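{- Let $$M(x)=\frac{ax+b}{cx+d}\in\mathbb{R}(x),\qquad a,b,c,d\in\mathbb{R},\quad ad-bc\neq0.$$ Then $M$ has Maillet's property if and only if $M\in\mathbb{Q}(x)$. Moreover, if $M\notin\mathbb{Q}(x)$, then every nonempty open interval contained in the domain of $M$ contains a Liouville number $\xi$ such that $M(\xi)$ is not a Liouville number.
   Context: A real number $\xi$ is a Liouville number if for every integer $N\ge 1$ there exist infinitely many pairs $(p,q)\in\mathbb{Z}\times\mathbb{Z}_{>0}$ with $q\ge 2$ such that $0<|\xi-p/q|<q^{ -N}$. A function has Maillet's property if it maps every Liouville number in its domain to a Liouville number. The domain of $M$ is $\{x\in\mathbb{R}:cx+d\ne0\}$. The condition $M\in\mathbb{Q}(x)$ means that, as an element of $\mathbb{R}(x)$, $M$ is a rational function with rational coefficients; equivalently, $(a,b,c,d)$ is a real scalar multiple of a vector in $\mathbb{Q}^4$. -}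

module Defs where

open import Algebra.Bundles using (CommutativeRing)
import Algebra.Definitions as AlgebraDefinitions
import Algebra.Definitions.RawMonoid as RawMonoidDefinitions
open import Data.Integer.Base using (ℤ; +_; -[1+_])
open import Data.List.Base using (List; []; _∷_; map)
open import Data.List.Membership.Propositional using (_∈_)
open import Data.Nat.Base as ℕ using (ℕ; zero; suc; NonZero)
open import Data.Nat.Properties using (m^n≢0)
open import Data.Product.Base using (∃; ∃-syntax; _×_; _,_; proj₁)
open import Data.Rational.Base using (ℚ; ↥_; ↧ₙ_)
open import Level using (0ℓ)
open import Relation.Binary.Core using (Rel)
open import Relation.Binary.Definitions using (tri<; tri≈; tri>)
open import Relation.Binary.Structures using (IsStrictTotalOrder)
import Relation.Binary.Construct.Add.Extrema.Strict as AddExtrema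
import Relation.Binary.Construct.StrictToNonStrict as StrictToNonStrict
open import Relation.Nullary.Construct.Add.Extrema using (_±; [_])
open import Relation.Nullary.Negation using (¬_)
open import Relation.Unary using (Pred; _⊆_; Satisfiable)

Finite : {A : Set} → Pred A 0ℓ → Set
Finite P = ∃[ xs ] P ⊆ (_∈ xs)

Infinite : {A : Set} → Pred A 0ℓ → Set
Infinite P = ¬ Finite P

-- The real numbers are given by their axioms.  The axioms are the classical
-- ones (trichotomy; suprema of arbitrary nonempty bounded predicates), so they
-- are meant to be used together with excluded middle, under which they
-- determine the field up to isomorphism.  Equality is a setoid equality, so
-- that Cauchy sequences of rationals, compared modulo null sequences, are an
-- instance.
record CompleteOrderedField : Set₁ where
  infix 4 _<_
  field
    commutativeRing : CommutativeRing 0ℓ 0ℓ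

  open CommutativeRing commutativeRing public

  field
    _<_                : Rel Carrier 0ℓ
    isStrictTotalOrder : IsStrictTotalOrder _≈_ _<_

  open IsStrictTotalOrder isStrictTotalOrder public
    using (compare; <-respˡ-≈; <-respʳ-≈; <-resp-≈)
    renaming (trans to <-trans; irrefl to <-irrefl; asym to <-asym)
  open StrictToNonStrict _≈_ _<_ public using (_≤_)
  open AlgebraDefinitions _≈_ public using (Invertible)

  UpperBound : Pred Carrier 0ℓ → Pred Carrier 0ℓ
  UpperBound P u = ∀ {x} → P x → x ≤ u

  field
    0<1            : 0# < 1#
    +-monoʳ-<      : ∀ z {x y} → x < y → z + x < z + y
    *-pos          : ∀ {x y} → 0# < x → 0# < y → 0# < x * y
    ≉0⇒invertible  : ∀ {x} → x ≉ 0# → Invertible 1# _*_ x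
    supremum       : (P : Pred Carrier 0ℓ) → Satisfiable P → ∃ (UpperBound P) →
                     ∃[ s ] UpperBound P s × (∀ {u} → UpperBound P u → s ≤ u)

module RealNumbers (ℝ : CompleteOrderedField) where
  open CompleteOrderedField ℝ
  open RawMonoidDefinitions +-rawMonoid using () renaming (_×_ to _×ℕ_)

  infixl 7 _÷_∵_ _/_

  _÷_∵_ : Carrier → (y : Carrier) → y ≉ 0# → Carrier
  x ÷ y ∵ y≉0 = x * proj₁ (≉0⇒invertible y≉0)

  ∣_∣ : Carrier → Carrier
  ∣ x ∣ with compare x 0#
  ... | tri< _ _ _ = - x
  ... | tri≈ _ _ _ = x
  ... | tri> _ _ _ = x

  fromℕ : ℕ → Carrier
  fromℕ n = n ×ℕ 1#

  fromℤ : ℤ → Carrier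
  fromℤ (+ n)    = fromℕ n
  fromℤ -[1+ n ] = - fromℕ (suc n)

  0<fromℕ-suc : ∀ n → 0# < fromℕ (suc n)
  0<fromℕ-suc zero    = <-respʳ-≈ (sym (+-identityʳ 1#)) 0<1
  0<fromℕ-suc (suc n) =
    <-trans 0<1 (<-respˡ-≈ (+-identityʳ 1#) (+-monoʳ-< 1# (0<fromℕ-suc n)))

  fromℕ≉0 : ∀ n .{{_ : NonZero n}} → fromℕ n ≉ 0#
  fromℕ≉0 (suc n) eq = <-irrefl (sym eq) (0<fromℕ-suc n)

  _/_ : ℤ → (q : ℕ) .{{_ : NonZero q}} → Carrier
  p / q = fromℤ p ÷ fromℕ q ∵ fromℕ≉0 q

  fromℚ : ℚ → Carrier
  fromℚ r = ↥ r / ↧ₙ r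

  infix 8 _^-_

  _^-_ : (q N : ℕ) .{{_ : NonZero q}} → Carrier
  q ^- N = _/_ (+ 1) (q ℕ.^ N) {{m^n≢0 q N}}

  -- q is stored as a natural number; q ≥ 2 makes it a positive integer.
  data Approximates (ξ : Carrier) (N : ℕ) : ℤ × ℕ → Set where
    approx : ∀ {p q} .{{_ : NonZero q}} → 2 ℕ.≤ q →
             0# < ∣ ξ - p / q ∣ → ∣ ξ - p / q ∣ < q ^- N →
             Approximates ξ N (p , q)

  Liouville : Pred Carrier 0ℓ
  Liouville ξ = ∀ N → 1 ℕ.≤ N → Infinite (Approximates ξ N)

  HasMailletProperty : (D : Pred Carrier 0ℓ) → (∀ x → D x → Carrier) → Set
  HasMailletProperty D f = ∀ ξ (ξ∈D : D ξ) → Liouville ξ → Liouville (f ξ ξ∈D)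

  -- Polynomials are lists of coefficients, constant term first; trailing zeros
  -- are allowed, whence the coefficientwise equality.
  Poly : Set
  Poly = List Carrier

  coeff : Poly → ℕ → Carrier
  coeff []      _       = 0#
  coeff (a ∷ _) zero    = a
  coeff (_ ∷ f) (suc n) = coeff f n

  infix  4 _≈ₚ_
  infixl 6 _+ₚ_
  infixl 7 _*ₚ_

  _≈ₚ_ : Rel Poly 0ℓ
  f ≈ₚ g = ∀ n → coeff f n ≈ coeff g n

  _+ₚ_ : Poly → Poly → Poly
  []      +ₚ g       = g
  (a ∷ f) +ₚ []      = a ∷ f
  (a ∷ f) +ₚ (b ∷ g) = a + b ∷ f +ₚ g

  _*ₚ_ : Poly → Poly → Poly
  []      *ₚ g = []
  (a ∷ f) *ₚ g = map (a *_) g +ₚ (0# ∷ f *ₚ g)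

  -- The fraction f/g, for g a nonzero polynomial, lies in the subfield ℚ(x) of
  -- ℝ(x): f/g = P/Q with P, Q ∈ ℚ[x] and Q ≠ 0, the equality of fractions being
  -- cross-multiplied.
  Fraction∈ℚ⟨x⟩ : (f g : Poly) → Set
  Fraction∈ℚ⟨x⟩ f g =
    ∃[ P ] ∃[ Q ] ¬ (map fromℚ Q ≈ₚ []) × f *ₚ map fromℚ Q ≈ₚ map fromℚ P *ₚ g

  -- Endpoints may be infinite.
  OpenInterval : (u v : Carrier ±) → Pred Carrier 0ℓ
  OpenInterval u v x = (u <± [ x ]) × ([ x ] <± v)
    where open AddExtrema _<_ using (_<±_)

  -- M(x) = (ax + b)/(cx + d)
  module Möbius (a b c d : Carrier) where

    Domain : Pred Carrier 0ℓ
    Domain x = c * x + d ≉ 0#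

    M : ∀ x → Domain x → Carrier
    M x x∈D = (a * x + b) ÷ (c * x + d) ∵ x∈D

    M∈ℚ⟨x⟩ : Set
    M∈ℚ⟨x⟩ = Fraction∈ℚ⟨x⟩ (b ∷ a ∷ []) (d ∷ c ∷ [])

{-# OPTIONS --safe #-}

-- If M ∈ ℚ(x), then M is given by an integer matrix and turns good approximations
-- p/q of ξ into approximations (Ap + Bq)/(Cp + Dq) of M(ξ) of comparable quality.
--
-- If M ∉ ℚ(x), then M takes a rational value s₀ at some irrational x₀ of the
-- interval, since three rational points with rational images would make M rational.
-- If x₀ is a Liouville number, we are done, as s₀ is not.  Otherwise x₀ has a finite
-- irrationality exponent, and this bounds how often rationals r of denominator q
-- can have images M(r) close to rationals s: three pairs (rᵢ , sᵢ) with denominators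
-- of comparable size would, by invariance of the cross-ratio, give a rational
-- solution of the equation determining x₀ from s₀, too close to x₀.  So among a few
-- neighbouring fractions of denominator q there is one, r, with M(r) far from all
-- rationals with denominators in a prescribed range up to a large power of q.
-- Alternating the choice of a tiny ball around such an r with the choice of a
-- subball whose image avoids the rationals of small denominator (at most one of
-- which is near the image of a given ball), one gets nested balls whose common
-- point ξ is a Liouville number, while M(ξ) has a finite irrationality exponent.
module Submission where

open import Algebra.Solver.Ring.AlmostCommutativeRing using (fromCommutativeRing; _-Raw-AlmostCommutative⟶_)
open import Axiom.ExcludedMiddle using (ExcludedMiddle)
open import Data.Empty using (⊥; ⊥-elim)
open import Data.Fin.Base as Fin using (Fin; toℕ; combine)
import Data.Fin.Properties as Fin
open import Data.Integer.Base as ℤ using (ℤ; +_; -[1+_])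
import Data.Integer.Properties as ℤ
open import Data.List.Base using (List; []; _∷_; map)
open import Data.List.Membership.Propositional using (_∈_)
open import Data.List.Relation.Unary.Any using (here; there)
open import Data.Maybe.Base using (Maybe; just; nothing)
open import Data.Nat.Base as ℕ using (ℕ; zero; suc; NonZero)
import Data.Nat.Coprimality as Coprimality
import Data.Nat.Properties as ℕ
import Data.Nat.Tactic.RingSolver as ℕ-Solver
open import Data.Product.Base using (∃; ∃-syntax; Σ-syntax; _×_; _,_; proj₁; proj₂)
open import Data.Rational.Base using (ℚ; mkℚ)
open import Data.Sum.Base using (_⊎_; inj₁; inj₂; [_,_]′)
open import Defs
open import Function.Bundles using (_⇔_; mk⇔)
open import Level using (0ℓ)
open import Relation.Binary.Bundles using (StrictPartialOrder; StrictTotalOrder)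
open import Relation.Binary.Definitions using (tri<; tri≈; tri>)
open import Relation.Binary.PropositionalEquality.Core as ≡ using (_≡_; _≢_)
open import Relation.Nullary.Construct.Add.Extrema using () renaming ([_] to ⟨_⟩)
open import Relation.Nullary.Decidable.Core using (Dec; yes; no)
open import Relation.Nullary.Negation using (¬_; contradiction)
open import Relation.Unary using (_⊆_; Satisfiable)
import Algebra.Properties.Monoid.Mult.TCOptimised
import Algebra.Properties.Ring
import Algebra.Properties.Semiring.Mult
import Algebra.Solver.Ring
import Relation.Binary.Construct.Add.Extrema.Strict as Extrema
import Relation.Binary.Construct.Add.Infimum.Strict as Infimum
import Relation.Binary.Construct.Add.Supremum.Strict as Supremum
import Relation.Binary.Properties.StrictTotalOrder
import Relation.Binary.Reasoning.StrictPartialOrder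

-- The obstacle is a conflict of scales. For ξ to be Liouville, the scale `t (suc n)` must be an
-- unbounded power of `t n`; but ∣M(ξ) - s∣ must stay above a fixed power of the denominator Q of s,
-- for every Q in between. Hence the intermediate bound `W = t ^ (2 ^ n)` and the next scale
-- `W ^ K`. For t ≤ Q < W the choice of r gives the bound; for W ≤ Q < W ^ K the next avoidance of
-- small denominators does, as its loss (W ^ K) ^ 4 is a fixed power of W ≤ Q. The first range
-- splits into n classes T ≤ Q ≤ T², and one class spoils at most two fractions, so their number
-- need only grow with n. The rational value s₀ makes the cross-ratio relation a linear equation for
-- x₀ with rational coefficients; the finite exponent κ of x₀ forces these to vanish, and K depends
-- on κ alone. The exponents 3, 4, 5 are nested: two balls of radius t⁻⁴ fit at distance t⁻³ in one
-- of radius t⁻³, and one of radius t⁻⁴ holds about t fractions of denominator t⁵.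

-- Ordered field arithmetic, absolute values, and a ring solver with integer coefficients.

module OrderedField (ℝ : CompleteOrderedField) where
  open CompleteOrderedField ℝ public
  open RealNumbers ℝ public renaming (fromℕ to ι; fromℤ to ιℤ)
  open Algebra.Properties.Ring ring public using (-0#≈0#; -‿involutive; -‿distribˡ-*)
  module Mult = Algebra.Properties.Semiring.Mult semiring
  module Mult′ = Algebra.Properties.Monoid.Mult.TCOptimised +-monoid

  strictTotalOrder : StrictTotalOrder 0ℓ 0ℓ 0ℓ
  strictTotalOrder = record { isStrictTotalOrder = isStrictTotalOrder }

  strictPartialOrder : StrictPartialOrder 0ℓ 0ℓ 0ℓ
  strictPartialOrder = StrictTotalOrder.strictPartialOrder strictTotalOrder

  module ≤-Reasoning = Relation.Binary.Reasoning.StrictPartialOrder strictPartialOrder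

  open Relation.Binary.Properties.StrictTotalOrder strictTotalOrder public
    using () renaming (refl to ≤-refl; trans to ≤-trans; antisym to ≤-antisym; total to ≤-total; _≤?_ to _≤?_)

  ι-+ : ∀ m n → ι (m ℕ.+ n) ≈ ι m + ι n
  ι-+ = Mult.×-homo-+ 1#

  ι-* : ∀ m n → ι (m ℕ.* n) ≈ ι m * ι n
  ι-* = Mult.×1-homo-*

  ι-cong : ∀ {m n} → m ≡ n → ι m ≈ ι n
  ι-cong ≡.refl = refl

  ι-1 : ι 1 ≈ 1#
  ι-1 = +-identityʳ 1#

  private
    +-elimˡ : ∀ {a b} m → (m + a) - (m + b) ≈ a - b
    +-elimˡ {a} {b} m = begin
      (m + a) + - (m + b)    ≈⟨ +-cong (+-comm m a) (sym (-‿+-comm m b)) ⟩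
      (a + m) + (- m + - b)  ≈⟨ +-assoc a m _ ⟩
      a + (m + (- m + - b))  ≈⟨ +-congˡ (sym (+-assoc m _ _)) ⟩
      a + ((m + - m) + - b)  ≈⟨ +-congˡ (+-congʳ (-‿inverseʳ m)) ⟩
      a + (0# + - b)         ≈⟨ +-congˡ (+-identityˡ _) ⟩
      a - b                  ∎
      where
      open Algebra.Properties.Ring ring using (-‿+-comm)
      open import Relation.Binary.Reasoning.Setoid setoid

  ιℤ-⊖ : ∀ m n → ιℤ (m ℤ.⊖ n) ≈ ι m - ι n
  ιℤ-⊖ m       zero    = sym (trans (+-congˡ -0#≈0#) (+-identityʳ _))
  ιℤ-⊖ zero    (suc n) = sym (+-identityˡ _)
  ιℤ-⊖ (suc m) (suc n) = begin
    ιℤ (suc m ℤ.⊖ suc n)     ≡⟨ ≡.cong ιℤ (ℤ.[1+m]⊖[1+n]≡m⊖n m n) ⟩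
    ιℤ (m ℤ.⊖ n)             ≈⟨ ιℤ-⊖ m n ⟩
    ι m - ι n                ≈⟨ sym (+-elimˡ 1#) ⟩
    ι (suc m) - ι (suc n)    ∎
    where open import Relation.Binary.Reasoning.Setoid setoid

  ιℤ-neg : ∀ i → ιℤ (ℤ.- i) ≈ - ιℤ i
  ιℤ-neg (+ zero)  = sym -0#≈0#
  ιℤ-neg (+ suc n) = refl
  ιℤ-neg -[1+ n ]  = sym (-‿involutive _)

  ιℤ-+ : ∀ i j → ιℤ (i ℤ.+ j) ≈ ιℤ i + ιℤ j
  ιℤ-+ (+ m)    (+ n)    = ι-+ m n
  ιℤ-+ (+ m)    -[1+ n ] = ιℤ-⊖ m (suc n)
  ιℤ-+ -[1+ m ] (+ n)    = trans (ιℤ-⊖ n (suc m)) (+-comm _ _)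
  ιℤ-+ -[1+ m ] -[1+ n ] = begin
    - ι (suc (suc (m ℕ.+ n)))     ≈⟨ -‿cong (ι-cong (≡.sym (ℕ.+-suc (suc m) n))) ⟩
    - ι (suc m ℕ.+ suc n)         ≈⟨ -‿cong (ι-+ (suc m) (suc n)) ⟩
    - (ι (suc m) + ι (suc n))     ≈⟨ sym (-‿+-comm _ _) ⟩
    - ι (suc m) + - ι (suc n)     ∎
    where
    open Algebra.Properties.Ring ring using (-‿+-comm)
    open import Relation.Binary.Reasoning.Setoid setoid

  private
    ιℤ-*-+ : ∀ m j → ιℤ (+ m ℤ.* j) ≈ ι m * ιℤ j
    ιℤ-*-+ zero    j = trans (reflexive (≡.cong ιℤ (ℤ.*-zeroˡ j))) (sym (zeroˡ _))
    ιℤ-*-+ (suc m) j = begin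
      ιℤ (+ suc m ℤ.* j)        ≡⟨ ≡.cong ιℤ (ℤ.suc-* (+ m) j) ⟩
      ιℤ (j ℤ.+ + m ℤ.* j)      ≈⟨ trans (ιℤ-+ j _) (+-congˡ (ιℤ-*-+ m j)) ⟩
      ιℤ j + ι m * ιℤ j         ≈⟨ +-congʳ (sym (*-identityˡ _)) ⟩
      1# * ιℤ j + ι m * ιℤ j    ≈⟨ sym (distribʳ _ _ _) ⟩
      ι (suc m) * ιℤ j          ∎
      where
      open import Relation.Binary.Reasoning.Setoid setoid

  ιℤ-* : ∀ i j → ιℤ (i ℤ.* j) ≈ ιℤ i * ιℤ j
  ιℤ-* (+ m)    j = ιℤ-*-+ m j
  ιℤ-* -[1+ m ] j = begin
    ιℤ (-[1+ m ] ℤ.* j)         ≡⟨ ≡.cong ιℤ (≡.sym (ℤ.neg-distribˡ-* (+ suc m) j)) ⟩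
    ιℤ (ℤ.- (+ suc m ℤ.* j))    ≈⟨ ιℤ-neg (+ suc m ℤ.* j) ⟩
    - ιℤ (+ suc m ℤ.* j)        ≈⟨ -‿cong (ιℤ-*-+ (suc m) j) ⟩
    - (ι (suc m) * ιℤ j)        ≈⟨ -‿distribˡ-* _ _ ⟩
    - ι (suc m) * ιℤ j          ∎
    where open import Relation.Binary.Reasoning.Setoid setoid

  private
    -- Integer constants of the ring solver; unlike ιℤ, this sends 1 to 1#
    -- definitionally.
    ⟦_⟧ℤ : ℤ → Carrier
    ⟦ + n      ⟧ℤ = n Mult′.× 1#
    ⟦ -[1+ n ] ⟧ℤ = - (suc n Mult′.× 1#)

    ⟦⟧ℤ≈ιℤ : ∀ i → ⟦ i ⟧ℤ ≈ ιℤ i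
    ⟦⟧ℤ≈ιℤ (+ n)    = sym (Mult′.×ᵤ≈× n 1#)
    ⟦⟧ℤ≈ιℤ -[1+ n ] = -‿cong (sym (Mult′.×ᵤ≈× (suc n) 1#))

    homomorphism : ℤ.+-*-rawRing -Raw-AlmostCommutative⟶ fromCommutativeRing commutativeRing
    homomorphism = record
      { ⟦_⟧    = ⟦_⟧ℤ
      ; +-homo = λ i j → trans (⟦⟧ℤ≈ιℤ (i ℤ.+ j)) (trans (ιℤ-+ i j) (sym (+-cong (⟦⟧ℤ≈ιℤ i) (⟦⟧ℤ≈ιℤ j))))
      ; *-homo = λ i j → trans (⟦⟧ℤ≈ιℤ (i ℤ.* j)) (trans (ιℤ-* i j) (sym (*-cong (⟦⟧ℤ≈ιℤ i) (⟦⟧ℤ≈ιℤ j))))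
      ; -‿homo = λ i → trans (⟦⟧ℤ≈ιℤ (ℤ.- i)) (trans (ιℤ-neg i) (-‿cong (sym (⟦⟧ℤ≈ιℤ i))))
      ; 0-homo = refl
      ; 1-homo = refl
      }

    _coeff≟_ : ∀ i j → Maybe (⟦ i ⟧ℤ ≈ ⟦ j ⟧ℤ)
    i coeff≟ j with i ℤ.≟ j
    ... | yes ≡.refl = just refl
    ... | no _       = nothing

  open Algebra.Solver.Ring ℤ.+-*-rawRing (fromCommutativeRing commutativeRing) homomorphism _coeff≟_ public
    using (solve; _:=_; _:+_; _:*_; _:-_; :-_; con)

  open StrictTotalOrder strictTotalOrder public using (_<?_; _≟_)

  private variable
    w x y z : Carrier

  <⇒≤ : x < y → x ≤ y
  <⇒≤ = inj₁

  ≤-reflexive : x ≈ y → x ≤ y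
  ≤-reflexive = inj₂

  >⇒≉ : y < x → x ≉ y
  >⇒≉ y<x x≈y = <-irrefl (sym x≈y) y<x

  <-≤-trans : x < y → y ≤ z → x < z
  <-≤-trans x<y (inj₁ y<z) = <-trans x<y y<z
  <-≤-trans x<y (inj₂ y≈z) = <-respʳ-≈ y≈z x<y

  ≤-<-trans : x ≤ y → y < z → x < z
  ≤-<-trans (inj₁ x<y) y<z = <-trans x<y y<z
  ≤-<-trans (inj₂ x≈y) y<z = <-respˡ-≈ (sym x≈y) y<z

  <⇒≱ : x < y → ¬ (y ≤ x)
  <⇒≱ x<y y≤x = <-irrefl refl (<-≤-trans x<y y≤x)

  ≰⇒> : ¬ (x ≤ y) → y < x
  ≰⇒> {x} {y} x≰y with compare x y
  ... | tri< x<y _ _ = contradiction (inj₁ x<y) x≰y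
  ... | tri≈ _ x≈y _ = contradiction (inj₂ x≈y) x≰y
  ... | tri> _ _ y<x = y<x

  ≮⇒≥ : ¬ (x < y) → y ≤ x
  ≮⇒≥ {x} {y} x≮y with compare x y
  ... | tri< x<y _ _ = contradiction x<y x≮y
  ... | tri≈ _ x≈y _ = inj₂ (sym x≈y)
  ... | tri> _ _ y<x = inj₁ y<x

  +-mono-< : w < x → y < z → w + y < x + z
  +-mono-< {w} {x} {y} {z} w<x y<z =
    <-trans (+-monoʳ-< w y<z)
            (<-respˡ-≈ (+-comm z w) (<-respʳ-≈ (+-comm z x) (+-monoʳ-< z w<x)))

  +-monoˡ-< : ∀ z → x < y → x + z < y + z
  +-monoˡ-< {x} {y} z x<y = <-respˡ-≈ (+-comm z x) (<-respʳ-≈ (+-comm z y) (+-monoʳ-< z x<y))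

  +-mono-≤ : w ≤ x → y ≤ z → w + y ≤ x + z
  +-mono-≤ (inj₁ w<x) (inj₁ y<z) = inj₁ (+-mono-< w<x y<z)
  +-mono-≤ (inj₁ w<x) (inj₂ y≈z) = inj₁ (<-respʳ-≈ (+-congˡ y≈z) (+-monoˡ-< _ w<x))
  +-mono-≤ (inj₂ w≈x) (inj₁ y<z) = inj₁ (<-respʳ-≈ (+-congʳ w≈x) (+-monoʳ-< _ y<z))
  +-mono-≤ (inj₂ w≈x) (inj₂ y≈z) = inj₂ (+-cong w≈x y≈z)

  +-mono-<-≤ : w < x → y ≤ z → w + y < x + z
  +-mono-<-≤ w<x (inj₁ y<z) = +-mono-< w<x y<z
  +-mono-<-≤ w<x (inj₂ y≈z) = <-respʳ-≈ (+-congˡ y≈z) (+-monoˡ-< _ w<x)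

  +-mono-≤-< : w ≤ x → y < z → w + y < x + z
  +-mono-≤-< (inj₁ w<x) y<z = +-mono-< w<x y<z
  +-mono-≤-< (inj₂ w≈x) y<z = <-respʳ-≈ (+-congʳ w≈x) (+-monoʳ-< _ y<z)

  -- The inequality x ≤ y follows from w ≤ z once y − x ≈ z − w is a ring
  -- identity; hypotheses are added up with +-mono-≤ beforehand.
  linear-≤ : w ≤ z → y - x ≈ z - w → x ≤ y
  linear-≤ {w} {z} {y} {x} w≤z eq = begin
    x             ≈⟨ solve 2 (λ x w → x := w :+ (x :- w)) refl x w ⟩
    w + (x - w)   ≤⟨ +-mono-≤ w≤z ≤-refl ⟩
    z + (x - w)   ≈⟨ solve 3 (λ z x w → z :+ (x :- w) := (z :- w) :+ x) refl z x w ⟩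
    (z - w) + x   ≈⟨ +-congʳ (sym eq) ⟩
    (y - x) + x   ≈⟨ solve 2 (λ x y → (y :- x) :+ x := y) refl x y ⟩
    y             ∎
    where open ≤-Reasoning

  linear-< : w < z → y - x ≈ z - w → x < y
  linear-< {w} {z} {y} {x} w<z eq = begin-strict
    x             ≈⟨ solve 2 (λ x w → x := w :+ (x :- w)) refl x w ⟩
    w + (x - w)   <⟨ +-mono-<-≤ w<z ≤-refl ⟩
    z + (x - w)   ≈⟨ solve 3 (λ z x w → z :+ (x :- w) := (z :- w) :+ x) refl z x w ⟩
    (z - w) + x   ≈⟨ +-congʳ (sym eq) ⟩
    (y - x) + x   ≈⟨ solve 2 (λ x y → (y :- x) :+ x := y) refl x y ⟩
    y             ∎
    where open ≤-Reasoning

  0<y-x : x < y → 0# < y - x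
  0<y-x {x} {y} x<y = linear-< x<y (solve 2 (λ x y → y :- x :- con (+ 0) := y :- x) refl x y)

  0≤y-x : x ≤ y → 0# ≤ y - x
  0≤y-x {x} {y} x≤y = linear-≤ x≤y (solve 2 (λ x y → y :- x :- con (+ 0) := y :- x) refl x y)

  neg-mono-≤ : x ≤ y → - y ≤ - x
  neg-mono-≤ {x} {y} x≤y = linear-≤ x≤y (solve 2 (λ x y → :- x :- :- y := y :- x) refl x y)

  *-nonNeg : 0# ≤ x → 0# ≤ y → 0# ≤ x * y
  *-nonNeg (inj₁ 0<x) (inj₁ 0<y) = inj₁ (*-pos 0<x 0<y)
  *-nonNeg (inj₁ 0<x) (inj₂ 0≈y) = inj₂ (sym (trans (*-congˡ (sym 0≈y)) (zeroʳ _)))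
  *-nonNeg (inj₂ 0≈x) 0≤y        = inj₂ (sym (trans (*-congʳ (sym 0≈x)) (zeroˡ _)))

  *-monoˡ-≤ : ∀ z → 0# ≤ z → x ≤ y → z * x ≤ z * y
  *-monoˡ-≤ {x} {y} z 0≤z x≤y = linear-≤ (*-nonNeg 0≤z (0≤y-x x≤y))
    (solve 3 (λ x y z → z :* y :- z :* x := z :* (y :- x) :- con (+ 0)) refl x y z)

  *-monoʳ-≤ : ∀ z → 0# ≤ z → x ≤ y → x * z ≤ y * z
  *-monoʳ-≤ {x} {y} z 0≤z x≤y = linear-≤ (*-nonNeg 0≤z (0≤y-x x≤y))
    (solve 3 (λ x y z → y :* z :- x :* z := z :* (y :- x) :- con (+ 0)) refl x y z)

  *-monoˡ-< : ∀ z → 0# < z → x < y → z * x < z * y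
  *-monoˡ-< {x} {y} z 0<z x<y = linear-< (*-pos 0<z (0<y-x x<y))
    (solve 3 (λ x y z → z :* y :- z :* x := z :* (y :- x) :- con (+ 0)) refl x y z)

  *-monoʳ-< : ∀ z → 0# < z → x < y → x * z < y * z
  *-monoʳ-< {x} {y} z 0<z x<y = <-respˡ-≈ (*-comm z x) (<-respʳ-≈ (*-comm z y) (*-monoˡ-< z 0<z x<y))

  *-mono-≤ : 0# ≤ w → 0# ≤ z → w ≤ x → y ≤ z → w * y ≤ x * z
  *-mono-≤ 0≤w 0≤z w≤x y≤z = ≤-trans (*-monoˡ-≤ _ 0≤w y≤z) (*-monoʳ-≤ _ 0≤z w≤x)

  *-cancelˡ-≤ : ∀ z → 0# < z → z * x ≤ z * y → x ≤ y
  *-cancelˡ-≤ z 0<z zx≤zy = ≮⇒≥ λ y<x → <⇒≱ (*-monoˡ-< z 0<z y<x) zx≤zy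

  *-cancelˡ-< : ∀ z → 0# < z → z * x < z * y → x < y
  *-cancelˡ-< z 0<z zx<zy = ≰⇒> λ y≤x → <⇒≱ zx<zy (*-monoˡ-≤ z (<⇒≤ 0<z) y≤x)

  +-pos : 0# < x → 0# < y → 0# < x + y
  +-pos 0<x 0<y = <-respˡ-≈ (+-identityˡ 0#) (+-mono-< 0<x 0<y)

  +-nonNeg : 0# ≤ x → 0# ≤ y → 0# ≤ x + y
  +-nonNeg 0≤x 0≤y = ≤-trans (≤-reflexive (sym (+-identityˡ 0#))) (+-mono-≤ 0≤x 0≤y)

  0<2 : 0# < 1# + 1#
  0<2 = +-pos 0<1 0<1

  0≤ι : ∀ n → 0# ≤ ι n
  0≤ι zero    = ≤-refl
  0≤ι (suc n) = <⇒≤ (0<fromℕ-suc n)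

  0<ι : ∀ {n} → 0 ℕ.< n → 0# < ι n
  0<ι {suc n} _ = 0<fromℕ-suc n

  ι-mono-≤ : ∀ {m n} → m ℕ.≤ n → ι m ≤ ι n
  ι-mono-≤ {n = n} ℕ.z≤n = 0≤ι n
  ι-mono-≤ (ℕ.s≤s m≤n)   = +-mono-≤ ≤-refl (ι-mono-≤ m≤n)

  ι-mono-< : ∀ {m n} → m ℕ.< n → ι m < ι n
  ι-mono-< {m} m<n = <-≤-trans (linear-< 0<1 (solve 1 (λ x → con (+ 1) :+ x :- x := con (+ 1) :- con (+ 0)) refl (ι m)))
                               (ι-mono-≤ m<n)

  1≤ι : ∀ {n} → 0 ℕ.< n → 1# ≤ ι n
  1≤ι 0<n = ≤-trans (≤-reflexive (sym ι-1)) (ι-mono-≤ 0<n)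

  abs-cases : ∀ x → (0# ≤ x × ∣ x ∣ ≡ x) ⊎ (x < 0# × ∣ x ∣ ≡ - x)
  abs-cases x with compare x 0#
  ... | tri< x<0 _ _ = inj₂ (x<0 , ≡.refl)
  ... | tri≈ _ x≈0 _ = inj₁ (inj₂ (sym x≈0) , ≡.refl)
  ... | tri> _ _ 0<x = inj₁ (inj₁ 0<x , ≡.refl)

  0≤∣x∣ : ∀ x → 0# ≤ ∣ x ∣
  0≤∣x∣ x with abs-cases x
  ... | inj₁ (0≤x , eq) rewrite eq = 0≤x
  ... | inj₂ (x<0 , eq) rewrite eq = ≤-trans (≤-reflexive (sym -0#≈0#)) (neg-mono-≤ (<⇒≤ x<0))

  x≤∣x∣ : ∀ x → x ≤ ∣ x ∣
  x≤∣x∣ x with abs-cases x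
  ... | inj₁ (0≤x , eq) rewrite eq = ≤-refl
  ... | inj₂ (x<0 , eq) rewrite eq = ≤-trans (<⇒≤ x<0) (≤-trans (≤-reflexive (sym -0#≈0#)) (neg-mono-≤ (<⇒≤ x<0)))

  -x≤∣x∣ : ∀ x → - x ≤ ∣ x ∣
  -x≤∣x∣ x with abs-cases x
  ... | inj₁ (0≤x , eq) rewrite eq = ≤-trans (neg-mono-≤ 0≤x) (≤-trans (≤-reflexive -0#≈0#) 0≤x)
  ... | inj₂ (x<0 , eq) rewrite eq = ≤-refl

  abs-≤ : x ≤ y → - x ≤ y → ∣ x ∣ ≤ y
  abs-≤ {x} x≤y -x≤y with abs-cases x
  ... | inj₁ (_ , eq) rewrite eq = x≤y
  ... | inj₂ (_ , eq) rewrite eq = -x≤y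

  abs-unique : 0# ≤ y → (x ≈ y) ⊎ (x ≈ - y) → ∣ x ∣ ≈ y
  abs-unique {y} {x} 0≤y (inj₁ x≈y) = ≤-antisym
    (abs-≤ (≤-reflexive x≈y) (≤-trans (neg-mono-≤ (≤-trans 0≤y (≤-reflexive (sym x≈y)))) (≤-trans (≤-reflexive -0#≈0#) 0≤y)))
    (≤-trans (≤-reflexive (sym x≈y)) (x≤∣x∣ x))
  abs-unique {y} {x} 0≤y (inj₂ x≈-y) = ≤-antisym
    (abs-≤ (≤-trans (≤-reflexive x≈-y) (≤-trans (neg-mono-≤ 0≤y) (≤-trans (≤-reflexive -0#≈0#) 0≤y))) (≤-reflexive -x≈y))
    (≤-trans (≤-reflexive (sym -x≈y)) (-x≤∣x∣ x))
    where
    -x≈y : - x ≈ y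
    -x≈y = trans (-‿cong x≈-y) (-‿involutive y)

  abs-cong : x ≈ y → ∣ x ∣ ≈ ∣ y ∣
  abs-cong {x} {y} x≈y = abs-unique (0≤∣x∣ y) (lemma (abs-cases y))
    where
    lemma : (0# ≤ y × ∣ y ∣ ≡ y) ⊎ (y < 0# × ∣ y ∣ ≡ - y) → (x ≈ ∣ y ∣) ⊎ (x ≈ - ∣ y ∣)
    lemma (inj₁ (_ , eq)) rewrite eq = inj₁ x≈y
    lemma (inj₂ (_ , eq)) rewrite eq = inj₂ (trans x≈y (sym (-‿involutive y)))

  abs-nonNeg : 0# ≤ x → ∣ x ∣ ≈ x
  abs-nonNeg 0≤x = abs-unique 0≤x (inj₁ refl)

  x≈0⇒∣x∣≈0 : x ≈ 0# → ∣ x ∣ ≈ 0#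
  x≈0⇒∣x∣≈0 x≈0 = trans (abs-cong x≈0) (abs-nonNeg ≤-refl)

  abs-sign : ∀ x → (x ≈ ∣ x ∣) ⊎ (x ≈ - ∣ x ∣)
  abs-sign x with abs-cases x
  ... | inj₁ (_ , eq) rewrite eq = inj₁ refl
  ... | inj₂ (_ , eq) rewrite eq = inj₂ (sym (-‿involutive x))

  abs-neg : ∀ x → ∣ - x ∣ ≈ ∣ x ∣
  abs-neg x = abs-unique (0≤∣x∣ x) ([ (λ eq → inj₂ (-‿cong eq)) , (λ eq → inj₁ (trans (-‿cong eq) (-‿involutive _))) ]′ (abs-sign x))

  abs-swap : ∀ x y → ∣ x - y ∣ ≈ ∣ y - x ∣
  abs-swap x y = trans (abs-cong (solve 2 (λ x y → x :- y := :- (y :- x)) refl x y)) (abs-neg _)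

  abs-* : ∀ x y → ∣ x * y ∣ ≈ ∣ x ∣ * ∣ y ∣
  abs-* x y = abs-unique (*-nonNeg (0≤∣x∣ x) (0≤∣x∣ y)) (lemma (abs-sign x) (abs-sign y))
    where
    lemma : (x ≈ ∣ x ∣) ⊎ (x ≈ - ∣ x ∣) → (y ≈ ∣ y ∣) ⊎ (y ≈ - ∣ y ∣) →
            (x * y ≈ ∣ x ∣ * ∣ y ∣) ⊎ (x * y ≈ - (∣ x ∣ * ∣ y ∣))
    lemma (inj₁ p) (inj₁ q) = inj₁ (*-cong p q)
    lemma (inj₁ p) (inj₂ q) = inj₂ (trans (*-cong p q) (solve 2 (λ x y → x :* :- y := :- (x :* y)) refl ∣ x ∣ ∣ y ∣))
    lemma (inj₂ p) (inj₁ q) = inj₂ (trans (*-cong p q) (solve 2 (λ x y → :- x :* y := :- (x :* y)) refl ∣ x ∣ ∣ y ∣))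
    lemma (inj₂ p) (inj₂ q) = inj₁ (trans (*-cong p q) (solve 2 (λ x y → :- x :* :- y := x :* y) refl ∣ x ∣ ∣ y ∣))

  triangle : ∀ x y → ∣ x + y ∣ ≤ ∣ x ∣ + ∣ y ∣
  triangle x y = abs-≤ (+-mono-≤ (x≤∣x∣ x) (x≤∣x∣ y))
    (≤-trans (≤-reflexive (solve 2 (λ x y → :- (x :+ y) := :- x :+ :- y) refl x y)) (+-mono-≤ (-x≤∣x∣ x) (-x≤∣x∣ y)))

  triangle-− : ∀ x y → ∣ x - y ∣ ≤ ∣ x ∣ + ∣ y ∣
  triangle-− x y = ≤-trans (triangle x (- y)) (+-mono-≤ ≤-refl (≤-reflexive (abs-neg y)))

  x≤x+∣y∣ : ∀ x y → x ≤ x + ∣ y ∣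
  x≤x+∣y∣ x y = ≤-trans (≤-reflexive (sym (+-identityʳ x))) (+-mono-≤ ≤-refl (0≤∣x∣ y))

  triangle-via : ∀ z → ∣ x - y ∣ ≤ ∣ x - z ∣ + ∣ z - y ∣
  triangle-via {x} {y} z = ≤-trans
    (≤-reflexive (abs-cong (solve 3 (λ x y z → x :- y := (x :- z) :+ (z :- y)) refl x y z)))
    (triangle (x - z) (z - y))

  abs-bound : ∣ x ∣ ≤ y → - y ≤ x × x ≤ y
  abs-bound {x} {y} ∣x∣≤y =
      linear-≤ (≤-trans (-x≤∣x∣ x) ∣x∣≤y) (solve 2 (λ x y → x :- :- y := y :- :- x) refl x y)
    , ≤-trans (x≤∣x∣ x) ∣x∣≤y

  x≉0⇒0<∣x∣ : x ≉ 0# → 0# < ∣ x ∣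
  x≉0⇒0<∣x∣ {x} x≉0 = ≰⇒> λ ∣x∣≤0 → x≉0 (≤-antisym (≤-trans (x≤∣x∣ x) ∣x∣≤0)
    (linear-≤ (≤-trans (-x≤∣x∣ x) ∣x∣≤0) (solve 1 (λ x → x :- con (+ 0) := con (+ 0) :- :- x) refl x)))

  0<∣x∣⇒x≉0 : 0# < ∣ x ∣ → x ≉ 0#
  0<∣x∣⇒x≉0 0<∣x∣ x≈0 = <-irrefl (sym (x≈0⇒∣x∣≈0 x≈0)) 0<∣x∣

  x-y≈0⇒x≈y : x - y ≈ 0# → x ≈ y
  x-y≈0⇒x≈y {x} {y} eq = trans (solve 2 (λ x y → x := (x :- y) :+ y) refl x y) (trans (+-congʳ eq) (+-identityˡ y))

  x≈y⇒x-y≈0 : x ≈ y → x - y ≈ 0#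
  x≈y⇒x-y≈0 {x} {y} eq = trans (+-congʳ eq) (-‿inverseʳ y)

  recip : (x : Carrier) → x ≉ 0# → Carrier
  recip x x≉0 = proj₁ (≉0⇒invertible x≉0)

  *-recip : (x≉0 : x ≉ 0#) → x * recip x x≉0 ≈ 1#
  *-recip x≉0 = proj₂ (proj₂ (≉0⇒invertible x≉0))

  *-cancelˡ : x ≉ 0# → x * y ≈ x * z → y ≈ z
  *-cancelˡ {x} {y} {z} x≉0 eq = begin
    y                    ≈⟨ sym (*-identityˡ y) ⟩
    1# * y               ≈⟨ *-congʳ (sym (*-recip x≉0)) ⟩
    x * recip x x≉0 * y  ≈⟨ solve 3 (λ x r y → x :* r :* y := r :* (x :* y)) refl x _ y ⟩
    recip x x≉0 * (x * y) ≈⟨ *-congˡ eq ⟩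
    recip x x≉0 * (x * z) ≈⟨ solve 3 (λ x r y → r :* (x :* y) := x :* r :* y) refl x _ z ⟩
    x * recip x x≉0 * z  ≈⟨ *-congʳ (*-recip x≉0) ⟩
    1# * z               ≈⟨ *-identityˡ z ⟩
    z                    ∎
    where open import Relation.Binary.Reasoning.Setoid setoid

  x*y≈0⇒x≈0∨y≈0 : x * y ≈ 0# → (x ≈ 0#) ⊎ (y ≈ 0#)
  x*y≈0⇒x≈0∨y≈0 {x} {y} eq with compare x 0#
  ... | tri≈ _ x≈0 _ = inj₁ x≈0
  ... | tri< _ x≉0 _ = inj₂ (*-cancelˡ x≉0 (trans eq (sym (zeroʳ x))))
  ... | tri> _ x≉0 _ = inj₂ (*-cancelˡ x≉0 (trans eq (sym (zeroʳ x))))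

  *-≉0 : x ≉ 0# → y ≉ 0# → x * y ≉ 0#
  *-≉0 x≉0 y≉0 eq = [ x≉0 , y≉0 ]′ (x*y≈0⇒x≈0∨y≈0 eq)

  recip-pos : (0<x : 0# < x) → 0# < recip x (>⇒≉ 0<x)
  recip-pos {x} 0<x = *-cancelˡ-< x 0<x (<-respˡ-≈ (sym (zeroʳ x)) (<-respʳ-≈ (sym (*-recip (>⇒≉ 0<x))) 0<1))

n<2^n : ∀ n → n ℕ.< 2 ℕ.^ n
n<2^n zero    = ℕ.s≤s ℕ.z≤n
n<2^n (suc n) = begin-strict
  suc n                        ≤⟨ n<2^n n ⟩
  2 ℕ.^ n                      <⟨ ℕ.m<m+n (2 ℕ.^ n) (ℕ.m^n>0 2 n) ⟩
  2 ℕ.^ n ℕ.+ 2 ℕ.^ n          ≡⟨ ≡.cong (2 ℕ.^ n ℕ.+_) (≡.sym (ℕ.+-identityʳ _)) ⟩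
  2 ℕ.^ suc n                  ∎
  where open ℕ.≤-Reasoning

-- Integers and denominators in the reals; Liouville numbers through one approximation per order.

module Archimedean (em : ExcludedMiddle 0ℓ) (ℝ : CompleteOrderedField) where
  open OrderedField ℝ public

  private variable
    x y ξ : Carrier
    m n : ℕ

  -- Otherwise the naturals have a supremum s, and s - 1 is an upper bound too, because n + 1 ≤ s
  -- for every n.
  archimedean : ∀ x → ∃[ n ] x < ι n
  archimedean x with em {P = ∃[ n ] x < ι n}
  ... | yes p = p
  ... | no ¬p = contradiction (least bound) (<⇒≱ s-1<s)
    where
    naturals : Carrier → Set
    naturals y = ∃[ n ] y ≈ ι n
    sup = supremum naturals (ι 0 , 0 , refl)
      (x , λ (n , y≈n) → ≮⇒≥ λ x<y → ¬p (n , <-respʳ-≈ y≈n x<y))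
    s = proj₁ sup
    upper = proj₁ (proj₂ sup)
    least = proj₂ (proj₂ sup)
    bound : UpperBound naturals (s - 1#)
    bound {y} (n , y≈n) = linear-≤ (upper {ι (suc n)} (suc n , refl))
      (trans (+-congˡ (-‿cong y≈n)) (solve 2 (λ s n → s :- con (+ 1) :- n := s :- (con (+ 1) :+ n)) refl s (ι n)))
    s-1<s : s - 1# < s
    s-1<s = linear-< 0<1 (solve 1 (λ s → s :- (s :- con (+ 1)) := con (+ 1) :- con (+ 0)) refl s)

  -- A power of two is wanted because 2 ^ n ≤ q ^ n for every q ≥ 2, so that a constant can be
  -- absorbed in an exponent of q.
  archimedean₂ : 0# < x → ∃[ n ] 1# ≤ ι (2 ℕ.^ n) * x
  archimedean₂ {x} 0<x with archimedean (recip x (>⇒≉ 0<x))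
  ... | n , x⁻¹<n = n , ≤-trans (≤-reflexive (sym (trans (*-comm _ x) (*-recip (>⇒≉ 0<x)))))
          (*-monoʳ-≤ x (<⇒≤ 0<x) (<⇒≤ (<-≤-trans x⁻¹<n (ι-mono-≤ (ℕ.<⇒≤ (n<2^n n))))))

  floor : ∀ x → ∃[ p ] ιℤ p ≤ x × x < ιℤ p + 1#
  floor x with archimedean x | archimedean (- x)
  -- Since -b ≤ x < a, at most b + a unit steps upwards from -b are needed.
  ... | a , x<a | b , -x<b = search (b ℕ.+ a) (ℤ.- (+ b))
      (linear-≤ (<⇒≤ -x<b) (trans (+-congˡ (-‿cong (ιℤ-neg (+ b)))) (solve 2 (λ x b → x :- :- b := b :- :- x) refl x (ι b))))
      (linear-< x<a (trans (+-congʳ (+-cong (ιℤ-neg (+ b)) (ι-+ b a))) (solve 3 (λ x a b → :- b :+ (b :+ a) :- x := a :- x) refl x (ι a) (ι b))))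
    where
    search : ∀ n p → ιℤ p ≤ x → x < ιℤ p + ι n → ∃[ p ] ιℤ p ≤ x × x < ιℤ p + 1#
    search zero    p p≤x x<p+n = contradiction p≤x (<⇒≱ (<-respʳ-≈ (+-identityʳ _) x<p+n))
    search (suc n) p p≤x x<p+n with (ιℤ p + 1#) ≤? x
    ... | no  p+1≰x = p , p≤x , ≰⇒> p+1≰x
    ... | yes p+1≤x = search n (p ℤ.+ + 1)
            (≤-trans (≤-reflexive p+1≈) p+1≤x)
            (<-respʳ-≈ (trans (sym (+-assoc _ _ _)) (+-congʳ (sym p+1≈))) x<p+n)
      where
      p+1≈ : ιℤ (p ℤ.+ + 1) ≈ ιℤ p + 1#
      p+1≈ = trans (ιℤ-+ p (+ 1)) (+-congˡ ι-1)

  IsInteger : Carrier → Set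
  IsInteger x = ∃[ p ] x ≈ ιℤ p

  integer-+ : IsInteger x → IsInteger y → IsInteger (x + y)
  integer-+ (p , x≈p) (q , y≈q) = p ℤ.+ q , trans (+-cong x≈p y≈q) (sym (ιℤ-+ p q))

  integer-* : IsInteger x → IsInteger y → IsInteger (x * y)
  integer-* (p , x≈p) (q , y≈q) = p ℤ.* q , trans (*-cong x≈p y≈q) (sym (ιℤ-* p q))

  integer-neg : IsInteger x → IsInteger (- x)
  integer-neg (p , x≈p) = ℤ.- p , trans (-‿cong x≈p) (sym (ιℤ-neg p))

  integer-− : IsInteger x → IsInteger y → IsInteger (x - y)
  integer-− ix iy = integer-+ ix (integer-neg iy)

  integer-ι : ∀ n → IsInteger (ι n)
  integer-ι n = + n , refl

  integer-resp : x ≈ y → IsInteger x → IsInteger y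
  integer-resp x≈y (p , x≈p) = p , trans (sym x≈y) x≈p

  ∣ιℤ∣ : ∀ p → ∣ ιℤ p ∣ ≈ ι ℤ.∣ p ∣
  ∣ιℤ∣ (+ n)    = abs-nonNeg (0≤ι n)
  ∣ιℤ∣ -[1+ n ] = trans (abs-neg _) (abs-nonNeg (0≤ι (suc n)))

  integer-≥1 : IsInteger x → x ≉ 0# → 1# ≤ ∣ x ∣
  integer-≥1 (p , x≈p) x≉0 = ≤-trans (1≤ι {ℤ.∣ p ∣} (ℕ.n≢0⇒n>0 λ ∣p∣≡0 →
      x≉0 (trans x≈p (reflexive (≡.cong ιℤ (ℤ.∣i∣≡0⇒i≡0 {p} ∣p∣≡0))))))
    (≤-reflexive (sym (trans (abs-cong x≈p) (∣ιℤ∣ p))))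

  -- Here n is any multiple of the reduced denominator, so that denominators can simply be
  -- multiplied. The case n = 0 carries no information; positivity is demanded where it matters. The
  -- record wrapper keeps n and x inferable.
  record Den (n : ℕ) (x : Carrier) : Set where
    constructor den
    field integer : IsInteger (ι n * x)

  open Den public

  den-resp : x ≈ y → Den n x → Den n y
  den-resp x≈y (den i) = den (integer-resp (*-congˡ x≈y) i)

  den-scale : ∀ m → Den n x → Den (m ℕ.* n) x
  den-scale {n} {x} m (den i) = den (integer-resp
    (trans (sym (*-assoc _ _ _)) (*-congʳ (sym (ι-* m n)))) (integer-* (integer-ι m) i))

  den-+ : Den n x → Den n y → Den n (x + y)
  den-+ (den i) (den j) = den (integer-resp (sym (distribˡ _ _ _)) (integer-+ i j))

  den-neg : Den n x → Den n (- x)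
  den-neg {n} {x} (den i) = den (integer-resp (solve 2 (λ n x → :- (n :* x) := n :* :- x) refl (ι n) x) (integer-neg i))

  den-− : Den n x → Den n y → Den n (x - y)
  den-− dx dy = den-+ dx (den-neg dy)

  den-* : Den m x → Den n y → Den (m ℕ.* n) (x * y)
  den-* {m} {x} {n} {y} (den i) (den j) = den (integer-resp
    (trans (solve 4 (λ m n x y → (m :* x) :* (n :* y) := m :* n :* (x :* y)) refl (ι m) (ι n) x y) (*-congʳ (sym (ι-* m n))))
    (integer-* i j))

  den-−-* : Den m x → Den n y → Den (m ℕ.* n) (x - y)
  den-−-* {m} {x} {n} {y} dx dy = den-− (≡.subst (λ k → Den k x) (ℕ.*-comm n m) (den-scale n dx)) (den-scale m dy)

  -- Multiplied by `m * n`, the difference becomes a nonzero integer.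
  den-gap : Den m x → Den n y → x ≉ y → 0 ℕ.< m → 0 ℕ.< n → 1# ≤ ι (m ℕ.* n) * ∣ x - y ∣
  den-gap {m} {x} {n} {y} dx dy x≉y 0<m 0<n = ≤-trans
    (integer-≥1 (integer (den-−-* dx dy))
      (*-≉0 (>⇒≉ (0<ι (ℕ.*-mono-≤ 0<m 0<n))) λ eq → x≉y (x-y≈0⇒x≈y eq)))
    (≤-reflexive (trans (abs-* _ _) (*-congʳ (abs-nonNeg (0≤ι (m ℕ.* n))))))

  module _ (p : ℤ) (q : ℕ) .{{_ : NonZero q}} where
    q*[p/q]≈p : ι q * (p / q) ≈ ιℤ p
    q*[p/q]≈p = begin
      ι q * (ιℤ p * _)   ≈⟨ solve 3 (λ q p r → q :* (p :* r) := p :* (q :* r)) refl (ι q) (ιℤ p) _ ⟩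
      ιℤ p * (ι q * _)   ≈⟨ *-congˡ (*-recip (fromℕ≉0 q)) ⟩
      ιℤ p * 1#          ≈⟨ *-identityʳ _ ⟩
      ιℤ p               ∎
      where open import Relation.Binary.Reasoning.Setoid setoid

    den-/ : Den q (p / q)
    den-/ = den (p , q*[p/q]≈p)

    q∣ξ-p/q∣ : ∀ ξ → ι q * ∣ ξ - p / q ∣ ≈ ∣ ι q * ξ - ιℤ p ∣
    q∣ξ-p/q∣ ξ = begin
      ι q * ∣ ξ - p / q ∣         ≈⟨ *-congʳ (sym (abs-nonNeg (0≤ι q))) ⟩
      ∣ ι q ∣ * ∣ ξ - p / q ∣     ≈⟨ sym (abs-* _ _) ⟩
      ∣ ι q * (ξ - p / q) ∣       ≈⟨ abs-cong (solve 3 (λ q x y → q :* (x :- y) := q :* x :- q :* y) refl (ι q) ξ _) ⟩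
      ∣ ι q * ξ - ι q * (p / q) ∣ ≈⟨ abs-cong (+-congˡ (-‿cong q*[p/q]≈p)) ⟩
      ∣ ι q * ξ - ιℤ p ∣          ∎
      where open import Relation.Binary.Reasoning.Setoid setoid

  q^N*q^-N≈1 : ∀ q N .{{_ : NonZero q}} → ι (q ℕ.^ N) * q ^- N ≈ 1#
  q^N*q^-N≈1 q N = trans (q*[p/q]≈p (+ 1) (q ℕ.^ N) {{ℕ.m^n≢0 q N}}) ι-1

  -- The error is ∣ q ξ - p ∣ instead of ∣ ξ - p / q ∣, which removes the division and shifts the
  -- order N by at most one.
  Close : Carrier → ℕ → ℤ → ℕ → Set
  Close ξ N p q = 0# < ∣ ι q * ξ - ιℤ p ∣ × ι (q ℕ.^ N) * ∣ ι q * ξ - ιℤ p ∣ < 1#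

  -- One pair for each order is enough to work with; infinitude is recovered in
  -- `wellApproximable⇒liouville`.
  WellApproximable : Carrier → Set
  WellApproximable ξ = ∀ N → ∃[ p ] ∃[ q ] 2 ℕ.≤ q × Close ξ N p q

  private
    0<-≥2 : 2 ℕ.≤ n → 0 ℕ.< n
    0<-≥2 = ℕ.≤-trans (ℕ.s≤s ℕ.z≤n)

  approximates⇒close : ∀ {N p q} → Approximates ξ (suc N) (p , q) → 2 ℕ.≤ q × Close ξ N p q
  approximates⇒close {ξ} {N} {p} {q} (approx 2≤q 0<δ δ<) = 2≤q
    , <-respʳ-≈ (q∣ξ-p/q∣ p q ξ) (*-pos (0<ι (0<-≥2 2≤q)) 0<δ)
    , (begin-strict
        ι (q ℕ.^ N) * ∣ ι q * ξ - ιℤ p ∣        ≈⟨ *-congˡ (sym (q∣ξ-p/q∣ p q ξ)) ⟩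
        ι (q ℕ.^ N) * (ι q * ∣ ξ - p / q ∣)     ≈⟨ solve 3 (λ x y z → x :* (y :* z) := y :* x :* z) refl _ (ι q) _ ⟩
        ι q * ι (q ℕ.^ N) * ∣ ξ - p / q ∣       ≈⟨ *-congʳ (sym (ι-* q (q ℕ.^ N))) ⟩
        ι (q ℕ.^ suc N) * ∣ ξ - p / q ∣         <⟨ *-monoˡ-< _ (0<ι (ℕ.m^n>0 q (suc N))) δ< ⟩
        ι (q ℕ.^ suc N) * q ^- suc N            ≈⟨ q^N*q^-N≈1 q (suc N) ⟩
        1#                                      ∎)
    where open ≤-Reasoning

  close⇒approximates : ∀ {N p q} → 2 ℕ.≤ q → Close ξ N p q → Approximates ξ N (p , q)
  close⇒approximates {ξ} {N} {p} {suc q′} 2≤q (0<δ , δ<) = approx 2≤q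
    (*-cancelˡ-< (ι q) 0<q (<-respˡ-≈ (sym (zeroʳ _)) (<-respʳ-≈ (sym (q∣ξ-p/q∣ p q ξ)) 0<δ)))
    (*-cancelˡ-< (ι (q ℕ.^ N)) (0<ι (ℕ.m^n>0 q N)) (begin-strict
      ι (q ℕ.^ N) * ∣ ξ - p / q ∣             ≤⟨ *-monoˡ-≤ _ (0≤ι (q ℕ.^ N)) δ≤qδ ⟩
      ι (q ℕ.^ N) * ∣ ι q * ξ - ιℤ p ∣        <⟨ δ< ⟩
      1#                                      ≈⟨ sym (q^N*q^-N≈1 q N) ⟩
      ι (q ℕ.^ N) * q ^- N                    ∎))
    where
    open ≤-Reasoning
    q = suc q′
    0<q = 0<ι {q} (0<-≥2 2≤q)
    δ≤qδ : ∣ ξ - p / q ∣ ≤ ∣ ι q * ξ - ιℤ p ∣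
    δ≤qδ = begin
      ∣ ξ - p / q ∣          ≈⟨ sym (*-identityˡ _) ⟩
      1# * ∣ ξ - p / q ∣     ≤⟨ *-monoʳ-≤ _ (0≤∣x∣ _) (1≤ι {q} (0<-≥2 2≤q)) ⟩
      ι q * ∣ ξ - p / q ∣    ≈⟨ q∣ξ-p/q∣ p q ξ ⟩
      ∣ ι q * ξ - ιℤ p ∣     ∎

  liouville⇒wellApproximable : Liouville ξ → WellApproximable ξ
  liouville⇒wellApproximable {ξ} L N with em {P = ∃[ pq ] Approximates ξ (suc N) pq}
  ... | yes ((p , q) , a) = p , q , approximates⇒close a
  ... | no none = contradiction ([] , λ {pq} a → contradiction (pq , a) none) (L (suc N) (ℕ.s≤s ℕ.z≤n))

  ι-scale-≤ : m ℕ.≤ n → 0# ≤ x → ι m * x ≤ ι n * x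
  ι-scale-≤ m≤n 0≤x = *-monoʳ-≤ _ 0≤x (ι-mono-≤ m≤n)

  private
    gap : Carrier → ℤ × ℕ → Carrier
    gap ξ pq = ∣ ι (proj₂ pq) * ξ - ιℤ (proj₁ pq) ∣

    Separated : Carrier → List (ℤ × ℕ) → ℕ → Set
    Separated ξ xs k = ∀ pq → pq ∈ xs → 0# < gap ξ pq → 1# ≤ ι (2 ℕ.^ k) * gap ξ pq

    separated-∷ : ∀ ξ pq xs → ∃ (Separated ξ xs) → Dec (0# < gap ξ pq) → ∃ (Separated ξ (pq ∷ xs))
    separated-∷ ξ pq xs (k , sep) (no ¬0<δ) = k , λ
      { _  (here ≡.refl) 0<δ → contradiction 0<δ ¬0<δ
      ; rs (there m)         → sep rs m }
    separated-∷ ξ pq xs (k , sep) (yes 0<δ) = j ℕ.+ k , λ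
      { _  (here ≡.refl) _ → ≤-trans (proj₂ (archimedean₂ 0<δ)) (ι-scale-≤ (ℕ.^-monoʳ-≤ 2 (ℕ.m≤m+n j k)) (0≤∣x∣ _))
      ; rs (there m) 0<δ′  → ≤-trans (sep rs m 0<δ′) (ι-scale-≤ (ℕ.^-monoʳ-≤ 2 (ℕ.m≤n+m k j)) (0≤∣x∣ _)) }
      where
      j = proj₁ (archimedean₂ 0<δ)

    separated : ∀ ξ xs → ∃ (Separated ξ xs)
    separated ξ []        = 0 , λ _ ()
    separated ξ (pq ∷ xs) = separated-∷ ξ pq xs (separated ξ xs) (0# <? gap ξ pq)

  -- If a finite list covered all approximations of order N, its nonzero gaps would all be at least
  -- 2 ^ -k for some k. But an approximation of order N + k is also one of order N, hence in the
  -- list, and its gap is below q ^ -(N + k) ≤ 2 ^ -k.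
  wellApproximable⇒liouville : WellApproximable ξ → Liouville ξ
  wellApproximable⇒liouville {ξ} W N _ (xs , covers) = absurd (separated ξ xs)
    where
    absurd : ∃ (Separated ξ xs) → ⊥
    absurd (k , sep) = contra (W (N ℕ.+ k))
      where
      contra : (∃[ p ] ∃[ q ] 2 ℕ.≤ q × Close ξ (N ℕ.+ k) p q) → ⊥
      contra (p , q , 2≤q , 0<δ , δ<) = <⇒≱ δ<
          (≤-trans (sep (p , q) (covers (close⇒approximates 2≤q close)) 0<δ)
                   (ι-scale-≤ 2^k≤ (0≤∣x∣ _)))
        where
        instance q≢0 = ℕ.>-nonZero (0<-≥2 2≤q)
        q^N≤ : q ℕ.^ N ℕ.≤ q ℕ.^ (N ℕ.+ k)
        q^N≤ = ℕ.^-monoʳ-≤ q (ℕ.m≤m+n N k)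
        2^k≤ : 2 ℕ.^ k ℕ.≤ q ℕ.^ (N ℕ.+ k)
        2^k≤ = ℕ.≤-trans (ℕ.^-monoˡ-≤ k 2≤q) (ℕ.^-monoʳ-≤ q (ℕ.m≤n+m k N))
        close : Close ξ N p q
        close = 0<δ , ≤-<-trans (ι-scale-≤ q^N≤ (0≤∣x∣ _)) δ<

-- Finite irrationality exponents and criteria for not being Liouville.

module Approximation (em : ExcludedMiddle 0ℓ) (ℝ : CompleteOrderedField) where
  open Archimedean em ℝ public

  private variable
    x y ξ : Carrier
    m n : ℕ

  Rational : Carrier → Set
  Rational x = ∃[ n ] 0 ℕ.< n × Den n x

  -- A finite irrationality exponent in integral form: ∣ q ξ - x ∣ ≥ (2 q) ^ -κ. The base is 2 q
  -- rather than q so that constants can be absorbed in κ even when q = 1.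
  Repelled : ℕ → Carrier → Set
  Repelled κ ξ = ∀ q → 0 ℕ.< q → ∀ {x} → IsInteger x → 1# ≤ ι ((2 ℕ.* q) ℕ.^ κ) * ∣ ι q * ξ - x ∣

  ι-abs-* : ∀ n x → ∣ ι n * x ∣ ≈ ι n * ∣ x ∣
  ι-abs-* n x = trans (abs-* _ _) (*-congʳ (abs-nonNeg (0≤ι n)))

  ι-2* : ∀ n → ι (2 ℕ.* n) ≈ ι n + ι n
  ι-2* n = trans (ι-* 2 n) (solve 1 (λ x → (con (+ 1) :+ (con (+ 1) :+ con (+ 0))) :* x := x :+ x) refl (ι n))

  private
    Closest : Carrier → ℕ → Set
    Closest ξ N = ∃[ p ] ∃[ q ] 2 ℕ.≤ q × Close ξ N p q

    repelled : ¬ Rational ξ → ∀ N → ¬ Closest ξ N → Repelled (suc N) ξ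
    repelled {ξ} irr N none q 0<q {x} ix@(p , x≈p) = ≮⇒≥ λ <1 → none
      -- The pair is doubled to make the denominator at least 2. The factor 2 that this puts into
      -- the error is paid for by the step from N to N + 1.
      ( (+ 2 ℤ.* p) , 2 ℕ.* q , ℕ.*-monoʳ-≤ 2 0<q
      , x≉0⇒0<∣x∣ (λ eq → irr (2 ℕ.* q , ℕ.≤-trans 0<q (ℕ.m≤m+n q _) , den (+ 2 ℤ.* p , x-y≈0⇒x≈y eq)))
      , (begin-strict
          ι (c ℕ.^ N) * ∣ ι c * ξ - ιℤ (+ 2 ℤ.* p) ∣   ≈⟨ *-congˡ (abs-cong (+-cong (*-congʳ (ι-* 2 q)) (-‿cong (trans (ιℤ-* (+ 2) p) (*-congˡ (sym x≈p)))))) ⟩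
          ι (c ℕ.^ N) * ∣ ι 2 * ι q * ξ - ι 2 * x ∣    ≈⟨ *-congˡ (abs-cong (solve 4 (λ t q ξ x → t :* q :* ξ :- t :* x := t :* (q :* ξ :- x)) refl (ι 2) (ι q) ξ x)) ⟩
          ι (c ℕ.^ N) * ∣ ι 2 * (ι q * ξ - x) ∣        ≈⟨ *-congˡ (ι-abs-* 2 _) ⟩
          ι (c ℕ.^ N) * (ι 2 * ∣ ι q * ξ - x ∣)        ≈⟨ solve 3 (λ a b c → a :* (b :* c) := b :* a :* c) refl (ι (c ℕ.^ N)) (ι 2) _ ⟩
          ι 2 * ι (c ℕ.^ N) * ∣ ι q * ξ - x ∣          ≈⟨ *-congʳ (sym (ι-* 2 (c ℕ.^ N))) ⟩
          ι (2 ℕ.* c ℕ.^ N) * ∣ ι q * ξ - x ∣          ≤⟨ ι-scale-≤ (ℕ.*-monoˡ-≤ (c ℕ.^ N) (ℕ.*-monoʳ-≤ 2 0<q)) (0≤∣x∣ _) ⟩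
          ι (c ℕ.^ suc N) * ∣ ι q * ξ - x ∣            <⟨ <1 ⟩
          1#                                           ∎))
      where
      open ≤-Reasoning
      c = 2 ℕ.* q

  ¬liouville⇒repelled : ¬ Rational ξ → ¬ Liouville ξ → ∃[ κ ] Repelled κ ξ
  ¬liouville⇒repelled {ξ} irr ¬L = from em
    where
    from : Dec (∃[ κ ] Repelled κ ξ) → ∃[ κ ] Repelled κ ξ
    from (yes r) = r
    from (no ¬r) = contradiction (wellApproximable⇒liouville λ N → closest N em) ¬L
      where
      closest : ∀ N → Dec (Closest ξ N) → Closest ξ N
      closest N (yes c)   = c
      closest N (no none) = contradiction (suc N , repelled irr N none) ¬r

  -- The form in which repulsion is applied: of the leading coefficient u of a linear equation for ξ
  -- only a bound is known, not its sign. Negating u and v together reduces to u > 0.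
  repelled-integers : ∀ {κ} → Repelled κ ξ → ∀ {u v} H → IsInteger u → IsInteger v → u ≉ 0# → ∣ u ∣ ≤ ι H →
                      1# ≤ ι ((2 ℕ.* H) ℕ.^ κ) * ∣ u * ξ - v ∣
  repelled-integers {ξ} {κ} rep {u} {v} H iu@(p , u≈p) iv u≉0 ∣u∣≤H = begin
    1#                                                 ≤⟨ [ positive , negative ]′ (abs-sign u) ⟩
    ι ((2 ℕ.* q) ℕ.^ κ) * ∣ u * ξ - v ∣                ≤⟨ ι-scale-≤ (ℕ.^-monoˡ-≤ κ (ℕ.*-monoʳ-≤ 2 q≤H)) (0≤∣x∣ _) ⟩
    ι ((2 ℕ.* H) ℕ.^ κ) * ∣ u * ξ - v ∣                ∎
    where
    open ≤-Reasoning
    q = ℤ.∣ p ∣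
    ∣u∣≈q : ∣ u ∣ ≈ ι q
    ∣u∣≈q = trans (abs-cong u≈p) (∣ιℤ∣ p)
    q≤H : q ℕ.≤ H
    q≤H = ℕ.≮⇒≥ λ H<q → <⇒≱ (ι-mono-< H<q) (≤-trans (≤-reflexive (sym ∣u∣≈q)) ∣u∣≤H)
    0<q : 0 ℕ.< q
    0<q = ℕ.n≢0⇒n>0 λ q≡0 → u≉0 (trans u≈p (reflexive (≡.cong ιℤ (ℤ.∣i∣≡0⇒i≡0 {p} q≡0))))
    positive : u ≈ ∣ u ∣ → 1# ≤ ι ((2 ℕ.* q) ℕ.^ κ) * ∣ u * ξ - v ∣
    positive eq = ≤-trans (rep q 0<q iv) (≤-reflexive (*-congˡ (abs-cong (+-congʳ (*-congʳ (sym (trans eq ∣u∣≈q)))))))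
    negative : u ≈ - ∣ u ∣ → 1# ≤ ι ((2 ℕ.* q) ℕ.^ κ) * ∣ u * ξ - v ∣
    negative eq = ≤-trans (rep q 0<q (integer-neg iv)) (≤-reflexive (*-congˡ (begin-equality
      ∣ ι q * ξ - - v ∣   ≈⟨ abs-cong (+-congʳ (*-congʳ (trans (sym ∣u∣≈q) (trans (sym (-‿involutive _)) (-‿cong (sym eq)))))) ⟩
      ∣ - u * ξ - - v ∣   ≈⟨ abs-cong (solve 3 (λ u ξ v → :- u :* ξ :- :- v := :- (u :* ξ :- v)) refl u ξ v) ⟩
      ∣ - (u * ξ - v) ∣   ≈⟨ abs-neg _ ⟩
      ∣ u * ξ - v ∣       ∎)))

  -- Every p / q also has the denominator t * q, which is at least t. As t ≤ 2 ^ t ≤ q ^ t, the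
  -- factor (t * q) ^ K is at most q ^ ((t + 1) * K), so order (t + 1) * K is already impossible.
  ¬liouville-lowerBound : ∀ K t → 0 ℕ.< t → (∀ Q s → t ℕ.≤ Q → Den Q s → 1# ≤ ι (Q ℕ.^ K) * ∣ y - s ∣) → ¬ Liouville y
  ¬liouville-lowerBound {y} K t 0<t bound L = absurd (liouville⇒wellApproximable L N)
    where
    N = suc t ℕ.* K
    absurd : ∃[ p ] ∃[ q ] 2 ℕ.≤ q × Close y N p q → ⊥
    absurd (p , q@(suc _) , 2≤q , _ , <1) = <⇒≱ <1 (begin
      1#                                          ≤⟨ bound (t ℕ.* q) (p / q) (ℕ.m≤m*n t q) (den-scale t (den-/ p q)) ⟩
      ι ((t ℕ.* q) ℕ.^ K) * ∣ y - p / q ∣         ≤⟨ ι-scale-≤ tq^K≤ (0≤∣x∣ _) ⟩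
      ι (q ℕ.^ N) * ∣ y - p / q ∣                 ≤⟨ *-monoˡ-≤ _ (0≤ι (q ℕ.^ N)) δ≤qδ ⟩
      ι (q ℕ.^ N) * ∣ ι q * y - ιℤ p ∣            ∎)
      where
      open ≤-Reasoning
      t≤q^t : t ℕ.≤ q ℕ.^ t
      t≤q^t = ℕ.≤-trans (ℕ.<⇒≤ (n<2^n t)) (ℕ.^-monoˡ-≤ t 2≤q)
      tq^K≤ : (t ℕ.* q) ℕ.^ K ℕ.≤ q ℕ.^ N
      tq^K≤ = ℕ.≤-trans
        (ℕ.^-monoˡ-≤ K (ℕ.≤-trans (ℕ.*-monoˡ-≤ q t≤q^t) (ℕ.≤-reflexive (ℕ.*-comm (q ℕ.^ t) q))))
        (ℕ.≤-reflexive (ℕ.^-*-assoc q (suc t) K))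
      δ≤qδ : ∣ y - p / q ∣ ≤ ∣ ι q * y - ιℤ p ∣
      δ≤qδ = begin
        ∣ y - p / q ∣          ≈⟨ sym (*-identityˡ _) ⟩
        1# * ∣ y - p / q ∣     ≤⟨ *-monoʳ-≤ _ (0≤∣x∣ _) (1≤ι {q} (ℕ.s≤s ℕ.z≤n)) ⟩
        ι q * ∣ y - p / q ∣    ≈⟨ q∣ξ-p/q∣ p q y ⟩
        ∣ ι q * y - ιℤ p ∣     ∎

  -- The number n (q y - p) is a nonzero integer, so the gap is at least 1 / n, and n < 2 ^ n ≤ q ^
  -- n excludes order n.
  rational⇒¬liouville : Rational y → ¬ Liouville y
  rational⇒¬liouville {y} (n , 0<n , den iy) L = absurd (liouville⇒wellApproximable L n)
    where
    absurd : ∃[ p ] ∃[ q ] 2 ℕ.≤ q × Close y n p q → ⊥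
    absurd (p , q , 2≤q , 0<δ , δ<) = <⇒≱ δ< (begin
      1#                                    ≤⟨ integer-≥1 n*-integer (*-≉0 (>⇒≉ (0<ι 0<n)) (0<∣x∣⇒x≉0 0<δ)) ⟩
      ∣ ι n * (ι q * y - ιℤ p) ∣            ≈⟨ ι-abs-* n _ ⟩
      ι n * ∣ ι q * y - ιℤ p ∣              ≤⟨ ι-scale-≤ (ℕ.≤-trans (ℕ.<⇒≤ (n<2^n n)) (ℕ.^-monoˡ-≤ n 2≤q)) (0≤∣x∣ _) ⟩
      ι (q ℕ.^ n) * ∣ ι q * y - ιℤ p ∣      ∎)
      where
      open ≤-Reasoning
      n*-integer : IsInteger (ι n * (ι q * y - ιℤ p))
      n*-integer = integer-resp (solve 4 (λ n q y p → q :* (n :* y) :- n :* p := n :* (q :* y :- p)) refl (ι n) (ι q) y (ιℤ p))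
        (integer-− (integer-* (integer-ι q) iy) (integer-* (integer-ι n) (p , refl)))

*-≤-^ : ∀ T i j {m n} → m ℕ.≤ T ℕ.^ i → n ℕ.≤ T ℕ.^ j → m ℕ.* n ℕ.≤ T ℕ.^ (i ℕ.+ j)
*-≤-^ T i j m≤ n≤ = ℕ.≤-trans (ℕ.*-mono-≤ m≤ n≤) (ℕ.≤-reflexive (≡.sym (ℕ.^-distribˡ-+-* T i j)))

^-≤-^ : ∀ T i κ {m} → m ℕ.≤ T ℕ.^ i → m ℕ.^ κ ℕ.≤ T ℕ.^ (i ℕ.* κ)
^-≤-^ T i κ m≤ = ℕ.≤-trans (ℕ.^-monoˡ-≤ κ m≤) (ℕ.≤-reflexive (ℕ.^-*-assoc T i κ))

≤-^1 : ∀ {m T} → m ℕ.≤ T → m ℕ.≤ T ℕ.^ 1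
≤-^1 {T = T} m≤T = ℕ.≤-trans m≤T (ℕ.≤-reflexive (≡.sym (ℕ.*-identityʳ T)))

-- Three nearby fractions cannot all have images close to rationals of comparable denominators.

module Germs (em : ExcludedMiddle 0ℓ) (ℝ : CompleteOrderedField) where
  open Approximation em ℝ public

  private variable
    x y ξ : Carrier
    m n : ℕ

  Ball : Carrier → Carrier → Carrier → Set
  Ball c r x = ∣ x - c ∣ ≤ r

  -- The properties of a Möbius transformation near a non-Liouville irrational x₀ with
  -- rational image that the construction of ξ depends on.
  record Germ (f : Carrier → Carrier) (x₀ R : Carrier) : Set where
    field
      0<R         : 0# < R
      2R≤1        : R + R ≤ 1#
      L           : ℕ
      1≤L         : 1 ℕ.≤ L
      lipschitz   : Ball x₀ R x → Ball x₀ R y → ∣ f x - f y ∣ ≤ ι L * ∣ x - y ∣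
      colipschitz : Ball x₀ R x → Ball x₀ R y → ∣ x - y ∣ ≤ ι L * ∣ f x - f y ∣
      -- Invariance of the cross-ratio of x₀, x₁, x₂, x₃ with denominators cleared. The outer
      -- factors x₀ - x₁ and x₀ - x₂ stand apart so that, with f x₀ known, this reads as a linear
      -- equation for x₀.
      cross-ratio : ∀ {x₁ x₂ x₃} → Ball x₀ R x₁ → Ball x₀ R x₂ → Ball x₀ R x₃ →
                    (x₀ - x₁) * ((f x₁ - f x₃) * (f x₂ - f x₀) * (x₂ - x₃)) ≈
                    (x₀ - x₂) * ((f x₁ - f x₀) * (f x₂ - f x₃) * (x₁ - x₃))
      Q₀          : ℕ
      0<Q₀        : 0 ℕ.< Q₀
      den-f-x₀    : Den Q₀ (f x₀)
      κ           : ℕ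
      repelled-x₀ : Repelled κ x₀

  ball-centre : ∀ {r} c → 0# ≤ r → Ball c r c
  ball-centre c 0≤r = ≤-trans (≤-reflexive (x≈0⇒∣x∣≈0 (-‿inverseʳ c))) 0≤r

  product-difference : ∀ {a a′ b b′ δ B} → ∣ a - a′ ∣ ≤ δ → ∣ b - b′ ∣ ≤ δ → ∣ b ∣ ≤ B → ∣ a′ ∣ ≤ B →
                       ∣ a * b - a′ * b′ ∣ ≤ (δ + δ) * B
  product-difference {a} {a′} {b} {b′} {δ} {B} ha hb hB ha′ = begin
    ∣ a * b - a′ * b′ ∣                   ≈⟨ abs-cong (solve 4 (λ a a′ b b′ → a :* b :- a′ :* b′ := (a :- a′) :* b :+ a′ :* (b :- b′)) refl a a′ b b′) ⟩
    ∣ (a - a′) * b + a′ * (b - b′) ∣      ≤⟨ triangle _ _ ⟩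
    ∣ (a - a′) * b ∣ + ∣ a′ * (b - b′) ∣  ≈⟨ +-cong (abs-* _ _) (abs-* _ _) ⟩
    ∣ a - a′ ∣ * ∣ b ∣ + ∣ a′ ∣ * ∣ b - b′ ∣  ≤⟨ +-mono-≤ (*-mono-≤ (0≤∣x∣ _) 0≤B ha hB)
                                                        (*-mono-≤ (0≤∣x∣ _) 0≤δ ha′ hb) ⟩
    δ * B + B * δ                         ≈⟨ solve 2 (λ δ B → δ :* B :+ B :* δ := (δ :+ δ) :* B) refl δ B ⟩
    (δ + δ) * B                           ∎
    where
    open ≤-Reasoning
    0≤δ = ≤-trans (0≤∣x∣ _) ha
    0≤B = ≤-trans (0≤∣x∣ _) hB

  abs-*-≤ : ∀ {a b A B} → ∣ a ∣ ≤ A → ∣ b ∣ ≤ B → ∣ a * b ∣ ≤ A * B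
  abs-*-≤ {a} {b} ha hb = ≤-trans (≤-reflexive (abs-* a b)) (*-mono-≤ (0≤∣x∣ a) (≤-trans (0≤∣x∣ b) hb) ha hb)

  module ThreeApproximations {f x₀ R} (germ : Germ f x₀ R) where
    open Germ germ

    -- B bounds the differences of the sᵢ; the integers arising below are at most
    -- T ^ (18 κ + 18), hence negligible against T ^ K.
    B K T₀ : ℕ
    B  = L ℕ.+ 2
    K  = suc (18 ℕ.* κ ℕ.+ 18)
    T₀ = Q₀ ℕ.+ 8 ℕ.* (B ℕ.* B)

    module _ {T q r₁ r₂ r₃ Q₁ Q₂ Q₃ s₁ s₂ s₃}
      (T₀≤T : T₀ ℕ.≤ T) (0<q : 0 ℕ.< q) (q≤T⁵ : q ℕ.≤ T ℕ.^ 5)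
      (r₁∈ : Ball x₀ R r₁) (r₂∈ : Ball x₀ R r₂) (r₃∈ : Ball x₀ R r₃)
      (den-r₁ : Den q r₁) (den-r₂ : Den q r₂) (den-r₃ : Den q r₃)
      (r₁≉r₂ : r₁ ≉ r₂) (r₁≉r₃ : r₁ ≉ r₃) (r₂≉r₃ : r₂ ≉ r₃)
      (T≤Q₁ : T ℕ.≤ Q₁) (T≤Q₂ : T ℕ.≤ Q₂) (T≤Q₃ : T ℕ.≤ Q₃)
      (Q₁≤T² : Q₁ ℕ.≤ T ℕ.^ 2) (Q₂≤T² : Q₂ ℕ.≤ T ℕ.^ 2) (Q₃≤T² : Q₃ ℕ.≤ T ℕ.^ 2)
      (den-s₁ : Den Q₁ s₁) (den-s₂ : Den Q₂ s₂) (den-s₃ : Den Q₃ s₃)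
      (close₁ : ι (Q₁ ℕ.^ K) * ∣ f r₁ - s₁ ∣ < 1#)
      (close₂ : ι (Q₂ ℕ.^ K) * ∣ f r₂ - s₂ ∣ < 1#)
      (close₃ : ι (Q₃ ℕ.^ K) * ∣ f r₃ - s₃ ∣ < 1#)
      where

      private
        Q₀≤T : Q₀ ℕ.≤ T
        Q₀≤T = ℕ.≤-trans (ℕ.m≤m+n Q₀ _) T₀≤T

        8B²≤T : 8 ℕ.* (B ℕ.* B) ℕ.≤ T
        8B²≤T = ℕ.≤-trans (ℕ.m≤n+m _ Q₀) T₀≤T

        2≤B : 2 ℕ.≤ B
        2≤B = ℕ.m≤n+m 2 L

        B≤B² : B ℕ.≤ B ℕ.* B
        B≤B² = ℕ.≤-trans (ℕ.≤-reflexive (≡.sym (ℕ.*-identityʳ B))) (ℕ.*-monoʳ-≤ B (ℕ.≤-trans (ℕ.s≤s ℕ.z≤n) 2≤B))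

        8B≤T : 8 ℕ.* B ℕ.≤ T
        8B≤T = ℕ.≤-trans (ℕ.*-monoʳ-≤ 8 B≤B²) 8B²≤T

        2≤T : 2 ℕ.≤ T
        2≤T = ℕ.≤-trans 2≤B (ℕ.≤-trans (ℕ.m≤n*m B 8) 8B≤T)

        instance
          T≢0 : NonZero T
          T≢0 = ℕ.>-nonZero (ℕ.≤-trans (ℕ.s≤s ℕ.z≤n) 2≤T)

        0<τ : 0# < ι (T ℕ.^ K)
        0<τ = 0<ι (ℕ.m^n>0 T K)

        ε : Carrier
        ε = recip (ι (T ℕ.^ K)) (>⇒≉ 0<τ)

        0<ε : 0# < ε
        0<ε = recip-pos 0<τ

        0≤ε : 0# ≤ ε
        0≤ε = <⇒≤ 0<ε

        -- Every contradiction below has this shape: a quantity is at least 1 by integrality or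
        -- repulsion, yet at most N ε, where ε = T ^ -K and K exceeds the exponent 18 κ + 18 by one.
        negligible : ∀ {N} → N ℕ.≤ T ℕ.^ (18 ℕ.* κ ℕ.+ 18) → ¬ (1# ≤ ι N * ε)
        negligible {N} N≤ 1≤ = <⇒≱ (begin-strict
          ι N * ε                       ≤⟨ ι-scale-≤ N≤ 0≤ε ⟩
          ι (T ℕ.^ (18 ℕ.* κ ℕ.+ 18)) * ε  <⟨ *-monoʳ-< ε 0<ε (ι-mono-< {T ℕ.^ (18 ℕ.* κ ℕ.+ 18)} {T ℕ.^ K} (ℕ.^-monoʳ-< T 2≤T (ℕ.n<1+n (18 ℕ.* κ ℕ.+ 18)))) ⟩
          ι (T ℕ.^ K) * ε               ≈⟨ *-recip (>⇒≉ 0<τ) ⟩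
          1#                            ∎) 1≤
          where open ≤-Reasoning

        small-power : ∀ i → i ℕ.≤ 18 → T ℕ.^ i ℕ.≤ T ℕ.^ (18 ℕ.* κ ℕ.+ 18)
        small-power i i≤ = ℕ.^-monoʳ-≤ T (ℕ.≤-trans i≤ (ℕ.m≤n+m 18 (18 ℕ.* κ)))

        ε-close : ∀ {Q a b} → T ℕ.≤ Q → ι (Q ℕ.^ K) * ∣ a - b ∣ < 1# → ∣ b - a ∣ ≤ ε
        ε-close {Q} {a} {b} T≤Q <1 = *-cancelˡ-≤ (ι (T ℕ.^ K)) 0<τ (begin
          ι (T ℕ.^ K) * ∣ b - a ∣   ≤⟨ ι-scale-≤ (ℕ.^-monoˡ-≤ K T≤Q) (0≤∣x∣ _) ⟩
          ι (Q ℕ.^ K) * ∣ b - a ∣   ≈⟨ *-congˡ (abs-swap b a) ⟩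
          ι (Q ℕ.^ K) * ∣ a - b ∣   ≤⟨ <⇒≤ <1 ⟩
          1#                        ≈⟨ sym (*-recip (>⇒≉ 0<τ)) ⟩
          ι (T ℕ.^ K) * ε           ∎)
          where open ≤-Reasoning

        e₁ = ε-close T≤Q₁ close₁
        e₂ = ε-close T≤Q₂ close₂
        e₃ = ε-close T≤Q₃ close₃

        s₀ f₁ f₂ f₃ : Carrier
        s₀ = f x₀
        f₁ = f r₁
        f₂ = f r₂
        f₃ = f r₃

        x₀∈ : Ball x₀ R x₀
        x₀∈ = ball-centre x₀ (<⇒≤ 0<R)

        e₀ : ∣ s₀ - s₀ ∣ ≤ ε
        e₀ = ball-centre s₀ 0≤ε

        ball-diff : ∀ {x y} → Ball x₀ R x → Ball x₀ R y → ∣ x - y ∣ ≤ 1#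
        ball-diff {x} {y} x∈ y∈ = begin
          ∣ x - y ∣                  ≤⟨ triangle-via x₀ ⟩
          ∣ x - x₀ ∣ + ∣ x₀ - y ∣    ≤⟨ +-mono-≤ x∈ (≤-trans (≤-reflexive (abs-swap x₀ y)) y∈) ⟩
          R + R                      ≤⟨ 2R≤1 ⟩
          1#                         ∎
          where open ≤-Reasoning

        ε≤1 : ε ≤ 1#
        ε≤1 = begin
          ε                 ≈⟨ sym (*-identityˡ ε) ⟩
          1# * ε            ≤⟨ *-monoʳ-≤ ε 0≤ε (1≤ι {T ℕ.^ K} (ℕ.m^n>0 T K)) ⟩
          ι (T ℕ.^ K) * ε   ≈⟨ *-recip (>⇒≉ 0<τ) ⟩
          1#                ∎
          where open ≤-Reasoning

        f-diff : ∀ {x y} → Ball x₀ R x → Ball x₀ R y → ∣ f x - f y ∣ ≤ ι B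
        f-diff {x} {y} x∈ y∈ = begin
          ∣ f x - f y ∣        ≤⟨ lipschitz x∈ y∈ ⟩
          ι L * ∣ x - y ∣      ≤⟨ *-monoˡ-≤ _ (0≤ι L) (ball-diff x∈ y∈) ⟩
          ι L * 1#             ≈⟨ *-identityʳ _ ⟩
          ι L                  ≤⟨ ι-mono-≤ (ℕ.m≤m+n L 2) ⟩
          ι B                  ∎
          where open ≤-Reasoning

        diff-diff : ∀ {s t a b} → ∣ s - a ∣ ≤ ε → ∣ t - b ∣ ≤ ε → ∣ (s - t) - (a - b) ∣ ≤ ε + ε
        diff-diff {s} {t} {a} {b} hs ht = begin
          ∣ (s - t) - (a - b) ∣     ≈⟨ abs-cong (solve 4 (λ s t a b → (s :- t) :- (a :- b) := (s :- a) :- (t :- b)) refl s t a b) ⟩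
          ∣ (s - a) - (t - b) ∣     ≤⟨ triangle-− _ _ ⟩
          ∣ s - a ∣ + ∣ t - b ∣     ≤⟨ +-mono-≤ hs ht ⟩
          ε + ε                     ∎
          where open ≤-Reasoning

        s-diff : ∀ {s t x y} → Ball x₀ R x → Ball x₀ R y → ∣ s - f x ∣ ≤ ε → ∣ t - f y ∣ ≤ ε → ∣ s - t ∣ ≤ ι B
        s-diff {s} {t} {x} {y} x∈ y∈ hs ht = begin
          ∣ s - t ∣                                       ≈⟨ abs-cong (solve 3 (λ s t a → s :- t := a :+ ((s :- t) :- a)) refl s t (f x - f y)) ⟩
          ∣ (f x - f y) + ((s - t) - (f x - f y)) ∣       ≤⟨ triangle _ _ ⟩
          ∣ f x - f y ∣ + ∣ (s - t) - (f x - f y) ∣       ≤⟨ +-mono-≤ (≤-trans (lipschitz x∈ y∈) (≤-trans (*-monoˡ-≤ _ (0≤ι L) (ball-diff x∈ y∈)) (≤-reflexive (*-identityʳ _))))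
                                                                      (≤-trans (diff-diff hs ht) (+-mono-≤ ε≤1 ε≤1)) ⟩
          ι L + (1# + 1#)                                 ≈⟨ +-congˡ (+-congˡ (sym (+-identityʳ 1#))) ⟩
          ι L + ι 2                                       ≈⟨ sym (ι-+ L 2) ⟩
          ι B                                             ∎
          where open ≤-Reasoning

        product-diff : ∀ {s t s′ t′ x y x′ y′} → Ball x₀ R x → Ball x₀ R y → Ball x₀ R x′ → Ball x₀ R y′ →
                       ∣ s - f x ∣ ≤ ε → ∣ t - f y ∣ ≤ ε → ∣ s′ - f x′ ∣ ≤ ε → ∣ t′ - f y′ ∣ ≤ ε →
                       ∣ (s - t) * (s′ - t′) - (f x - f y) * (f x′ - f y′) ∣ ≤ ι (4 ℕ.* B) * ε
        product-diff x∈ y∈ x′∈ y′∈ hs ht hs′ ht′ = ≤-trans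
          (product-difference (diff-diff hs ht) (diff-diff hs′ ht′) (s-diff x′∈ y′∈ hs′ ht′) (f-diff x∈ y∈))
          (≤-reflexive (trans (solve 2 (λ ε B → ((ε :+ ε) :+ (ε :+ ε)) :* B :=
            (con (+ 1) :+ (con (+ 1) :+ (con (+ 1) :+ (con (+ 1) :+ con (+ 0))))) :* B :* ε) refl ε (ι B)) (*-congʳ (sym (ι-* 4 B)))))

        -- x₀ solves the linear equation x₀ (α − β) = r₁ α − r₂ β up to O(ε).
        α α₀ β β₀ U V : Carrier
        α  = (s₁ - s₃) * (s₂ - s₀) * (r₂ - r₃)
        β  = (s₁ - s₀) * (s₂ - s₃) * (r₁ - r₃)
        α₀ = (f₁ - f₃) * (f₂ - s₀) * (r₂ - r₃)
        β₀ = (f₁ - s₀) * (f₂ - f₃) * (r₁ - r₃)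
        U = α - β
        V = r₁ * α - r₂ * β

        α-diff : ∣ α - α₀ ∣ ≤ ι (4 ℕ.* B) * ε
        α-diff = begin
          ∣ α - α₀ ∣     ≈⟨ abs-cong (solve 3 (λ a b r → a :* r :- b :* r := (a :- b) :* r) refl _ _ (r₂ - r₃)) ⟩
          ∣ ((s₁ - s₃) * (s₂ - s₀) - (f₁ - f₃) * (f₂ - s₀)) * (r₂ - r₃) ∣
                         ≤⟨ abs-*-≤ (product-diff r₁∈ r₃∈ r₂∈ x₀∈ e₁ e₃ e₂ e₀) (ball-diff r₂∈ r₃∈) ⟩
          ι (4 ℕ.* B) * ε * 1#  ≈⟨ *-identityʳ _ ⟩
          ι (4 ℕ.* B) * ε       ∎
          where open ≤-Reasoning

        β-diff : ∣ β - β₀ ∣ ≤ ι (4 ℕ.* B) * ε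
        β-diff = begin
          ∣ β - β₀ ∣     ≈⟨ abs-cong (solve 3 (λ a b r → a :* r :- b :* r := (a :- b) :* r) refl _ _ (r₁ - r₃)) ⟩
          ∣ ((s₁ - s₀) * (s₂ - s₃) - (f₁ - s₀) * (f₂ - f₃)) * (r₁ - r₃) ∣
                         ≤⟨ abs-*-≤ (product-diff r₁∈ x₀∈ r₂∈ r₃∈ e₁ e₀ e₂ e₃) (ball-diff r₁∈ r₃∈) ⟩
          ι (4 ℕ.* B) * ε * 1#  ≈⟨ *-identityʳ _ ⟩
          ι (4 ℕ.* B) * ε       ∎
          where open ≤-Reasoning

        UV-small : ∣ U * x₀ - V ∣ ≤ ι (8 ℕ.* B) * ε
        UV-small = begin
          ∣ U * x₀ - V ∣
            ≈⟨ abs-cong (solve 5 (λ x r₁ r₂ α β → (α :- β) :* x :- (r₁ :* α :- r₂ :* β) := (x :- r₁) :* α :- (x :- r₂) :* β) refl x₀ r₁ r₂ α β) ⟩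
          ∣ (x₀ - r₁) * α - (x₀ - r₂) * β ∣
            -- The subtracted bracket vanishes by the exact cross-ratio relation for the images f
            -- rᵢ, so that only the perturbations α - α₀ and β - β₀ remain.
            ≈⟨ abs-cong (trans (sym (+-identityʳ _)) (+-congˡ (sym (trans (-‿cong (x≈y⇒x-y≈0 (cross-ratio r₁∈ r₂∈ r₃∈))) -0#≈0#)))) ⟩
          ∣ ((x₀ - r₁) * α - (x₀ - r₂) * β) - ((x₀ - r₁) * α₀ - (x₀ - r₂) * β₀) ∣
            ≈⟨ abs-cong (solve 6 (λ x y α β α₀ β₀ → (x :* α :- y :* β) :- (x :* α₀ :- y :* β₀) := x :* (α :- α₀) :- y :* (β :- β₀)) refl _ _ α β α₀ β₀) ⟩
          ∣ (x₀ - r₁) * (α - α₀) - (x₀ - r₂) * (β - β₀) ∣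
            ≤⟨ triangle-− _ _ ⟩
          ∣ (x₀ - r₁) * (α - α₀) ∣ + ∣ (x₀ - r₂) * (β - β₀) ∣
            ≤⟨ +-mono-≤ (abs-*-≤ (ball-diff x₀∈ r₁∈) α-diff) (abs-*-≤ (ball-diff x₀∈ r₂∈) β-diff) ⟩
          1# * (ι (4 ℕ.* B) * ε) + 1# * (ι (4 ℕ.* B) * ε)
            ≈⟨ solve 2 (λ b ε → con (+ 1) :* (b :* ε) :+ con (+ 1) :* (b :* ε) := (b :+ b) :* ε) refl (ι (4 ℕ.* B)) ε ⟩
          (ι (4 ℕ.* B) + ι (4 ℕ.* B)) * ε
            ≈⟨ *-congʳ (trans (sym (ι-+ (4 ℕ.* B) (4 ℕ.* B))) (ι-cong (≡.sym (ℕ.*-distribʳ-+ B 4 4)))) ⟩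
          ι (8 ℕ.* B) * ε
            ∎
          where open ≤-Reasoning

        -- `D` is a common denominator of α and β. The further factor q in `E` serves the products
        -- r₁ α and r₂ β in V.
        D E : ℕ
        D = Q₁ ℕ.* Q₃ ℕ.* (Q₂ ℕ.* Q₀) ℕ.* q
        E = q ℕ.* D

        0<Q : ∀ {Q} → T ℕ.≤ Q → 0 ℕ.< Q
        0<Q = ℕ.≤-trans (ℕ.≤-trans (ℕ.s≤s ℕ.z≤n) 2≤T)

        0<E : 0 ℕ.< E
        0<E = ℕ.*-mono-≤ 0<q (ℕ.*-mono-≤ (ℕ.*-mono-≤ (ℕ.*-mono-≤ (0<Q T≤Q₁) (0<Q T≤Q₃)) (ℕ.*-mono-≤ (0<Q T≤Q₂) 0<Q₀)) 0<q)

        E≤T¹⁷ : E ℕ.≤ T ℕ.^ 17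
        E≤T¹⁷ = *-≤-^ T 5 12 q≤T⁵ (*-≤-^ T 7 5 (*-≤-^ T 4 3 (*-≤-^ T 2 2 Q₁≤T² Q₃≤T²) (*-≤-^ T 2 1 Q₂≤T² (≤-^1 Q₀≤T))) q≤T⁵)

        den-α : Den D α
        den-α = den-* (den-* (den-−-* den-s₁ den-s₃) (den-−-* den-s₂ den-f-x₀)) (den-− den-r₂ den-r₃)

        den-β : Den D β
        den-β = ≡.subst (λ k → Den k β) (reorder Q₀ Q₁ Q₂ Q₃ q)
          (den-* (den-* (den-−-* den-s₁ den-f-x₀) (den-−-* den-s₂ den-s₃)) (den-− den-r₁ den-r₃))
          where
          reorder : ∀ Q₀ Q₁ Q₂ Q₃ q → Q₁ ℕ.* Q₀ ℕ.* (Q₂ ℕ.* Q₃) ℕ.* q ≡ Q₁ ℕ.* Q₃ ℕ.* (Q₂ ℕ.* Q₀) ℕ.* q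
          reorder = ℕ-Solver.solve-∀

        u v : Carrier
        u = ι E * U
        v = ι E * V

        integer-u : IsInteger u
        integer-u = integer (den-scale q (den-− den-α den-β))

        integer-v : IsInteger v
        integer-v = integer (den-− (den-* den-r₁ den-α) (den-* den-r₂ den-β))

        uv-small : ∣ u * x₀ - v ∣ ≤ ι (E ℕ.* (8 ℕ.* B)) * ε
        uv-small = begin
          ∣ u * x₀ - v ∣              ≈⟨ abs-cong (solve 4 (λ E U V x → E :* U :* x :- E :* V := E :* (U :* x :- V)) refl (ι E) U V x₀) ⟩
          ∣ ι E * (U * x₀ - V) ∣      ≈⟨ ι-abs-* E _ ⟩
          ι E * ∣ U * x₀ - V ∣        ≤⟨ *-monoˡ-≤ _ (0≤ι E) UV-small ⟩
          ι E * (ι (8 ℕ.* B) * ε)     ≈⟨ trans (sym (*-assoc _ _ _)) (*-congʳ (sym (ι-* E (8 ℕ.* B)))) ⟩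
          ι (E ℕ.* (8 ℕ.* B)) * ε     ∎
          where open ≤-Reasoning

        H : ℕ
        H = E ℕ.* (2 ℕ.* (B ℕ.* B))

        ∣u∣≤H : ∣ u ∣ ≤ ι H
        ∣u∣≤H = begin
          ∣ ι E * U ∣                ≈⟨ ι-abs-* E U ⟩
          ι E * ∣ U ∣                ≤⟨ *-monoˡ-≤ _ (0≤ι E) (≤-trans (triangle-− α β) (+-mono-≤
              (abs-*-≤ (abs-*-≤ (s-diff r₁∈ r₃∈ e₁ e₃) (s-diff r₂∈ x₀∈ e₂ e₀)) (ball-diff r₂∈ r₃∈))
              (abs-*-≤ (abs-*-≤ (s-diff r₁∈ x₀∈ e₁ e₀) (s-diff r₂∈ r₃∈ e₂ e₃)) (ball-diff r₁∈ r₃∈)))) ⟩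
          ι E * (ι B * ι B * 1# + ι B * ι B * 1#)
            ≈⟨ *-congˡ (trans (+-cong (*-identityʳ _) (*-identityʳ _)) (trans (+-cong (sym (ι-* B B)) (sym (ι-* B B))) (sym (ι-2* (B ℕ.* B))))) ⟩
          ι E * ι (2 ℕ.* (B ℕ.* B))  ≈⟨ sym (ι-* E (2 ℕ.* (B ℕ.* B))) ⟩
          ι H                        ∎
          where open ≤-Reasoning

        2H≤T¹⁸ : 2 ℕ.* H ℕ.≤ T ℕ.^ 18
        2H≤T¹⁸ = ℕ.≤-trans (ℕ.≤-reflexive (reorder E (B ℕ.* B)))
          (*-≤-^ T 17 1 E≤T¹⁷ (≤-^1 (ℕ.≤-trans (ℕ.*-monoˡ-≤ (B ℕ.* B) (ℕ.m≤m+n 4 4)) 8B²≤T)))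
          where
          reorder : ∀ E b → 2 ℕ.* (E ℕ.* (2 ℕ.* b)) ≡ E ℕ.* (4 ℕ.* b)
          reorder = ℕ-Solver.solve-∀

        E8B≤T¹⁸ : E ℕ.* (8 ℕ.* B) ℕ.≤ T ℕ.^ 18
        E8B≤T¹⁸ = *-≤-^ T 17 1 E≤T¹⁷ (≤-^1 8B≤T)

        -- Otherwise v / u approximates x₀ better than `repelled-x₀` permits. The product (2 H) ^ κ
        -- * (E * 8 B) of the two losses is the origin of the exponent 18 κ + 18.
        u≈0 : u ≈ 0#
        u≈0 = decide (u ≟ 0#)
          where
          open ≤-Reasoning
          decide : Dec (u ≈ 0#) → u ≈ 0#
          decide (yes u≈0) = u≈0
          decide (no u≉0) = contradiction (begin
            1#                                              ≤⟨ repelled-integers {κ = κ} repelled-x₀ H integer-u integer-v u≉0 ∣u∣≤H ⟩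
            ι ((2 ℕ.* H) ℕ.^ κ) * ∣ u * x₀ - v ∣            ≤⟨ *-monoˡ-≤ _ (0≤ι ((2 ℕ.* H) ℕ.^ κ)) uv-small ⟩
            ι ((2 ℕ.* H) ℕ.^ κ) * (ι (E ℕ.* (8 ℕ.* B)) * ε) ≈⟨ trans (sym (*-assoc _ _ _)) (*-congʳ (sym (ι-* ((2 ℕ.* H) ℕ.^ κ) (E ℕ.* (8 ℕ.* B))))) ⟩
            ι ((2 ℕ.* H) ℕ.^ κ ℕ.* (E ℕ.* (8 ℕ.* B))) * ε   ∎)
            (negligible (*-≤-^ T (18 ℕ.* κ) 18 (^-≤-^ T 18 κ 2H≤T¹⁸) E8B≤T¹⁸))

        -- Once u vanishes, ∣ v ∣ equals the small quantity ∣ u * x₀ - v ∣, while v is an integer.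
        v≈0 : v ≈ 0#
        v≈0 = decide (v ≟ 0#)
          where
          open ≤-Reasoning
          decide : Dec (v ≈ 0#) → v ≈ 0#
          decide (yes v≈0) = v≈0
          decide (no v≉0) = contradiction (begin
            1#                        ≤⟨ integer-≥1 integer-v v≉0 ⟩
            ∣ v ∣                     ≈⟨ sym (abs-neg v) ⟩
            ∣ - v ∣                   ≈⟨ abs-cong (sym (trans (+-congʳ (trans (*-congʳ u≈0) (zeroˡ x₀))) (+-identityˡ _))) ⟩
            ∣ u * x₀ - v ∣            ≤⟨ uv-small ⟩
            ι (E ℕ.* (8 ℕ.* B)) * ε   ∎)
            (negligible (ℕ.≤-trans E8B≤T¹⁸ (small-power 18 ℕ.≤-refl)))

        E≉0 : ι E ≉ 0#
        E≉0 = >⇒≉ (0<ι 0<E)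

        -- The combination V - r₂ U = (r₁ - r₂) α eliminates β.
        α≈0 : α ≈ 0#
        α≈0 = [ (λ eq → contradiction (x-y≈0⇒x≈y eq) r₁≉r₂) , (λ eq → eq) ]′
          (x*y≈0⇒x≈0∨y≈0 (*-cancelˡ E≉0 (begin
            ι E * ((r₁ - r₂) * α)    ≈⟨ solve 5 (λ E r₁ r₂ α β → E :* ((r₁ :- r₂) :* α) := E :* (r₁ :* α :- r₂ :* β) :- r₂ :* (E :* (α :- β))) refl (ι E) r₁ r₂ α β ⟩
            v - r₂ * u               ≈⟨ +-cong v≈0 (-‿cong (*-congˡ u≈0)) ⟩
            0# - r₂ * 0#             ≈⟨ solve 2 (λ r E → con (+ 0) :- r :* con (+ 0) := E :* con (+ 0)) refl r₂ (ι E) ⟩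
            ι E * 0#                 ∎)))
          where open import Relation.Binary.Reasoning.Setoid setoid

        -- If s₁ ≈ s₃, then f r₁ and f r₃ are within 2 ε, hence r₁ and r₃ within 2 L ε. This is less
        -- than q⁻², the least distance of distinct fractions of denominator q.
        s₁≉s₃ : s₁ ≉ s₃
        s₁≉s₃ s₁≈s₃ = negligible (*-≤-^ T 10 8 (*-≤-^ T 5 5 q≤T⁵ q≤T⁵) (ℕ.≤-trans L2≤T (ℕ.≤-trans (≤-^1 ℕ.≤-refl) (ℕ.^-monoʳ-≤ T (ℕ.m≤m+n 1 7)))) ⟨≤⟩ small-power 18 ℕ.≤-refl) (begin
          1#                                         ≤⟨ den-gap den-r₁ den-r₃ r₁≉r₃ 0<q 0<q ⟩
          ι (q ℕ.* q) * ∣ r₁ - r₃ ∣                  ≤⟨ *-monoˡ-≤ _ (0≤ι (q ℕ.* q)) (colipschitz r₁∈ r₃∈) ⟩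
          ι (q ℕ.* q) * (ι L * ∣ f₁ - f₃ ∣)          ≤⟨ *-monoˡ-≤ _ (0≤ι (q ℕ.* q)) (*-monoˡ-≤ _ (0≤ι L) (≤-trans (≤-reflexive f₁-f₃) (diff-diff e₁ e₃))) ⟩
          ι (q ℕ.* q) * (ι L * (ε + ε))              ≈⟨ solve 3 (λ q L ε → q :* (L :* (ε :+ ε)) := q :* (L :* (con (+ 1) :+ (con (+ 1) :+ con (+ 0)))) :* ε) refl (ι (q ℕ.* q)) (ι L) ε ⟩
          ι (q ℕ.* q) * (ι L * ι 2) * ε              ≈⟨ *-congʳ (trans (*-congˡ (sym (ι-* L 2))) (sym (ι-* (q ℕ.* q) (L ℕ.* 2)))) ⟩
          ι (q ℕ.* q ℕ.* (L ℕ.* 2)) * ε              ∎)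
          where
          open ≤-Reasoning
          _⟨≤⟩_ = ℕ.≤-trans
          L2≤T : L ℕ.* 2 ℕ.≤ T
          L2≤T = ℕ.*-monoˡ-≤ 2 (ℕ.m≤m+n L 2) ⟨≤⟩ (ℕ.≤-reflexive (ℕ.*-comm B 2) ⟨≤⟩ (ℕ.*-monoˡ-≤ B (ℕ.m≤m+n 2 6) ⟨≤⟩ 8B≤T))
          f₁-f₃ : ∣ f₁ - f₃ ∣ ≈ ∣ (s₁ - s₃) - (f₁ - f₃) ∣
          f₁-f₃ = trans (sym (abs-neg _)) (abs-cong (sym (trans (+-congʳ (x≈y⇒x-y≈0 s₁≈s₃)) (+-identityˡ _))))

        -- If s₂ ≈ s₀, then ∣ x₀ - r₂ ∣ ≤ L ε, which is closer to x₀ than `repelled-x₀` allows for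
        -- the denominator q.
        s₂≉s₀ : s₂ ≉ s₀
        s₂≉s₀ s₂≈s₀ = negligible (ℕ.≤-trans (*-≤-^ T (6 ℕ.* κ) 6 (^-≤-^ T 6 κ 2q≤T⁶) (*-≤-^ T 5 1 q≤T⁵ (≤-^1 L≤T)))
                                            (ℕ.^-monoʳ-≤ T (ℕ.+-mono-≤ (ℕ.*-monoˡ-≤ κ (ℕ.m≤m+n 6 12)) (ℕ.m≤m+n 6 12)))) (begin
          1#                                          ≤⟨ repelled-x₀ q 0<q (integer den-r₂) ⟩
          ι ((2 ℕ.* q) ℕ.^ κ) * ∣ ι q * x₀ - ι q * r₂ ∣  ≈⟨ *-congˡ (trans (abs-cong (solve 3 (λ q x r → q :* x :- q :* r := q :* (x :- r)) refl (ι q) x₀ r₂)) (ι-abs-* q _)) ⟩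
          ι ((2 ℕ.* q) ℕ.^ κ) * (ι q * ∣ x₀ - r₂ ∣)   ≤⟨ *-monoˡ-≤ _ (0≤ι ((2 ℕ.* q) ℕ.^ κ)) (*-monoˡ-≤ _ (0≤ι q) (≤-trans (colipschitz x₀∈ r₂∈) (*-monoˡ-≤ _ (0≤ι L) (≤-trans (≤-reflexive (abs-cong (+-congʳ (sym s₂≈s₀)))) e₂)))) ⟩
          ι ((2 ℕ.* q) ℕ.^ κ) * (ι q * (ι L * ε))     ≈⟨ solve 4 (λ a q L ε → a :* (q :* (L :* ε)) := a :* (q :* L) :* ε) refl (ι ((2 ℕ.* q) ℕ.^ κ)) (ι q) (ι L) ε ⟩
          ι ((2 ℕ.* q) ℕ.^ κ) * (ι q * ι L) * ε       ≈⟨ *-congʳ (trans (*-congˡ (sym (ι-* q L))) (sym (ι-* ((2 ℕ.* q) ℕ.^ κ) (q ℕ.* L)))) ⟩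
          ι ((2 ℕ.* q) ℕ.^ κ ℕ.* (q ℕ.* L)) * ε       ∎)
          where
          open ≤-Reasoning
          2q≤T⁶ : 2 ℕ.* q ℕ.≤ T ℕ.^ 6
          2q≤T⁶ = ℕ.*-mono-≤ 2≤T q≤T⁵
          L≤T : L ℕ.≤ T
          L≤T = ℕ.≤-trans (ℕ.m≤m+n L 2) (ℕ.≤-trans (ℕ.m≤n*m B 8) 8B≤T)

      -- All three factors of α have been shown or assumed nonzero, against `α≈0`.
      three-approximations : ⊥
      three-approximations = *-≉0 (*-≉0 (λ eq → s₁≉s₃ (x-y≈0⇒x≈y eq)) (λ eq → s₂≉s₀ (x-y≈0⇒x≈y eq))) (λ eq → r₂≉r₃ (x-y≈0⇒x≈y eq)) α≈0

-- J + 1 blocks of J + 1 points each: every block has a collision, and two of these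
-- collisions have the same value.
three-collide : ∀ J (f : Fin (suc J) → Fin (suc J) → Fin J) →
                ∃[ b ] ∃[ k ] ∃[ k′ ] ∃[ b″ ] ∃[ k″ ]
                  k ≢ k′ × b ≢ b″ × f b k ≡ f b k′ × f b k ≡ f b″ k″
three-collide J f = from (Fin.pigeonhole (ℕ.n<1+n J) λ b → f b (proj₁ (collide b)))
  where
  collide : ∀ b → ∃[ k ] ∃[ k′ ] k Fin.< k′ × f b k ≡ f b k′
  collide b = Fin.pigeonhole (ℕ.n<1+n J) (f b)
  from : ∃[ b ] ∃[ b″ ] b Fin.< b″ × f b (proj₁ (collide b)) ≡ f b″ (proj₁ (collide b″)) → _
  from (b , b″ , b<b″ , eq) = b , proj₁ (collide b) , proj₁ (proj₂ (collide b)) , b″ , proj₁ (collide b″)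
    , Fin.<⇒≢ (proj₁ (proj₂ (proj₂ (collide b)))) , Fin.<⇒≢ b<b″ , proj₂ (proj₂ (proj₂ (collide b))) , eq

-- Successive squaring of t covers the range. Squaring, unlike doubling, makes the number J of
-- classes independent of t, and T ≤ Q ≤ T² is the comparability that `three-approximations`
-- tolerates.
dyadic-class : ∀ {t Q} J → t ℕ.≤ Q → Q ℕ.< t ℕ.^ (2 ℕ.^ J) →
               ∃[ j ] t ℕ.^ (2 ℕ.^ toℕ {J} j) ℕ.≤ Q × Q ℕ.≤ (t ℕ.^ (2 ℕ.^ toℕ j)) ℕ.^ 2
dyadic-class {t} {Q} zero t≤Q Q<t = contradiction (ℕ.≤-trans (ℕ.≤-reflexive (ℕ.*-identityʳ t)) t≤Q) (ℕ.<⇒≱ Q<t)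
dyadic-class {t} {Q} (suc J) t≤Q Q< = from (Q ℕ.<? t ℕ.^ (2 ℕ.^ J))
  where
  Goal : Set
  Goal = ∃[ j ] t ℕ.^ (2 ℕ.^ toℕ {suc J} j) ℕ.≤ Q × Q ℕ.≤ (t ℕ.^ (2 ℕ.^ toℕ j)) ℕ.^ 2
  from : Dec (Q ℕ.< t ℕ.^ (2 ℕ.^ J)) → Goal
  from (yes Q<t^) = weaken (dyadic-class J t≤Q Q<t^)
    where
    weaken : ∃[ j ] t ℕ.^ (2 ℕ.^ toℕ {J} j) ℕ.≤ Q × Q ℕ.≤ (t ℕ.^ (2 ℕ.^ toℕ j)) ℕ.^ 2 → Goal
    weaken (j , bounds) = Fin.inject₁ j
      , ≡.subst (λ i → t ℕ.^ (2 ℕ.^ i) ℕ.≤ Q × Q ℕ.≤ (t ℕ.^ (2 ℕ.^ i)) ℕ.^ 2) (≡.sym (Fin.toℕ-inject₁ j)) bounds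
  from (no Q≮t^) = Fin.fromℕ J
    , ≡.subst (λ i → t ℕ.^ (2 ℕ.^ i) ℕ.≤ Q × Q ℕ.≤ (t ℕ.^ (2 ℕ.^ i)) ℕ.^ 2) (≡.sym (Fin.toℕ-fromℕ J))
      (ℕ.≮⇒≥ Q≮t^ , ℕ.≤-trans (ℕ.<⇒≤ Q<) (ℕ.≤-reflexive
        (≡.trans (≡.cong (t ℕ.^_) (ℕ.*-comm 2 (2 ℕ.^ J))) (≡.sym (ℕ.^-*-assoc t (2 ℕ.^ J) 2)))))

-- Subballs whose image avoids rationals of small denominator.

module Construction (em : ExcludedMiddle 0ℓ) (ℝ : CompleteOrderedField) where
  open Germs em ℝ public

  private variable
    x y z c : Carrier

  -- The ball of radius t ^ -k about c, stated without division; the record keeps t, k and c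
  -- inferable.
  record Near (t k : ℕ) (c z : Carrier) : Set where
    constructor near
    field near-≤ : ι (t ℕ.^ k) * ∣ z - c ∣ ≤ 1#

  open Near public

  ι-^suc : ∀ t k → ι (t ℕ.^ suc k) ≈ ι t * ι (t ℕ.^ k)
  ι-^suc t k = ι-* t (t ℕ.^ k)

  module Step {f x₀ R} (germ : Germ f x₀ R) where
    open Germ germ public
    open ThreeApproximations germ using (K; T₀; three-approximations) public

    -- The summand 4 L + 4 serves the comparisons 2 + 2 L < t and 2 + L (t + 2) < t², on which the
    -- proof of `not-both` rests.
    T₁ : ℕ
    T₁ = T₀ ℕ.+ (4 ℕ.* L ℕ.+ 4)

    module _ {t} (T₁≤t : T₁ ℕ.≤ t) where
      private
        4L+4≤t : 4 ℕ.* L ℕ.+ 4 ℕ.≤ t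
        4L+4≤t = ℕ.≤-trans (ℕ.m≤n+m _ T₀) T₁≤t

      4≤t : 4 ℕ.≤ t
      4≤t = ℕ.≤-trans (ℕ.m≤n+m 4 (4 ℕ.* L)) 4L+4≤t

      private
        2L+2<t : 2 ℕ.+ 2 ℕ.* L ℕ.< t
        2L+2<t = ℕ.≤-trans (ℕ.≤-trans (ℕ.+-mono-≤ (ℕ.m≤m+n 3 1) (ℕ.*-monoˡ-≤ L (ℕ.m≤m+n 2 2))) (ℕ.≤-reflexive (ℕ.+-comm 4 (4 ℕ.* L)))) 4L+4≤t

        growth : 2 ℕ.+ L ℕ.* (t ℕ.+ 2) ℕ.< t ℕ.* t
        growth = ℕ.<-≤-trans (ℕ.≤-<-trans (ℕ.≤-reflexive (expand L t)) (ℕ.+-monoˡ-< (L ℕ.* t) 2L+2<t))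
                             (ℕ.≤-trans (ℕ.≤-reflexive (collect L t)) (ℕ.*-monoˡ-≤ t (ℕ.≤-trans (ℕ.+-mono-≤ {1} {4} {L} {4 ℕ.* L} (ℕ.m≤m+n 1 3) (ℕ.m≤m+n L _)) (ℕ.≤-trans (ℕ.≤-reflexive (ℕ.+-comm 4 (4 ℕ.* L))) 4L+4≤t))))
          where
          expand : ∀ L t → 2 ℕ.+ L ℕ.* (t ℕ.+ 2) ≡ 2 ℕ.+ 2 ℕ.* L ℕ.+ L ℕ.* t
          expand = ℕ-Solver.solve-∀
          collect : ∀ L t → t ℕ.+ L ℕ.* t ≡ (1 ℕ.+ L) ℕ.* t
          collect = ℕ-Solver.solve-∀

        0<t : 0 ℕ.< t
        0<t = ℕ.≤-trans (ℕ.s≤s ℕ.z≤n) 4≤t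

        instance
          t≢0 : NonZero t
          t≢0 = ℕ.>-nonZero 0<t

        θ τ : Carrier
        θ = ι t
        τ = ι (t ℕ.^ 3)

        0<τ : 0# < τ
        0<τ = 0<ι (ℕ.m^n>0 t 3)

        0<2τ : 0# < τ + τ
        0<2τ = +-pos 0<τ 0<τ

        -- This is 1 / (2 t³), half the radius of the outer ball: the balls of radius t⁻⁴ about c +
        -- h and c - h stay inside it and miss c.
        h : Carrier
        h = recip (τ + τ) (>⇒≉ 0<2τ)

        2τh≈1 : (τ + τ) * h ≈ 1#
        2τh≈1 = *-recip (>⇒≉ 0<2τ)

        0≤h : 0# ≤ h
        0≤h = <⇒≤ (recip-pos 0<2τ)

        1+1≤θ : 1# + 1# ≤ θ
        1+1≤θ = ≤-trans (≤-reflexive (+-congˡ (sym (+-identityʳ 1#)))) (ι-mono-≤ {2} {t} (ℕ.≤-trans (ℕ.m≤m+n 2 2) 4≤t))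

        1+1<θ : 1# + 1# < θ
        1+1<θ = ≤-<-trans (≤-reflexive (+-congˡ (sym (+-identityʳ 1#)))) (ι-mono-< {2} {t} (ℕ.≤-trans (ℕ.m≤m+n 3 1) 4≤t))

        near₄ : ∀ {c z} → Near t 4 c z → θ * (τ * ∣ z - c ∣) ≤ 1#
        near₄ (near n) = ≤-trans (≤-reflexive (trans (sym (*-assoc _ _ _)) (*-congʳ (sym (ι-^suc t 3))))) n

        2τ-near₄ : ∀ {c z} → Near t 4 c z → τ * ∣ z - c ∣ + τ * ∣ z - c ∣ ≤ 1#
        2τ-near₄ {c} {z} n = begin
          τ * ∣ z - c ∣ + τ * ∣ z - c ∣      ≈⟨ solve 1 (λ a → a :+ a := (con (+ 1) :+ con (+ 1)) :* a) refl _ ⟩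
          (1# + 1#) * (τ * ∣ z - c ∣)        ≤⟨ *-monoʳ-≤ _ (*-nonNeg (<⇒≤ 0<τ) (0≤∣x∣ _)) 1+1≤θ ⟩
          θ * (τ * ∣ z - c ∣)                ≤⟨ near₄ n ⟩
          1#                                 ∎
          where open ≤-Reasoning

        shift : ∀ {c z h′} → ∣ h′ ∣ ≈ h → Near t 4 (c + h′) z → Near t 3 c z
        shift {c} {z} {h′} ∣h′∣≈h n = near (*-cancelˡ-≤ (1# + 1#) 0<2 (begin
          (1# + 1#) * (τ * ∣ z - c ∣)
            ≤⟨ *-monoˡ-≤ _ (<⇒≤ 0<2) (*-monoˡ-≤ τ (<⇒≤ 0<τ) (≤-trans (≤-reflexive (abs-cong (solve 3 (λ z c h → z :- c := (z :- (c :+ h)) :+ h) refl z c h′)))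
                    (≤-trans (triangle _ _) (+-mono-≤ ≤-refl (≤-reflexive ∣h′∣≈h))))) ⟩
          (1# + 1#) * (τ * (∣ z - (c + h′) ∣ + h))
            ≈⟨ solve 3 (λ τ a h → (con (+ 1) :+ con (+ 1)) :* (τ :* (a :+ h)) := (τ :* a :+ τ :* a) :+ (τ :+ τ) :* h) refl τ _ h ⟩
          (τ * ∣ z - (c + h′) ∣ + τ * ∣ z - (c + h′) ∣) + (τ + τ) * h
            ≤⟨ +-mono-≤ (2τ-near₄ n) (≤-reflexive 2τh≈1) ⟩
          1# + 1#
            ≈⟨ sym (*-identityʳ _) ⟩
          (1# + 1#) * 1#
            ∎))
          where
          open ≤-Reasoning

        avoids : ∀ {c z h′} → ∣ h′ ∣ ≈ h → Near t 4 (c + h′) z → z ≉ c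
        avoids {c} {z} {h′} ∣h′∣≈h n z≈c = <⇒≱ 1+1<θ (begin
          θ                                       ≈⟨ sym (*-identityʳ θ) ⟩
          θ * 1#                                  ≈⟨ *-congˡ (sym 2τh≈1) ⟩
          θ * ((τ + τ) * h)                       ≈⟨ *-congˡ (*-congˡ (trans (sym ∣h′∣≈h) (sym (trans (abs-cong z-c-h′) (abs-neg h′))))) ⟩
          θ * ((τ + τ) * ∣ z - (c + h′) ∣)        ≈⟨ solve 3 (λ θ τ a → θ :* ((τ :+ τ) :* a) := θ :* (τ :* a) :+ θ :* (τ :* a)) refl θ τ _ ⟩
          θ * (τ * ∣ z - (c + h′) ∣) + θ * (τ * ∣ z - (c + h′) ∣)  ≤⟨ +-mono-≤ (near₄ n) (near₄ n) ⟩
          1# + 1#                                 ∎)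
          where
          open ≤-Reasoning
          z-c-h′ : z - (c + h′) ≈ - h′
          z-c-h′ = trans (+-congʳ z≈c) (solve 2 (λ c h → c :- (c :+ h) := :- h) refl c h′)

      Avoiding : Carrier → Set
      Avoiding c′ = ∀ z → Near t 4 c′ z → ∀ Q s → 0 ℕ.< Q → Q ℕ.≤ t → Den Q s → 1# ≤ ι (t ℕ.^ 4) * ∣ f z - s ∣

      private
        -- The two candidate balls are about t⁻³ apart, while distinct fractions
        -- with denominators at most t are at least t⁻² apart.
        not-both : ∀ {c z₁ z₂ Q₁ Q₂ s₁ s₂} →
                   Near t 4 (c + h) z₁ → Near t 4 (c + - h) z₂ → Ball x₀ R z₁ → Ball x₀ R z₂ →
                   0 ℕ.< Q₁ → 0 ℕ.< Q₂ → Q₁ ℕ.≤ t → Q₂ ℕ.≤ t → Den Q₁ s₁ → Den Q₂ s₂ →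
                   ι (t ℕ.^ 4) * ∣ f z₁ - s₁ ∣ < 1# → ι (t ℕ.^ 4) * ∣ f z₂ - s₂ ∣ < 1# → ⊥
        not-both {c} {z₁} {z₂} {Q₁} {Q₂} {s₁} {s₂} n₁ n₂ z₁∈ z₂∈ 0<Q₁ 0<Q₂ Q₁≤t Q₂≤t d₁ d₂ b₁ b₂ = decide (s₁ ≟ s₂)
          where
          open ≤-Reasoning
          σ : Carrier
          σ = ι (t ℕ.^ 4)
          0≤σ : 0# ≤ σ
          0≤σ = 0≤ι (t ℕ.^ 4)
          σ2h≈θ : σ * (h + h) ≈ θ
          σ2h≈θ = trans (*-congʳ (ι-^suc t 3)) (trans (solve 3 (λ θ τ h → θ :* τ :* (h :+ h) := θ :* ((τ :+ τ) :* h)) refl θ τ h) (trans (*-congˡ 2τh≈1) (*-identityʳ θ)))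
          upper : σ * ∣ z₁ - z₂ ∣ ≤ θ + ι 2
          upper = begin
            σ * ∣ z₁ - z₂ ∣
              ≤⟨ *-monoˡ-≤ _ 0≤σ (≤-trans (≤-reflexive (abs-cong (solve 4 (λ z₁ z₂ c h → z₁ :- z₂ := (h :+ h) :+ ((z₁ :- (c :+ h)) :- (z₂ :- (c :+ :- h)))) refl z₁ z₂ c h)))
                   (≤-trans (triangle _ _) (+-mono-≤ (≤-reflexive (abs-nonNeg (+-nonNeg 0≤h 0≤h))) (triangle-− _ _)))) ⟩
            σ * ((h + h) + (∣ z₁ - (c + h) ∣ + ∣ z₂ - (c + - h) ∣))
              ≈⟨ solve 4 (λ σ h a b → σ :* ((h :+ h) :+ (a :+ b)) := σ :* (h :+ h) :+ (σ :* a :+ σ :* b)) refl σ h _ _ ⟩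
            σ * (h + h) + (σ * ∣ z₁ - (c + h) ∣ + σ * ∣ z₂ - (c + - h) ∣)
              ≤⟨ +-mono-≤ (≤-reflexive σ2h≈θ) (+-mono-≤ (near-≤ n₁) (near-≤ n₂)) ⟩
            θ + (1# + 1#)
              ≈⟨ +-congˡ (+-congˡ (sym (+-identityʳ 1#))) ⟩
            θ + ι 2
              ∎
          lower : θ ≤ ι 2 + σ * ∣ z₁ - z₂ ∣
          lower = begin
            θ
              ≈⟨ sym σ2h≈θ ⟩
            σ * (h + h)
              ≤⟨ *-monoˡ-≤ _ 0≤σ (≤-trans (x≤∣x∣ _) (≤-trans (≤-reflexive (abs-cong (solve 4 (λ z₁ z₂ c h → h :+ h := ((z₂ :- (c :+ :- h)) :- (z₁ :- (c :+ h))) :+ (z₁ :- z₂)) refl z₁ z₂ c h)))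
                   (≤-trans (triangle _ _) (+-mono-≤ (triangle-− _ _) ≤-refl)))) ⟩
            σ * ((∣ z₂ - (c + - h) ∣ + ∣ z₁ - (c + h) ∣) + ∣ z₁ - z₂ ∣)
              ≈⟨ solve 4 (λ σ a b d → σ :* ((a :+ b) :+ d) := (σ :* a :+ σ :* b) :+ σ :* d) refl σ _ _ _ ⟩
            (σ * ∣ z₂ - (c + - h) ∣ + σ * ∣ z₁ - (c + h) ∣) + σ * ∣ z₁ - z₂ ∣
              ≤⟨ +-mono-≤ (+-mono-≤ (near-≤ n₂) (near-≤ n₁)) ≤-refl ⟩
            (1# + 1#) + σ * ∣ z₁ - z₂ ∣
              ≈⟨ +-congʳ (+-congˡ (sym (+-identityʳ 1#))) ⟩
            ι 2 + σ * ∣ z₁ - z₂ ∣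
              ∎
          f-near : ∀ {a b} → σ * ∣ a ∣ + σ * ∣ b ∣ ≤ ι 2 → ∀ e → σ * ∣ (a - b) + e ∣ ≤ ι 2 + σ * ∣ e ∣
          f-near {a} {b} ab e = begin
            σ * ∣ (a - b) + e ∣                     ≤⟨ *-monoˡ-≤ _ 0≤σ (≤-trans (triangle _ _) (+-mono-≤ (triangle-− _ _) ≤-refl)) ⟩
            σ * ((∣ a ∣ + ∣ b ∣) + ∣ e ∣)           ≈⟨ solve 4 (λ σ a b d → σ :* ((a :+ b) :+ d) := (σ :* a :+ σ :* b) :+ σ :* d) refl σ _ _ _ ⟩
            (σ * ∣ a ∣ + σ * ∣ b ∣) + σ * ∣ e ∣     ≤⟨ +-mono-≤ ab ≤-refl ⟩
            ι 2 + σ * ∣ e ∣                         ∎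
          both : σ * ∣ f z₁ - s₁ ∣ + σ * ∣ f z₂ - s₂ ∣ ≤ ι 2
          both = ≤-trans (+-mono-≤ (<⇒≤ b₁) (<⇒≤ b₂)) (≤-reflexive (+-congˡ (sym (+-identityʳ 1#))))
          both′ : σ * ∣ f z₂ - s₂ ∣ + σ * ∣ f z₁ - s₁ ∣ ≤ ι 2
          both′ = ≤-trans (≤-reflexive (+-comm _ _)) both
          decide : Dec (s₁ ≈ s₂) → ⊥
          -- One fraction near both images: by `colipschitz` the points z₁, z₂ are within 2 L / σ of
          -- each other, but they lie at least (t - 2) / σ apart because 2 h = t / σ.
          decide (yes s₁≈s₂) = <⇒≱ (ι-mono-< {2 ℕ.+ 2 ℕ.* L} {t} 2L+2<t) (begin
            θ                                       ≤⟨ lower ⟩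
            ι 2 + σ * ∣ z₁ - z₂ ∣                   ≤⟨ +-mono-≤ ≤-refl (*-monoˡ-≤ _ 0≤σ (colipschitz z₁∈ z₂∈)) ⟩
            ι 2 + σ * (ι L * ∣ f z₁ - f z₂ ∣)       ≈⟨ +-congˡ (solve 3 (λ σ L a → σ :* (L :* a) := (σ :* a) :* L) refl σ (ι L) _) ⟩
            ι 2 + σ * ∣ f z₁ - f z₂ ∣ * ι L         ≤⟨ +-mono-≤ ≤-refl (*-monoʳ-≤ _ (0≤ι L) (begin
                σ * ∣ f z₁ - f z₂ ∣                 ≈⟨ *-congˡ (abs-cong (trans (solve 3 (λ a b s → a :- b := ((a :- s) :- (b :- s)) :+ con (+ 0)) refl (f z₁) (f z₂) s₁) (+-congʳ (+-congˡ (-‿cong (+-congˡ (-‿cong s₁≈s₂))))))) ⟩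
                σ * ∣ ((f z₁ - s₁) - (f z₂ - s₂)) + 0# ∣  ≤⟨ f-near both 0# ⟩
                ι 2 + σ * ∣ 0# ∣                    ≈⟨ +-congˡ (*-congˡ (abs-nonNeg ≤-refl)) ⟩
                ι 2 + σ * 0#                        ≈⟨ trans (+-congˡ (zeroʳ σ)) (+-identityʳ _) ⟩
                ι 2                                 ∎)) ⟩
            ι 2 + ι 2 * ι L                         ≈⟨ +-congˡ (sym (ι-* 2 L)) ⟩
            ι 2 + ι (2 ℕ.* L)                       ≈⟨ sym (ι-+ 2 (2 ℕ.* L)) ⟩
            ι (2 ℕ.+ 2 ℕ.* L)                       ∎)
          -- Two fractions: their distance is at least t⁻² = t² / σ, while `lipschitz` keeps the
          -- images within L (t + 2) / σ.
          decide (no s₁≉s₂) = <⇒≱ (ι-mono-< {2 ℕ.+ L ℕ.* (t ℕ.+ 2)} {t ℕ.* t} growth) (begin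
            ι (t ℕ.* t)                                   ≈⟨ sym (*-identityʳ _) ⟩
            ι (t ℕ.* t) * 1#                              ≤⟨ *-monoˡ-≤ _ (0≤ι (t ℕ.* t)) (≤-trans (den-gap d₁ d₂ s₁≉s₂ 0<Q₁ 0<Q₂) (ι-scale-≤ (ℕ.*-mono-≤ Q₁≤t Q₂≤t) (0≤∣x∣ _))) ⟩
            ι (t ℕ.* t) * (ι (t ℕ.* t) * ∣ s₁ - s₂ ∣)     ≈⟨ trans (sym (*-assoc _ _ _)) (*-congʳ (trans (sym (ι-* (t ℕ.* t) (t ℕ.* t))) (ι-cong (fourth t)))) ⟩
            σ * ∣ s₁ - s₂ ∣                               ≈⟨ *-congˡ (abs-cong (solve 4 (λ a b s s′ → s :- s′ := ((b :- s′) :- (a :- s)) :+ (a :- b)) refl (f z₁) (f z₂) s₁ s₂)) ⟩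
            σ * ∣ ((f z₂ - s₂) - (f z₁ - s₁)) + (f z₁ - f z₂) ∣  ≤⟨ f-near both′ (f z₁ - f z₂) ⟩
            ι 2 + σ * ∣ f z₁ - f z₂ ∣                     ≤⟨ +-mono-≤ ≤-refl (*-monoˡ-≤ _ 0≤σ (lipschitz z₁∈ z₂∈)) ⟩
            ι 2 + σ * (ι L * ∣ z₁ - z₂ ∣)                 ≈⟨ +-congˡ (solve 3 (λ σ L a → σ :* (L :* a) := L :* (σ :* a)) refl σ (ι L) _) ⟩
            ι 2 + ι L * (σ * ∣ z₁ - z₂ ∣)                 ≤⟨ +-mono-≤ ≤-refl (*-monoˡ-≤ _ (0≤ι L) upper) ⟩
            ι 2 + ι L * (θ + ι 2)                         ≈⟨ +-congˡ (trans (*-congˡ (sym (ι-+ t 2))) (sym (ι-* L (t ℕ.+ 2)))) ⟩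
            ι 2 + ι (L ℕ.* (t ℕ.+ 2))                     ≈⟨ sym (ι-+ 2 (L ℕ.* (t ℕ.+ 2))) ⟩
            ι (2 ℕ.+ L ℕ.* (t ℕ.+ 2))                     ∎)
            where
            fourth : ∀ t → t ℕ.* t ℕ.* (t ℕ.* t) ≡ t ℕ.* (t ℕ.* (t ℕ.* (t ℕ.* 1)))
            fourth = ℕ-Solver.solve-∀

      -- If the ball about c + h fails, `not-both` shows that the one about c - h succeeds. Moving
      -- off c has a second use: the limit will differ from every centre, as the strict inequality 0
      -- < ∣ ξ - p / q ∣ demands.
      avoid-small-denominators : ∀ {c} → (∀ z → Near t 3 c z → Ball x₀ R z) →
        ∃[ c′ ] (∀ z → Near t 4 c′ z → Near t 3 c z) × (∀ z → Near t 4 c′ z → z ≉ c) × Avoiding c′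
      avoid-small-denominators {c} inside = decide em
        where
        ∣-h∣ : ∣ - h ∣ ≈ h
        ∣-h∣ = trans (abs-neg h) (abs-nonNeg 0≤h)
        decide : Dec (Avoiding (c + h)) →
          ∃[ c′ ] (∀ z → Near t 4 c′ z → Near t 3 c z) × (∀ z → Near t 4 c′ z → z ≉ c) × Avoiding c′
        decide (yes avoiding) = c + h , (λ _ → shift (abs-nonNeg 0≤h)) , (λ _ → avoids (abs-nonNeg 0≤h)) , avoiding
        decide (no ¬avoiding) = c + - h , (λ _ → shift ∣-h∣) , (λ _ → avoids ∣-h∣)
          , λ z₂ n₂ Q₂ s₂ 0<Q₂ Q₂≤t d₂ → ≮⇒≥ λ b₂ → ¬avoiding λ z₁ n₁ Q₁ s₁ 0<Q₁ Q₁≤t d₁ → ≮⇒≥ λ b₁ →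
            not-both n₁ n₂ (inside z₁ (shift (abs-nonNeg 0≤h) n₁)) (inside z₂ (shift ∣-h∣ n₂)) 0<Q₁ 0<Q₂ Q₁≤t Q₂≤t d₁ d₂ b₁ b₂

-- Fractions whose images are far from rationals of medium denominator; one step of the
-- construction.

module Jump (em : ExcludedMiddle 0ℓ) (ℝ : CompleteOrderedField) where
  open Construction em ℝ public

  private variable
    x y z : Carrier

  -- With p the floor of q c, the numerators p, ..., p + m are within m of q c; 1 ≤ m accounts for
  -- small i, where the distance can be close to 1.
  fractions-near : ∀ c q m .{{_ : NonZero q}} → 1 ℕ.≤ m →
    ∃[ p ] (∀ i → i ℕ.≤ m → ι q * ∣ (p ℤ.+ + i) / q - c ∣ ≤ ι m)
  fractions-near c q m 1≤m = p , λ i i≤m → begin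
    ι q * ∣ (p ℤ.+ + i) / q - c ∣     ≈⟨ *-congˡ (abs-swap _ c) ⟩
    ι q * ∣ c - (p ℤ.+ + i) / q ∣     ≈⟨ q∣ξ-p/q∣ (p ℤ.+ + i) q c ⟩
    ∣ ι q * c - ιℤ (p ℤ.+ + i) ∣      ≈⟨ abs-cong (+-congˡ (-‿cong (ιℤ-+ p (+ i)))) ⟩
    ∣ ι q * c - (ιℤ p + ι i) ∣        ≤⟨ abs-≤
        (linear-≤ (+-mono-≤ (<⇒≤ qc<p+1) (+-mono-≤ (1≤ι {m} 1≤m) (0≤ι i)))
          (solve 4 (λ m x p i → m :- (x :- (p :+ i)) := (p :+ con (+ 1)) :+ (m :+ i) :- (x :+ (con (+ 1) :+ con (+ 0)))) refl (ι m) (ι q * c) (ιℤ p) (ι i)))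
        (linear-≤ (+-mono-≤ p≤qc (ι-mono-≤ i≤m))
          (solve 4 (λ m x p i → m :- (:- (x :- (p :+ i))) := x :+ m :- (p :+ i)) refl (ι m) (ι q * c) (ιℤ p) (ι i))) ⟩
    ι m                               ∎
    where
    open ≤-Reasoning
    p = proj₁ (floor (ι q * c))
    p≤qc = proj₁ (proj₂ (floor (ι q * c)))
    qc<p+1 = proj₂ (proj₂ (floor (ι q * c)))

  /-injective : ∀ {p p′} q .{{_ : NonZero q}} → p / q ≈ p′ / q → ιℤ p ≈ ιℤ p′
  /-injective {p} {p′} q eq = trans (sym (q*[p/q]≈p p q)) (trans (*-congˡ eq) (q*[p/q]≈p p′ q))

  ι-injective : ∀ {m n} → ι m ≈ ι n → m ≡ n
  ι-injective {m} {n} eq = ℕ.≤-antisym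
    (ℕ.≮⇒≥ λ n<m → <-irrefl (sym eq) (ι-mono-< n<m))
    (ℕ.≮⇒≥ λ m<n → <-irrefl eq (ι-mono-< m<n))

  fractions-distinct : ∀ p q .{{_ : NonZero q}} {i i′} → i ≢ i′ → (p ℤ.+ + i) / q ≉ (p ℤ.+ + i′) / q
  fractions-distinct p q {i} {i′} i≢i′ eq = i≢i′ (ι-injective (begin
    ι i                   ≈⟨ solve 2 (λ p i → i := (p :+ i) :- p) refl (ιℤ p) _ ⟩
    (ιℤ p + ι i) - ιℤ p   ≈⟨ +-congʳ (trans (sym (ιℤ-+ p (+ i))) (trans (/-injective {p ℤ.+ + i} {p ℤ.+ + i′} q eq) (ιℤ-+ p (+ i′)))) ⟩
    (ιℤ p + ι i′) - ιℤ p  ≈⟨ solve 2 (λ p i → (p :+ i) :- p := i) refl (ιℤ p) _ ⟩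
    ι i′                  ∎))
    where open import Relation.Binary.Reasoning.Setoid setoid

  module JumpStep {f x₀ R} (germ : Germ f x₀ R) where
    open Step germ public

    NoApproximation : (A W k : ℕ) → Carrier → Set
    NoApproximation A W k y = ∀ Q s → A ℕ.≤ Q → Q ℕ.< W → Den Q s → 1# ≤ ι (Q ℕ.^ k) * ∣ y - s ∣

    -- The candidates are (J + 1)² consecutive fractions of denominator t⁵ next to c′. Each of the J
    -- classes of Q spoils at most two of them, so by `three-collide` one survives. The doubled
    -- distance in the conclusion leaves half of the ball about c′ free for the next ball about r.
    jump : ∀ {t c′} J → T₁ ℕ.≤ t → 2 ℕ.* (suc J ℕ.* suc J) ℕ.≤ t → (∀ z → Near t 4 c′ z → Ball x₀ R z) →
           ∃[ r ] Den (t ℕ.^ 5) r × ι (t ℕ.^ 4) * (∣ r - c′ ∣ + ∣ r - c′ ∣) ≤ 1# ×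
             NoApproximation t (t ℕ.^ (2 ℕ.^ J)) K (f r)
    jump {t} {c′} J T₁≤t 2m≤t inside = decide em
      where
      m q : ℕ
      m = suc J ℕ.* suc J
      q = t ℕ.^ 5

      0<t : 0 ℕ.< t
      0<t = ℕ.≤-trans (ℕ.s≤s ℕ.z≤n) (4≤t T₁≤t)

      instance
        t≢0 : NonZero t
        t≢0 = ℕ.>-nonZero 0<t
        q≢0 : NonZero q
        q≢0 = ℕ.m^n≢0 t 5

      p : ℤ
      p = proj₁ (fractions-near c′ q m (ℕ.s≤s ℕ.z≤n))

      r : Fin m → Carrier
      r i = (p ℤ.+ + toℕ i) / q

      den-r : ∀ i → Den q (r i)
      den-r i = den-/ (p ℤ.+ + toℕ i) q

      r-near₂ : ∀ i → ι (t ℕ.^ 4) * (∣ r i - c′ ∣ + ∣ r i - c′ ∣) ≤ 1#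
      r-near₂ i = *-cancelˡ-≤ (ι t) (0<ι 0<t) (begin
        ι t * (ι (t ℕ.^ 4) * (∣ r i - c′ ∣ + ∣ r i - c′ ∣))
          ≈⟨ solve 3 (λ t u a → t :* (u :* (a :+ a)) := t :* u :* a :+ t :* u :* a) refl (ι t) (ι (t ℕ.^ 4)) _ ⟩
        ι t * ι (t ℕ.^ 4) * ∣ r i - c′ ∣ + ι t * ι (t ℕ.^ 4) * ∣ r i - c′ ∣
          ≈⟨ +-cong (*-congʳ (sym (ι-^suc t 4))) (*-congʳ (sym (ι-^suc t 4))) ⟩
        ι q * ∣ r i - c′ ∣ + ι q * ∣ r i - c′ ∣
          ≤⟨ +-mono-≤ bound bound ⟩
        ι m + ι m
          ≈⟨ sym (ι-2* m) ⟩
        ι (2 ℕ.* m)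
          ≤⟨ ι-mono-≤ 2m≤t ⟩
        ι t
          ≈⟨ sym (*-identityʳ _) ⟩
        ι t * 1#
          ∎)
        where
        open ≤-Reasoning
        bound : ι q * ∣ r i - c′ ∣ ≤ ι m
        bound = proj₂ (fractions-near c′ q m (ℕ.s≤s ℕ.z≤n)) (toℕ i) (ℕ.<⇒≤ (Fin.toℕ<n i))

      r∈ : ∀ i → Ball x₀ R (r i)
      r∈ i = inside (r i) (near (≤-trans (*-monoˡ-≤ _ (0≤ι (t ℕ.^ 4))
        (x≤x+∣y∣ _ _)) (r-near₂ i)))

      r-distinct : ∀ {i i′} → i ≢ i′ → r i ≉ r i′
      r-distinct i≢i′ = fractions-distinct p q λ eq → i≢i′ (Fin.toℕ-injective eq)

      Bad : Fin J → Fin m → Set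
      Bad j i = ∃[ Q ] ∃[ s ] t ℕ.^ (2 ℕ.^ toℕ j) ℕ.≤ Q × Q ℕ.≤ (t ℕ.^ (2 ℕ.^ toℕ j)) ℕ.^ 2 ×
                  Den Q s × ι (Q ℕ.^ K) * ∣ f (r i) - s ∣ < 1#

      -- The denominator q = t ^ 5 is at most T ^ 5 for T = t ^ (2 ^ j), so the same fractions can
      -- be tested against every class.
      at-most-two : ∀ j {i₁ i₂ i₃} → i₁ ≢ i₂ → i₁ ≢ i₃ → i₂ ≢ i₃ → Bad j i₁ → Bad j i₂ → Bad j i₃ → ⊥
      at-most-two j {i₁} {i₂} {i₃} i₁≢i₂ i₁≢i₃ i₂≢i₃
        (Q₁ , s₁ , T≤Q₁ , Q₁≤T² , d₁ , b₁) (Q₂ , s₂ , T≤Q₂ , Q₂≤T² , d₂ , b₂) (Q₃ , s₃ , T≤Q₃ , Q₃≤T² , d₃ , b₃) =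
        three-approximations (ℕ.≤-trans T₀≤t t≤T) (ℕ.m^n>0 t 5) (ℕ.^-monoˡ-≤ 5 t≤T)
          (r∈ i₁) (r∈ i₂) (r∈ i₃) (den-r i₁) (den-r i₂) (den-r i₃)
          (r-distinct i₁≢i₂) (r-distinct i₁≢i₃) (r-distinct i₂≢i₃)
          T≤Q₁ T≤Q₂ T≤Q₃ Q₁≤T² Q₂≤T² Q₃≤T² d₁ d₂ d₃ b₁ b₂ b₃
        where
        T₀≤t : T₀ ℕ.≤ t
        T₀≤t = ℕ.≤-trans (ℕ.m≤m+n T₀ _) T₁≤t
        t≤T : t ℕ.≤ t ℕ.^ (2 ℕ.^ toℕ j)
        t≤T = ℕ.≤-trans (≤-^1 ℕ.≤-refl) (ℕ.^-monoʳ-≤ t (ℕ.m^n>0 2 (toℕ j)))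

      some-unbad : ¬ (∀ i → ∃[ j ] Bad j i)
      some-unbad all-bad = from (three-collide J λ b k → proj₁ (all-bad (combine b k)))
        where
        from : _ → ⊥
        from (b , k , k′ , b″ , k″ , k≢k′ , b≢b″ , eq′ , eq″) = at-most-two (proj₁ (all-bad (combine b k)))
          {combine b k} {combine b k′} {combine b″ k″}
          (λ eq → k≢k′ (proj₂ (Fin.combine-injective b k b k′ eq)))
          (λ eq → b≢b″ (proj₁ (Fin.combine-injective b k b″ k″ eq)))
          (λ eq → b≢b″ (proj₁ (Fin.combine-injective b k′ b″ k″ eq)))
          (proj₂ (all-bad (combine b k)))
          (≡.subst (λ j → Bad j (combine b k′)) (≡.sym eq′) (proj₂ (all-bad (combine b k′))))
          (≡.subst (λ j → Bad j (combine b″ k″)) (≡.sym eq″) (proj₂ (all-bad (combine b″ k″))))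

      Good : Fin m → Set
      Good i = NoApproximation t (t ℕ.^ (2 ℕ.^ J)) K (f (r i))

      bad : ∀ i → ¬ Good i → Dec (∃[ j ] Bad j i) → ∃[ j ] Bad j i
      bad i ¬good (yes b) = b
      bad i ¬good (no ¬b) = contradiction
        (λ Q s t≤Q Q<W d → ≮⇒≥ λ b → class-of Q s d b (dyadic-class J t≤Q Q<W)) ¬good
        where
        class-of : ∀ Q s → Den Q s → ι (Q ℕ.^ K) * ∣ f (r i) - s ∣ < 1# →
                   ∃[ j ] t ℕ.^ (2 ℕ.^ toℕ {J} j) ℕ.≤ Q × Q ℕ.≤ (t ℕ.^ (2 ℕ.^ toℕ j)) ℕ.^ 2 → ⊥
        class-of Q s d b (j , lo , hi) = ¬b (j , Q , s , lo , hi , d , b)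

      decide : Dec (∃ Good) → ∃[ r ] Den (t ℕ.^ 5) r × ι (t ℕ.^ 4) * (∣ r - c′ ∣ + ∣ r - c′ ∣) ≤ 1# ×
                 NoApproximation t (t ℕ.^ (2 ℕ.^ J)) K (f r)
      decide (yes (i , good)) = r i , den-r i , r-near₂ i , good
      decide (no none)        = contradiction (λ i → bad i (λ g → none (i , g)) em) some-unbad

    -- The next ball has radius below 1 / (2 L W ^ K), so on it f stays close enough to f r for all
    -- Q < W. The growing exponent 2 ^ n makes ξ Liouville; the fixed K keeps f ξ from being so.
    W next : ℕ → ℕ → ℕ
    W n t    = t ℕ.^ (2 ℕ.^ n)
    next n t = W n t ℕ.^ K

    module _ {n t : ℕ} (T₁≤t : T₁ ℕ.≤ t) where
      private
        instance
          t≢0 : NonZero t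
          t≢0 = ℕ.>-nonZero (ℕ.≤-trans (ℕ.s≤s ℕ.z≤n) (4≤t T₁≤t))

        W≢0 : NonZero (W n t)
        W≢0 = ℕ.m^n≢0 t (2 ℕ.^ n)

      t≤W : t ℕ.≤ W n t
      t≤W = ℕ.≤-trans (≤-^1 ℕ.≤-refl) (ℕ.^-monoʳ-≤ t (ℕ.m^n>0 2 n))

      t^K≤next : t ℕ.^ K ℕ.≤ next n t
      t^K≤next = ℕ.^-monoˡ-≤ K t≤W

      private
        18≤K : 18 ℕ.≤ K
        18≤K = ℕ.≤-trans (ℕ.m≤n+m 18 (18 ℕ.* κ)) (ℕ.n≤1+n _)

      t^-≤next : ∀ k → k ℕ.≤ 18 → t ℕ.^ k ℕ.≤ next n t
      t^-≤next k k≤18 = ℕ.≤-trans (ℕ.^-monoʳ-≤ t (ℕ.≤-trans k≤18 18≤K)) t^K≤next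

      t≤next : t ℕ.≤ next n t
      t≤next = ℕ.≤-trans (≤-^1 ℕ.≤-refl) (t^-≤next 1 (ℕ.m≤m+n 1 17))

      next≤next³ : next n t ℕ.≤ next n t ℕ.^ 3
      next≤next³ = ℕ.m≤m*n (next n t) (next n t ℕ.^ 2) {{ℕ.m^n≢0 (next n t) 2 {{ℕ.m^n≢0 (W n t) K {{W≢0}}}}}}

      2t⁴≤next³ : 2 ℕ.* t ℕ.^ 4 ℕ.≤ next n t ℕ.^ 3
      2t⁴≤next³ = ℕ.≤-trans (ℕ.*-monoˡ-≤ (t ℕ.^ 4) (ℕ.≤-trans (ℕ.m≤m+n 2 2) (4≤t T₁≤t)))
                            (ℕ.≤-trans (t^-≤next 5 (ℕ.m≤m+n 5 13)) next≤next³)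

      2LW^K≤next³ : 2 ℕ.* L ℕ.* W n t ℕ.^ K ℕ.≤ next n t ℕ.^ 3
      2LW^K≤next³ = ℕ.≤-trans (ℕ.≤-reflexive (ℕ.*-comm (2 ℕ.* L) _)) (ℕ.*-monoʳ-≤ (next n t) (ℕ.≤-trans 2L≤next
          (ℕ.m≤m*n (next n t) (next n t ℕ.^ 1) {{ℕ.m^n≢0 (next n t) 1 {{ℕ.m^n≢0 (W n t) K {{W≢0}}}}}})))
        where
        2L≤next : 2 ℕ.* L ℕ.≤ next n t
        2L≤next = ℕ.≤-trans (ℕ.*-monoˡ-≤ L (ℕ.m≤m+n 2 2)) (ℕ.≤-trans (ℕ.m≤m+n (4 ℕ.* L) 4)
                    (ℕ.≤-trans (ℕ.m≤n+m _ T₀) (ℕ.≤-trans T₁≤t t≤next)))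

      4t≤next : 4 ℕ.* t ℕ.≤ next n t
      4t≤next = ℕ.≤-trans (ℕ.*-mono-≤ {4} {t} {t} {t ℕ.* 1} (4≤t T₁≤t) (ℕ.≤-reflexive (≡.sym (ℕ.*-identityʳ t)))) (t^-≤next 2 (ℕ.m≤m+n 2 16))

    record Stage (n : ℕ) : Set where
      field
        t      : ℕ
        c      : Carrier
        T₁≤t   : T₁ ℕ.≤ t
        2m≤t   : 2 ℕ.* (suc n ℕ.* suc n) ℕ.≤ t
        inside : ∀ z → Near t 3 c z → Ball x₀ R z

    record Improves {n} (S : Stage n) (z : Carrier) : Set where
      open Stage S
      field
        nested : Near t 3 c z
        moved  : z ≉ c
        small  : ∀ Q s → 0 ℕ.< Q → Q ℕ.≤ t → Den Q s → 1# ≤ ι (t ℕ.^ 4) * ∣ f z - s ∣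
        medium : NoApproximation t (W n t) (suc K) (f z)

    -- The properties are obtained for every z of the next ball, so that they pass to the limit
    -- without any continuity argument.
    advance : ∀ {n} (S : Stage n) → let open Stage S in
      ∃[ c⁺ ] Den (t ℕ.^ 5) c⁺ × (∀ z → Near (next n t) 3 c⁺ z → Improves S z)
    advance {n} S = from₁ (avoid-small-denominators T₁≤t inside)
      where
      open Stage S
      t⁺ : ℕ
      t⁺ = next n t

      Goal : Set
      Goal = ∃[ c⁺ ] Den (t ℕ.^ 5) c⁺ × (∀ z → Near t⁺ 3 c⁺ z → Improves S z)

      2≤t : 2 ℕ.≤ t
      2≤t = ℕ.≤-trans (ℕ.m≤m+n 2 2) (4≤t T₁≤t)

      from₁ : ∃[ c′ ] (∀ z → Near t 4 c′ z → Near t 3 c z) × (∀ z → Near t 4 c′ z → z ≉ c) × Avoiding T₁≤t c′ → Goal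
      from₁ (c′ , shrink , avoids , avoiding) = from₂ (jump n T₁≤t 2m≤t λ z z∈ → inside z (shrink z z∈))
        where
        from₂ : ∃[ r ] Den (t ℕ.^ 5) r × ι (t ℕ.^ 4) * (∣ r - c′ ∣ + ∣ r - c′ ∣) ≤ 1# × NoApproximation t (W n t) K (f r) → Goal
        from₂ (r , den-r , r-near , good) = r , den-r , improves
          where
          τ σ : Carrier
          τ = ι (t⁺ ℕ.^ 3)
          σ = ι (t ℕ.^ 4)
          module _ (z : Carrier) (z∈ : Near t⁺ 3 r z) where
            open ≤-Reasoning
            a : Carrier
            a = ∣ z - r ∣

            2σa≤1 : (σ + σ) * a ≤ 1#
            2σa≤1 = begin
              (σ + σ) * a                 ≈⟨ *-congʳ (sym (ι-2* (t ℕ.^ 4))) ⟩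
              ι (2 ℕ.* t ℕ.^ 4) * a       ≤⟨ ι-scale-≤ (2t⁴≤next³ {n} T₁≤t) (0≤∣x∣ _) ⟩
              τ * a                       ≤⟨ near-≤ z∈ ⟩
              1#                          ∎

            z∈′ : Near t 4 c′ z
            z∈′ = near (*-cancelˡ-≤ (1# + 1#) 0<2 (begin
              (1# + 1#) * (σ * ∣ z - c′ ∣)       ≤⟨ *-monoˡ-≤ _ (<⇒≤ 0<2) (*-monoˡ-≤ σ (0≤ι (t ℕ.^ 4)) (triangle-via r)) ⟩
              (1# + 1#) * (σ * (a + ∣ r - c′ ∣))  ≈⟨ solve 3 (λ σ a b → (con (+ 1) :+ con (+ 1)) :* (σ :* (a :+ b)) := (σ :+ σ) :* a :+ σ :* (b :+ b)) refl σ a _ ⟩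
              (σ + σ) * a + σ * (∣ r - c′ ∣ + ∣ r - c′ ∣)  ≤⟨ +-mono-≤ 2σa≤1 r-near ⟩
              1# + 1#                            ≈⟨ sym (*-identityʳ _) ⟩
              (1# + 1#) * 1#                     ∎))

            r∈′ : Near t 4 c′ r
            r∈′ = near (≤-trans (*-monoˡ-≤ _ (0≤ι (t ℕ.^ 4))
              (x≤x+∣y∣ _ _)) r-near)

            z∈B : Ball x₀ R z
            z∈B = inside z (shrink z z∈′)

            r∈B : Ball x₀ R r
            r∈B = inside r (shrink r r∈′)

            -- Passing from r to z changes f by at most 1 / (2 Q ^ K), half of the bound known for
            -- r. The lost factor 2 is absorbed in the extra exponent, since 2 ≤ Q.
            medium : NoApproximation t (W n t) (suc K) (f z)
            medium Q s t≤Q Q<W d = begin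
              1#                                     ≤⟨ linear-≤ (+-mono-≤ 2≤ ω2≤) (solve 2 (λ x y → x :- con (+ 1) := (x :+ y) :+ con (+ 1) :- ((con (+ 1) :+ con (+ 1)) :+ y)) refl ((ω + ω) * ∣ f z - s ∣) ((ω + ω) * ∣ f r - f z ∣)) ⟩
              (ω + ω) * ∣ f z - s ∣                  ≈⟨ *-congʳ (sym (ι-2* (Q ℕ.^ K))) ⟩
              ι (2 ℕ.* Q ℕ.^ K) * ∣ f z - s ∣        ≤⟨ ι-scale-≤ (ℕ.*-monoˡ-≤ (Q ℕ.^ K) (ℕ.≤-trans 2≤t t≤Q)) (0≤∣x∣ _) ⟩
              ι (Q ℕ.^ suc K) * ∣ f z - s ∣          ∎
              where
              ω : Carrier
              ω = ι (Q ℕ.^ K)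
              0≤ω+ω : 0# ≤ ω + ω
              0≤ω+ω = +-nonNeg (0≤ι (Q ℕ.^ K)) (0≤ι (Q ℕ.^ K))
              2≤ : 1# + 1# ≤ (ω + ω) * ∣ f z - s ∣ + (ω + ω) * ∣ f r - f z ∣
              2≤ = begin
                1# + 1#                                    ≤⟨ +-mono-≤ (good Q s t≤Q Q<W d) (good Q s t≤Q Q<W d) ⟩
                ω * ∣ f r - s ∣ + ω * ∣ f r - s ∣          ≈⟨ sym (distribʳ _ ω ω) ⟩
                (ω + ω) * ∣ f r - s ∣                      ≤⟨ *-monoˡ-≤ _ 0≤ω+ω (triangle-via (f z)) ⟩
                (ω + ω) * (∣ f r - f z ∣ + ∣ f z - s ∣)    ≈⟨ solve 3 (λ w a b → w :* (a :+ b) := w :* b :+ w :* a) refl (ω + ω) _ _ ⟩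
                (ω + ω) * ∣ f z - s ∣ + (ω + ω) * ∣ f r - f z ∣  ∎
              ω2≤ : (ω + ω) * ∣ f r - f z ∣ ≤ 1#
              ω2≤ = begin
                (ω + ω) * ∣ f r - f z ∣                ≤⟨ *-monoˡ-≤ _ 0≤ω+ω (lipschitz r∈B z∈B) ⟩
                (ω + ω) * (ι L * ∣ r - z ∣)            ≈⟨ *-cong (sym (ι-2* (Q ℕ.^ K))) (*-congˡ (abs-swap r z)) ⟩
                ι (2 ℕ.* Q ℕ.^ K) * (ι L * a)          ≈⟨ trans (sym (*-assoc _ _ _)) (*-congʳ (sym (ι-* (2 ℕ.* Q ℕ.^ K) L))) ⟩
                ι (2 ℕ.* Q ℕ.^ K ℕ.* L) * a            ≤⟨ ι-scale-≤ bound (0≤∣x∣ _) ⟩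
                τ * a                                  ≤⟨ near-≤ z∈ ⟩
                1#                                     ∎
                where
                reorder : ∀ w L → 2 ℕ.* w ℕ.* L ≡ 2 ℕ.* L ℕ.* w
                reorder = ℕ-Solver.solve-∀
                bound : 2 ℕ.* Q ℕ.^ K ℕ.* L ℕ.≤ t⁺ ℕ.^ 3
                bound = ℕ.≤-trans (ℕ.≤-reflexive (reorder (Q ℕ.^ K) L))
                  (ℕ.≤-trans (ℕ.*-monoʳ-≤ (2 ℕ.* L) (ℕ.^-monoˡ-≤ K (ℕ.<⇒≤ Q<W))) (2LW^K≤next³ {n} T₁≤t))

            improves : Improves S z
            improves = record
              { nested = shrink z z∈′
              ; moved  = avoids z z∈′
              ; small  = avoiding z z∈′
              ; medium = medium
              }

-- A downward search from Q + 1, where t exceeds Q; it stops at the first index m with t m ≤ Q, at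
-- the latest at 0.
bracket : ∀ (t : ℕ → ℕ) → (∀ n → n ℕ.≤ t n) → ∀ {Q} → t 0 ℕ.≤ Q → ∃[ n ] t n ℕ.≤ Q × Q ℕ.< t (suc n)
bracket t n≤t {Q} t₀≤Q = search (suc Q) (n≤t (suc Q))
  where
  search : ∀ m → Q ℕ.< t m → ∃[ n ] t n ℕ.≤ Q × Q ℕ.< t (suc n)
  search zero    Q<t₀ = contradiction t₀≤Q (ℕ.<⇒≱ Q<t₀)
  search (suc m) Q<t  = from (Q ℕ.<? t m)
    where
    from : Dec (Q ℕ.< t m) → ∃[ n ] t n ℕ.≤ Q × Q ℕ.< t (suc n)
    from (yes Q<tₘ) = search m Q<tₘ
    from (no Q≮tₘ)  = m , ℕ.≮⇒≥ Q≮tₘ , Q<t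

-- The common point ξ of the nested balls, and the irrationality exponent of its image.

module Limit (em : ExcludedMiddle 0ℓ) (ℝ : CompleteOrderedField) where
  open Jump em ℝ public

  private variable
    x y z : Carrier

  monotone-≤ : (a : ℕ → Carrier) → (∀ n → a n ≤ a (suc n)) → ∀ m n → a m ≤ a (m ℕ.+ n)
  monotone-≤ a step m zero    = ≤-reflexive (reflexive (≡.cong a (≡.sym (ℕ.+-identityʳ m))))
  monotone-≤ a step m (suc n) = ≤-trans (monotone-≤ a step m n)
    (≤-trans (step (m ℕ.+ n)) (≤-reflexive (reflexive (≡.cong a (≡.sym (ℕ.+-suc m n))))))

  nested-intervals : (lo hi : ℕ → Carrier) → (∀ n → lo n ≤ lo (suc n)) → (∀ n → hi (suc n) ≤ hi n) →
                     (∀ n → lo n ≤ hi n) → ∃[ ξ ] (∀ n → lo n ≤ ξ × ξ ≤ hi n)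
  nested-intervals lo hi lo-step hi-step lo≤hi = proj₁ sup , λ n →
      proj₁ (proj₂ sup) {lo n} (n , refl)
    , proj₂ (proj₂ sup) (λ {y} (m , y≈) → ≤-trans (≤-reflexive y≈) (cross m n))
    where
    cross : ∀ m n → lo m ≤ hi n
    cross m n = ≤-trans (monotone-≤ lo lo-step m n) (≤-trans (lo≤hi (m ℕ.+ n)) (≤-trans
      (≤-reflexive (reflexive (≡.cong hi (ℕ.+-comm m n))))
      (linear-≤ (monotone-≤ (λ k → - hi k) (λ k → neg-mono-≤ (hi-step k)) n m)
        (solve 2 (λ a b → a :- b := :- b :- :- a) refl (hi n) (hi (n ℕ.+ m))))))
    Lower : Carrier → Set
    Lower y = ∃[ n ] y ≈ lo n
    sup = supremum Lower (lo 0 , 0 , refl) (hi 0 , λ {y} (m , y≈) → ≤-trans (≤-reflexive y≈) (cross m 0))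

  -- Applying each inclusion to the two endpoints of the inner ball turns it into monotonicity of
  -- the endpoints.
  nested-balls : (T : ℕ → ℕ) (c : ℕ → Carrier) → (∀ n → 0 ℕ.< T n) →
                 (∀ n z → Near (T (suc n)) 3 (c (suc n)) z → Near (T n) 3 (c n) z) →
                 ∃[ ξ ] (∀ n → Near (T n) 3 (c n) ξ)
  nested-balls T c 0<T nested = from (nested-intervals lo hi
      (λ n → proj₁ (bounds n (nested n (lo (suc n)) (near-lo (suc n)))))
      (λ n → proj₂ (bounds n (nested n (hi (suc n)) (near-hi (suc n)))))
      (λ n → proj₂ (bounds n (near-lo n))))
    where
    τ ρ lo hi : ℕ → Carrier
    τ n = ι (T n ℕ.^ 3)
    0<τ : ∀ n → 0# < τ n
    0<τ n = 0<ι (ℕ.m^n>0 (T n) {{ℕ.>-nonZero (0<T n)}} 3)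
    ρ n = recip (τ n) (>⇒≉ (0<τ n))
    lo n = c n - ρ n
    hi n = c n + ρ n
    τρ≈1 : ∀ n → τ n * ρ n ≈ 1#
    τρ≈1 n = *-recip (>⇒≉ (0<τ n))
    0≤ρ : ∀ n → 0# ≤ ρ n
    0≤ρ n = <⇒≤ (recip-pos (0<τ n))
    ∣ρ∣ : ∀ n → ∣ ρ n ∣ ≈ ρ n
    ∣ρ∣ n = abs-nonNeg (0≤ρ n)
    near-lo : ∀ n → Near (T n) 3 (c n) (lo n)
    near-lo n = near (≤-reflexive (trans (*-congˡ (trans (abs-cong (solve 2 (λ c ρ → (c :- ρ) :- c := :- ρ) refl (c n) (ρ n))) (trans (abs-neg _) (∣ρ∣ n)))) (τρ≈1 n)))
    near-hi : ∀ n → Near (T n) 3 (c n) (hi n)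
    near-hi n = near (≤-reflexive (trans (*-congˡ (trans (abs-cong (solve 2 (λ c ρ → (c :+ ρ) :- c := ρ) refl (c n) (ρ n))) (∣ρ∣ n))) (τρ≈1 n)))
    bounds : ∀ n {z} → Near (T n) 3 (c n) z → lo n ≤ z × z ≤ hi n
    bounds n {z} (near n≤) =
        linear-≤ (proj₁ within) (solve 3 (λ z c ρ → z :- (c :- ρ) := (z :- c) :- :- ρ) refl z (c n) (ρ n))
      , linear-≤ (proj₂ within) (solve 3 (λ z c ρ → (c :+ ρ) :- z := ρ :- (z :- c)) refl z (c n) (ρ n))
      where
      within : - ρ n ≤ z - c n × z - c n ≤ ρ n
      within = abs-bound (*-cancelˡ-≤ (τ n) (0<τ n) (≤-trans n≤ (≤-reflexive (sym (τρ≈1 n)))))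
    from : ∃[ ξ ] (∀ n → lo n ≤ ξ × ξ ≤ hi n) → ∃[ ξ ] (∀ n → Near (T n) 3 (c n) ξ)
    from (ξ , within) = ξ , λ n → near (≤-trans (*-monoˡ-≤ (τ n) (<⇒≤ (0<τ n)) (abs-≤
        (linear-≤ (proj₂ (within n)) (solve 3 (λ z c ρ → ρ :- (z :- c) := (c :+ ρ) :- z) refl ξ (c n) (ρ n)))
        (linear-≤ (proj₁ (within n)) (solve 3 (λ z c ρ → ρ :- (:- (z :- c)) := z :- (c :- ρ)) refl ξ (c n) (ρ n)))))
      (≤-reflexive (τρ≈1 n)))

  module Conclusion {f x₀ R} (germ : Germ f x₀ R) where
    open JumpStep germ

    first : ∃[ k ] 1# ≤ ι (2 ℕ.^ k) * R
    first = archimedean₂ 0<R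

    -- The summand 2 ^ k ensures t₀⁻³ ≤ R, so that the first ball lies where the germ is controlled.
    t₀ : ℕ
    t₀ = 2 ℕ.^ proj₁ first ℕ.+ T₁

    stage₀ : Stage 0
    stage₀ = record
      { t      = t₀
      ; c      = x₀
      ; T₁≤t   = T₁≤t₀
      ; 2m≤t   = ℕ.≤-trans (ℕ.m≤m+n 2 2) (4≤t T₁≤t₀)
      ; inside = λ z z∈ → *-cancelˡ-≤ (ι (t₀ ℕ.^ 3)) (0<ι (ℕ.m^n>0 t₀ 3))
          (≤-trans (near-≤ z∈) (≤-trans (proj₂ first) (ι-scale-≤ 2^k≤t₀³ (<⇒≤ 0<R))))
      }
      where
      T₁≤t₀ : T₁ ℕ.≤ t₀
      T₁≤t₀ = ℕ.m≤n+m T₁ (2 ℕ.^ proj₁ first)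
      instance
        t₀≢0 : NonZero t₀
        t₀≢0 = ℕ.>-nonZero (ℕ.≤-trans (ℕ.s≤s ℕ.z≤n) (4≤t T₁≤t₀))
      2^k≤t₀³ : 2 ℕ.^ proj₁ first ℕ.≤ t₀ ℕ.^ 3
      2^k≤t₀³ = ℕ.≤-trans (ℕ.m≤m+n _ T₁) (ℕ.m≤m*n t₀ (t₀ ℕ.^ 2) {{ℕ.m^n≢0 t₀ 2}})

    stage-suc : ∀ {n} → Stage n → Stage (suc n)
    stage-suc {n} S = record
      { t      = next n t
      ; c      = proj₁ (advance S)
      ; T₁≤t   = ℕ.≤-trans T₁≤t (t≤next {n} T₁≤t)
      -- Uses (n + 2)² ≤ 4 (n + 1)², with the difference supplied to `quadratic`, and a next scale
      -- of at least 4 t.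
      ; 2m≤t   = ℕ.≤-trans (ℕ.≤-trans (ℕ.m≤m+n _ (2 ℕ.* (3 ℕ.* n ℕ.* n ℕ.+ 4 ℕ.* n))) (ℕ.≤-reflexive (quadratic n)))
                           (ℕ.≤-trans (ℕ.*-monoʳ-≤ 4 2m≤t) (4t≤next {n} T₁≤t))
      ; inside = λ z z∈ → inside z (Improves.nested (proj₂ (proj₂ (advance S)) z z∈))
      }
      where
      open Stage S
      quadratic : ∀ n → 2 ℕ.* ((2 ℕ.+ n) ℕ.* (2 ℕ.+ n)) ℕ.+ 2 ℕ.* (3 ℕ.* n ℕ.* n ℕ.+ 4 ℕ.* n) ≡ 4 ℕ.* (2 ℕ.* ((1 ℕ.+ n) ℕ.* (1 ℕ.+ n)))
      quadratic = ℕ-Solver.solve-∀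

    stage : ∀ n → Stage n
    stage zero    = stage₀
    stage (suc n) = stage-suc (stage n)

    t : ℕ → ℕ
    t n = Stage.t (stage n)

    c : ℕ → Carrier
    c n = Stage.c (stage n)

    T₁≤t : ∀ n → T₁ ℕ.≤ t n
    T₁≤t n = Stage.T₁≤t (stage n)

    0<t : ∀ n → 0 ℕ.< t n
    0<t n = ℕ.≤-trans (ℕ.s≤s ℕ.z≤n) (4≤t (T₁≤t n))

    n≤t : ∀ n → n ℕ.≤ t n
    n≤t n = ℕ.≤-trans (ℕ.n≤1+n n) (ℕ.≤-trans (ℕ.m≤m*n (suc n) (suc n))
      (ℕ.≤-trans (ℕ.m≤m+n _ _) (Stage.2m≤t (stage n))))

    improves : ∀ n z → Near (t (suc n)) 3 (c (suc n)) z → Improves (stage n) z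
    improves n = proj₂ (proj₂ (advance (stage n)))

    den-c : ∀ n → Den (t n ℕ.^ 5) (c (suc n))
    den-c n = proj₁ (proj₂ (advance (stage n)))

    limit : ∃[ ξ ] (∀ n → Near (t n) 3 (c n) ξ)
    limit = nested-balls t c 0<t λ n z z∈ → Improves.nested (improves n z z∈)

    ξ : Carrier
    ξ = proj₁ limit

    near-ξ : ∀ n → Near (t n) 3 (c n) ξ
    near-ξ = proj₂ limit

    improves-ξ : ∀ n → Improves (stage n) ξ
    improves-ξ n = improves n ξ (near-ξ (suc n))

    ξ∈ : Ball x₀ R ξ
    ξ∈ = Stage.inside stage₀ ξ (near-ξ 0)

    -- Compare exponents of `t N`: 5 (N + 1) < 6 (N + 1) ≤ 2 ^ N * K. Here the growing factor 2 ^ N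
    -- outruns the prescribed order.
    power-small : ∀ N → (t N ℕ.^ 5) ℕ.^ suc N ℕ.< t (suc N) ℕ.^ 3
    power-small N = ℕ.<-≤-trans (ℕ.≤-<-trans (ℕ.≤-reflexive (ℕ.^-*-assoc (t N) 5 (suc N)))
        (ℕ.^-monoʳ-< (t N) (ℕ.≤-trans (ℕ.m≤m+n 2 2) (4≤t (T₁≤t N))) exponents))
      (ℕ.≤-trans (ℕ.≤-reflexive (≡.sym (ℕ.^-*-assoc (t N) (2 ℕ.^ N) K))) (next≤next³ {N} (T₁≤t N)))
      where
      exponents : 5 ℕ.* suc N ℕ.< 2 ℕ.^ N ℕ.* K
      exponents = ℕ.<-≤-trans (ℕ.*-monoˡ-< (suc N) (ℕ.≤-refl {6})) (ℕ.≤-trans (ℕ.≤-reflexive (ℕ.*-comm 6 (suc N)))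
        (ℕ.*-mono-≤ (n<2^n N) (ℕ.≤-trans (ℕ.m≤m+n 6 12) (ℕ.≤-trans (ℕ.m≤n+m 18 (18 ℕ.* κ)) (ℕ.n≤1+n _)))))

    -- The approximation of order N is the centre `c (suc N)`, of denominator `t N ^ 5`. It is not ξ
    -- itself, because stage N + 1 moves off its centre.
    wellApproximable-ξ : WellApproximable ξ
    wellApproximable-ξ N = from (integer (den-c N))
      where
      q : ℕ
      q = t N ℕ.^ 5
      c⁺ : Carrier
      c⁺ = c (suc N)
      2≤t : 2 ℕ.≤ t N
      2≤t = ℕ.≤-trans (ℕ.m≤m+n 2 2) (4≤t (T₁≤t N))
      instance
        t≢0 : NonZero (t N)
        t≢0 = ℕ.>-nonZero (0<t N)
      2≤q : 2 ℕ.≤ q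
      2≤q = ℕ.≤-trans 2≤t (ℕ.m≤m*n (t N) (t N ℕ.^ 4) {{ℕ.m^n≢0 (t N) 4}})
      0<gap : 0# < ∣ ξ - c⁺ ∣
      0<gap = x≉0⇒0<∣x∣ λ eq → Improves.moved (improves-ξ (suc N)) (x-y≈0⇒x≈y eq)
      from : IsInteger (ι q * c⁺) → ∃[ p ] ∃[ q ] 2 ℕ.≤ q × Close ξ N p q
      from (p , qc≈p) = p , q , 2≤q
        , <-respʳ-≈ (sym gap≈) (*-pos (0<ι (ℕ.≤-trans (ℕ.s≤s ℕ.z≤n) 2≤q)) 0<gap)
        , (begin-strict
            ι (q ℕ.^ N) * ∣ ι q * ξ - ιℤ p ∣        ≈⟨ *-congˡ gap≈ ⟩
            ι (q ℕ.^ N) * (ι q * ∣ ξ - c⁺ ∣)        ≈⟨ solve 3 (λ a b c → a :* (b :* c) := b :* a :* c) refl (ι (q ℕ.^ N)) (ι q) _ ⟩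
            ι q * ι (q ℕ.^ N) * ∣ ξ - c⁺ ∣          ≈⟨ *-congʳ (sym (ι-* q (q ℕ.^ N))) ⟩
            ι (q ℕ.^ suc N) * ∣ ξ - c⁺ ∣            <⟨ *-monoʳ-< _ 0<gap (ι-mono-< (power-small N)) ⟩
            ι (t (suc N) ℕ.^ 3) * ∣ ξ - c⁺ ∣        ≤⟨ near-≤ (near-ξ (suc N)) ⟩
            1#                                      ∎)
        where
        open ≤-Reasoning
        gap≈ : ∣ ι q * ξ - ιℤ p ∣ ≈ ι q * ∣ ξ - c⁺ ∣
        gap≈ = trans (abs-cong (trans (+-congˡ (-‿cong (sym qc≈p))) (solve 3 (λ q x c → q :* x :- q :* c := q :* (x :- c)) refl (ι q) ξ c⁺))) (ι-abs-* q _)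

    -- For Q ≥ W the loss is t (n + 1) ^ 4 = W ^ (4 K) ≤ Q ^ (4 K); for Q < W it is Q ^ (K + 1). The
    -- exponent dominates both.
    K′ : ℕ
    K′ = 4 ℕ.* K ℕ.+ 1

    lowerBound : ∀ Q s → t₀ ℕ.≤ Q → Den Q s → 1# ≤ ι (Q ℕ.^ K′) * ∣ f ξ - s ∣
    lowerBound Q s t₀≤Q d = from (bracket t n≤t t₀≤Q)
      where
      0<Q : 0 ℕ.< Q
      0<Q = ℕ.≤-trans (0<t 0) t₀≤Q
      instance
        Q≢0 : NonZero Q
        Q≢0 = ℕ.>-nonZero 0<Q
      from : ∃[ n ] t n ℕ.≤ Q × Q ℕ.< t (suc n) → 1# ≤ ι (Q ℕ.^ K′) * ∣ f ξ - s ∣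
      from (n , tₙ≤Q , Q<tₙ₊₁) = split (Q ℕ.<? W n (t n))
        where
        split : Dec (Q ℕ.< W n (t n)) → 1# ≤ ι (Q ℕ.^ K′) * ∣ f ξ - s ∣
        split (yes Q<W) = ≤-trans (Improves.medium (improves-ξ n) Q s tₙ≤Q Q<W d)
          (ι-scale-≤ (ℕ.^-monoʳ-≤ Q (ℕ.≤-trans (ℕ.≤-reflexive (ℕ.+-comm 1 K)) (ℕ.+-monoˡ-≤ 1 (ℕ.m≤n*m K 4)))) (0≤∣x∣ _))
        split (no Q≮W) = ≤-trans (Improves.small (improves-ξ (suc n)) Q s 0<Q (ℕ.<⇒≤ Q<tₙ₊₁) d)
          (ι-scale-≤ bound (0≤∣x∣ _))
          where
          bound : next n (t n) ℕ.^ 4 ℕ.≤ Q ℕ.^ K′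
          bound = ℕ.≤-trans (ℕ.≤-reflexive (ℕ.^-*-assoc (W n (t n)) K 4))
            (ℕ.≤-trans (ℕ.^-monoˡ-≤ (K ℕ.* 4) (ℕ.≮⇒≥ Q≮W))
              (ℕ.^-monoʳ-≤ Q (ℕ.≤-trans (ℕ.≤-reflexive (ℕ.*-comm K 4)) (ℕ.m≤m+n (4 ℕ.* K) 1))))

    conclusion : ∃[ ξ ] Ball x₀ R ξ × Liouville ξ × ¬ Liouville (f ξ)
    conclusion = ξ , ξ∈ , wellApproximable⇒liouville wellApproximable-ξ
      , ¬liouville-lowerBound K′ t₀ (0<t 0) lowerBound

-- Metric properties of Möbius transformations.

module Möbius-transformations (em : ExcludedMiddle 0ℓ) (ℝ : CompleteOrderedField) where
  open Limit em ℝ public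

  private variable
    x y z : Carrier

  private
    inverse : Dec (x ≈ 0#) → Carrier
    inverse (yes _)   = 0#
    inverse {x} (no x≉0) = recip x x≉0

    *-inverse : (x≟0 : Dec (x ≈ 0#)) → x ≉ 0# → x * inverse x≟0 ≈ 1#
    *-inverse (yes x≈0) x≉0 = contradiction x≈0 x≉0
    *-inverse (no x≉0)  _   = *-recip x≉0

  -- 0 ⁻¹ = 0
  _⁻¹ : Carrier → Carrier
  x ⁻¹ = inverse (x ≟ 0#)

  *-⁻¹ : x ≉ 0# → x * x ⁻¹ ≈ 1#
  *-⁻¹ {x} = *-inverse (x ≟ 0#)

  ⁻¹-pos : 0# < x → 0# < x ⁻¹
  ⁻¹-pos {x} 0<x = *-cancelˡ-< x 0<x (<-respˡ-≈ (sym (zeroʳ x)) (<-respʳ-≈ (sym (*-⁻¹ (>⇒≉ 0<x))) 0<1))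

  lower-bound₂ : 0# < x → 0# < y → ∃[ r ] 0# < r × r ≤ x × r ≤ y
  lower-bound₂ {x} {y} 0<x 0<y = [ (λ x≤y → x , 0<x , ≤-refl , x≤y) , (λ y≤x → y , 0<y , y≤x , ≤-refl) ]′ (≤-total x y)

  quotient-bound : ∀ x → 0# < y → ∃[ n ] x ≤ ι n * y
  quotient-bound {y} x 0<y = proj₁ n , (begin
    x                     ≈⟨ trans (sym (*-identityʳ x)) (*-congˡ (sym (*-⁻¹ (>⇒≉ 0<y)))) ⟩
    x * (y * y ⁻¹)        ≈⟨ solve 3 (λ x y i → x :* (y :* i) := x :* i :* y) refl x y _ ⟩
    x * y ⁻¹ * y          ≤⟨ *-monoʳ-≤ y (<⇒≤ 0<y) (<⇒≤ (proj₂ n)) ⟩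
    ι (proj₁ n) * y       ∎)
    where
    open ≤-Reasoning
    n = archimedean (x * y ⁻¹)

  radius : ∀ x → 0# < y → ∃[ r ] 0# < r × x * r ≤ y
  radius {y} x 0<y = r , ⁻¹-pos 0<n , (begin
    x * r                    ≤⟨ *-monoʳ-≤ r (<⇒≤ (⁻¹-pos 0<n)) (≤-trans (proj₂ n) (ι-scale-≤ (ℕ.n≤1+n (proj₁ n)) (<⇒≤ 0<y))) ⟩
    ι (suc (proj₁ n)) * y * r  ≈⟨ solve 3 (λ n y r → n :* y :* r := n :* r :* y) refl _ y r ⟩
    ι (suc (proj₁ n)) * r * y  ≈⟨ trans (*-congʳ (*-⁻¹ (>⇒≉ 0<n))) (*-identityˡ y) ⟩
    y                        ∎)
    where
    open ≤-Reasoning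
    n = quotient-bound x 0<y
    0<n : 0# < ι (suc (proj₁ n))
    0<n = 0<fromℕ-suc (proj₁ n)
    r : Carrier
    r = ι (suc (proj₁ n)) ⁻¹

  ball-weaken : ∀ {c r r′ z} → r ≤ r′ → Ball c r z → Ball c r′ z
  ball-weaken r≤r′ z∈ = ≤-trans z∈ r≤r′

  record Transformation : Set where
    field
      a b c d : Carrier
      Δ≉0     : a * d - b * c ≉ 0#

    Δ : Carrier
    Δ = a * d - b * c

    denominator : Carrier → Carrier
    denominator x = c * x + d

    apply : Carrier → Carrier
    apply x = (a * x + b) * denominator x ⁻¹

    apply-denominator : denominator x ≉ 0# → apply x * denominator x ≈ a * x + b
    apply-denominator {x} w≉0 = trans (solve 3 (λ n i w → n :* i :* w := n :* (w :* i)) refl (a * x + b) _ (denominator x))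
      (trans (*-congˡ (*-⁻¹ w≉0)) (*-identityʳ _))

    -- The common source of both Lipschitz bounds and of the invariance of the cross-ratio.
    apply-diff : denominator x ≉ 0# → denominator y ≉ 0# →
                 (apply x - apply y) * (denominator x * denominator y) ≈ Δ * (x - y)
    apply-diff {x} {y} wx≉0 wy≉0 = begin
      (apply x - apply y) * (denominator x * denominator y)
        ≈⟨ solve 4 (λ m n w v → (m :- n) :* (w :* v) := m :* w :* v :- n :* v :* w) refl (apply x) (apply y) (denominator x) (denominator y) ⟩
      apply x * denominator x * denominator y - apply y * denominator y * denominator x
        ≈⟨ +-cong (*-congʳ (apply-denominator wx≉0)) (-‿cong (*-congʳ (apply-denominator wy≉0))) ⟩
      (a * x + b) * (c * y + d) - (a * y + b) * (c * x + d)
        ≈⟨ solve 6 (λ a b c d x y → (a :* x :+ b) :* (c :* y :+ d) :- (a :* y :+ b) :* (c :* x :+ d) := (a :* d :- b :* c) :* (x :- y)) refl a b c d x y ⟩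
      Δ * (x - y)
        ∎
      where open import Relation.Binary.Reasoning.Setoid setoid

    -- Multiplied by the four denominators, both sides become Δ² times the same product of
    -- differences.
    cross-ratio : ∀ {x₀ x₁ x₂ x₃} → denominator x₀ ≉ 0# → denominator x₁ ≉ 0# → denominator x₂ ≉ 0# → denominator x₃ ≉ 0# →
                  (x₀ - x₁) * ((apply x₁ - apply x₃) * (apply x₂ - apply x₀) * (x₂ - x₃)) ≈
                  (x₀ - x₂) * ((apply x₁ - apply x₀) * (apply x₂ - apply x₃) * (x₁ - x₃))
    cross-ratio {x₀} {x₁} {x₂} {x₃} h₀ h₁ h₂ h₃ = *-cancelˡ (*-≉0 (*-≉0 h₁ h₃) (*-≉0 h₂ h₀)) (begin
      w₁ * w₃ * (w₂ * w₀) * ((x₀ - x₁) * ((f₁ - f₃) * (f₂ - f₀) * (x₂ - x₃)))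
        ≈⟨ solve 6 (λ W V p g h r → W :* V :* (p :* (g :* h :* r)) := p :* r :* ((g :* W) :* (h :* V))) refl (w₁ * w₃) (w₂ * w₀) (x₀ - x₁) (f₁ - f₃) (f₂ - f₀) (x₂ - x₃) ⟩
      (x₀ - x₁) * (x₂ - x₃) * ((f₁ - f₃) * (w₁ * w₃) * ((f₂ - f₀) * (w₂ * w₀)))
        ≈⟨ *-congˡ (*-cong (apply-diff h₁ h₃) (apply-diff h₂ h₀)) ⟩
      (x₀ - x₁) * (x₂ - x₃) * (Δ * (x₁ - x₃) * (Δ * (x₂ - x₀)))
        ≈⟨ solve 5 (λ D x₀ x₁ x₂ x₃ → (x₀ :- x₁) :* (x₂ :- x₃) :* (D :* (x₁ :- x₃) :* (D :* (x₂ :- x₀))) := (x₀ :- x₂) :* (x₁ :- x₃) :* (D :* (x₁ :- x₀) :* (D :* (x₂ :- x₃)))) refl Δ x₀ x₁ x₂ x₃ ⟩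
      (x₀ - x₂) * (x₁ - x₃) * (Δ * (x₁ - x₀) * (Δ * (x₂ - x₃)))
        ≈⟨ *-congˡ (sym (*-cong (apply-diff h₁ h₀) (apply-diff h₂ h₃))) ⟩
      (x₀ - x₂) * (x₁ - x₃) * ((f₁ - f₀) * (w₁ * w₀) * ((f₂ - f₃) * (w₂ * w₃)))
        ≈⟨ solve 8 (λ w₀ w₁ w₂ w₃ p g h r → p :* r :* (g :* (w₁ :* w₀) :* (h :* (w₂ :* w₃))) := w₁ :* w₃ :* (w₂ :* w₀) :* (p :* (g :* h :* r))) refl w₀ w₁ w₂ w₃ (x₀ - x₂) (f₁ - f₀) (f₂ - f₃) (x₁ - x₃) ⟩
      w₁ * w₃ * (w₂ * w₀) * ((x₀ - x₂) * ((f₁ - f₀) * (f₂ - f₃) * (x₁ - x₃)))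
        ∎)
      where
      open import Relation.Binary.Reasoning.Setoid setoid
      w₀ w₁ w₂ w₃ f₀ f₁ f₂ f₃ : Carrier
      w₀ = denominator x₀
      w₁ = denominator x₁
      w₂ = denominator x₂
      w₃ = denominator x₃
      f₀ = apply x₀
      f₁ = apply x₁
      f₂ = apply x₂
      f₃ = apply x₃

    record BiLipschitz (x₀ R : Carrier) : Set where
      field
        0<R         : 0# < R
        2R≤1        : R + R ≤ 1#
        regular     : ∀ {x} → Ball x₀ R x → denominator x ≉ 0#
        L           : ℕ
        1≤L         : 1 ℕ.≤ L
        lipschitz   : ∀ {x y} → Ball x₀ R x → Ball x₀ R y → ∣ apply x - apply y ∣ ≤ ι L * ∣ x - y ∣
        colipschitz : ∀ {x y} → Ball x₀ R x → Ball x₀ R y → ∣ x - y ∣ ≤ ι L * ∣ apply x - apply y ∣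

    -- R is chosen with 2 ∣ c ∣ R ≤ ω for ω = ∣ denominator x₀ ∣. Then the denominator stays between
    -- ω / 2 and 2 ω in absolute value, and `apply-diff` gives the constants 4 ∣ Δ ∣ / ω² and 4 ω² /
    -- ∣ Δ ∣.
    locally-biLipschitz : ∀ {x₀ ρ} → denominator x₀ ≉ 0# → 0# < ρ → ∃[ R ] R ≤ ρ × BiLipschitz x₀ R
    locally-biLipschitz {x₀} {ρ} w₀≉0 0<ρ = R , R≤ρ , record
      { 0<R = 0<R ; 2R≤1 = 2R≤1 ; regular = regular ; L = L ; 1≤L = ℕ.s≤s ℕ.z≤n
      ; lipschitz = lipschitz ; colipschitz = colipschitz }
      where
      open ≤-Reasoning
      ω : Carrier
      ω = ∣ denominator x₀ ∣
      0<ω : 0# < ω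
      0<ω = x≉0⇒0<∣x∣ w₀≉0

      r₁ = radius (∣ c ∣ + ∣ c ∣) 0<ω
      r₂ = radius (1# + 1#) 0<1
      r₁₂ = lower-bound₂ (proj₁ (proj₂ r₁)) (proj₁ (proj₂ r₂))
      r = lower-bound₂ (proj₁ (proj₂ r₁₂)) 0<ρ

      R : Carrier
      R = proj₁ r
      0<R : 0# < R
      0<R = proj₁ (proj₂ r)
      R≤ρ : R ≤ ρ
      R≤ρ = proj₂ (proj₂ (proj₂ r))
      R≤r₁₂ : R ≤ proj₁ r₁₂
      R≤r₁₂ = proj₁ (proj₂ (proj₂ r))

      2R≤1 : R + R ≤ 1#
      2R≤1 = begin
        R + R                   ≈⟨ solve 1 (λ R → R :+ R := (con (+ 1) :+ con (+ 1)) :* R) refl R ⟩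
        (1# + 1#) * R           ≤⟨ *-monoˡ-≤ _ (<⇒≤ 0<2) (≤-trans R≤r₁₂ (proj₂ (proj₂ (proj₂ r₁₂)))) ⟩
        (1# + 1#) * proj₁ r₂    ≤⟨ proj₂ (proj₂ r₂) ⟩
        1#                      ∎

      2cR≤ω : (∣ c ∣ + ∣ c ∣) * R ≤ ω
      2cR≤ω = ≤-trans (*-monoˡ-≤ _ (+-nonNeg (0≤∣x∣ c) (0≤∣x∣ c)) (≤-trans R≤r₁₂ (proj₁ (proj₂ (proj₂ r₁₂)))))
        (proj₂ (proj₂ r₁))

      w-diff : ∀ {x} → Ball x₀ R x → ∣ denominator x - denominator x₀ ∣ + ∣ denominator x - denominator x₀ ∣ ≤ ω
      w-diff {x} x∈ = ≤-trans (+-mono-≤ bound bound) (≤-trans (≤-reflexive (sym (distribʳ R ∣ c ∣ ∣ c ∣))) 2cR≤ω)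
        where
        bound : ∣ denominator x - denominator x₀ ∣ ≤ ∣ c ∣ * R
        bound = begin
          ∣ denominator x - denominator x₀ ∣     ≈⟨ abs-cong (solve 4 (λ c d x y → (c :* x :+ d) :- (c :* y :+ d) := c :* (x :- y)) refl c d x x₀) ⟩
          ∣ c * (x - x₀) ∣                       ≈⟨ abs-* _ _ ⟩
          ∣ c ∣ * ∣ x - x₀ ∣                     ≤⟨ *-monoˡ-≤ _ (0≤∣x∣ c) x∈ ⟩
          ∣ c ∣ * R                              ∎

      w-lower : ∀ {x} → Ball x₀ R x → ω ≤ ∣ denominator x ∣ + ∣ denominator x ∣
      w-lower {x} x∈ = linear-≤ (+-mono-≤ (+-mono-≤ triangle₀ triangle₀) (w-diff x∈))
        (solve 3 (λ w v e → (w :+ w) :- v := ((e :+ w) :+ (e :+ w)) :+ v :- ((v :+ v) :+ (e :+ e))) refl (∣ denominator x ∣) ω (∣ denominator x - denominator x₀ ∣))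
        where
        triangle₀ : ω ≤ ∣ denominator x - denominator x₀ ∣ + ∣ denominator x ∣
        triangle₀ = ≤-trans (≤-reflexive (abs-cong (solve 2 (λ w v → v := :- (w :- v) :+ w) refl (denominator x) (denominator x₀))))
          (≤-trans (triangle _ _) (+-mono-≤ (≤-reflexive (abs-neg _)) ≤-refl))

      w-upper : ∀ {x} → Ball x₀ R x → ∣ denominator x ∣ ≤ ω + ω
      w-upper {x} x∈ = begin
        ∣ denominator x ∣                                   ≈⟨ abs-cong (solve 2 (λ w v → w := v :+ (w :- v)) refl (denominator x) (denominator x₀)) ⟩
        ∣ denominator x₀ + (denominator x - denominator x₀) ∣  ≤⟨ triangle _ _ ⟩
        ω + ∣ denominator x - denominator x₀ ∣              ≤⟨ +-mono-≤ ≤-refl (≤-trans (x≤x+∣y∣ _ _) (w-diff x∈)) ⟩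
        ω + ω                                               ∎

      regular : ∀ {x} → Ball x₀ R x → denominator x ≉ 0#
      regular {x} x∈ w≈0 = <⇒≱ 0<ω (≤-trans (w-lower x∈) (≤-reflexive (trans (+-cong ∣w∣≈0 ∣w∣≈0) (+-identityˡ 0#))))
        where
        ∣w∣≈0 : ∣ denominator x ∣ ≈ 0#
        ∣w∣≈0 = x≈0⇒∣x∣≈0 w≈0

      0<ω² : 0# < ω * ω
      0<ω² = *-pos 0<ω 0<ω
      0<Δ : 0# < ∣ Δ ∣
      0<Δ = x≉0⇒0<∣x∣ Δ≉0

      4# : Carrier
      4# = (1# + 1#) + (1# + 1#)

      L₁ = quotient-bound (4# * ∣ Δ ∣) 0<ω²
      L₂ = quotient-bound (4# * (ω * ω)) 0<Δ

      L : ℕ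
      L = suc (proj₁ L₁ ℕ.+ proj₁ L₂)

      ∣diff∣ : ∀ {x y} → Ball x₀ R x → Ball x₀ R y →
               ∣ apply x - apply y ∣ * (∣ denominator x ∣ * ∣ denominator y ∣) ≈ ∣ Δ ∣ * ∣ x - y ∣
      ∣diff∣ x∈ y∈ = trans (*-congˡ (sym (abs-* _ _))) (trans (sym (abs-* _ _))
        (trans (abs-cong (apply-diff (regular x∈) (regular y∈))) (abs-* _ _)))

      lipschitz : ∀ {x y} → Ball x₀ R x → Ball x₀ R y → ∣ apply x - apply y ∣ ≤ ι L * ∣ x - y ∣
      lipschitz {x} {y} x∈ y∈ = *-cancelˡ-≤ (ω * ω) 0<ω² (begin
        ω * ω * e                                ≤⟨ *-monoʳ-≤ e (0≤∣x∣ _) (*-mono-≤ (<⇒≤ 0<ω) (≤-trans (<⇒≤ 0<ω) (w-lower y∈)) (w-lower x∈) (w-lower y∈)) ⟩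
        (wx + wx) * (wy + wy) * e                ≈⟨ solve 3 (λ w v e → (w :+ w) :* (v :+ v) :* e := ((con (+ 1) :+ con (+ 1)) :+ (con (+ 1) :+ con (+ 1))) :* (e :* (w :* v))) refl wx wy e ⟩
        4# * (e * (wx * wy))                     ≈⟨ *-congˡ (∣diff∣ x∈ y∈) ⟩
        4# * (∣ Δ ∣ * ∣ x - y ∣)                 ≈⟨ sym (*-assoc _ _ _) ⟩
        4# * ∣ Δ ∣ * ∣ x - y ∣                   ≤⟨ *-monoʳ-≤ _ (0≤∣x∣ _) (≤-trans (proj₂ L₁) (ι-scale-≤ (ℕ.≤-trans (ℕ.m≤m+n (proj₁ L₁) (proj₁ L₂)) (ℕ.n≤1+n _)) (<⇒≤ 0<ω²))) ⟩
        ι L * (ω * ω) * ∣ x - y ∣                ≈⟨ solve 3 (λ L w e → L :* w :* e := w :* (L :* e)) refl (ι L) (ω * ω) _ ⟩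
        ω * ω * (ι L * ∣ x - y ∣)                ∎)
        where
        e wx wy : Carrier
        e = ∣ apply x - apply y ∣
        wx = ∣ denominator x ∣
        wy = ∣ denominator y ∣

      colipschitz : ∀ {x y} → Ball x₀ R x → Ball x₀ R y → ∣ x - y ∣ ≤ ι L * ∣ apply x - apply y ∣
      colipschitz {x} {y} x∈ y∈ = *-cancelˡ-≤ ∣ Δ ∣ 0<Δ (begin
        ∣ Δ ∣ * ∣ x - y ∣                        ≈⟨ sym (∣diff∣ x∈ y∈) ⟩
        e * (∣ denominator x ∣ * ∣ denominator y ∣)  ≤⟨ *-monoˡ-≤ e (0≤∣x∣ _) (*-mono-≤ (0≤∣x∣ _) (≤-trans (0≤∣x∣ _) (w-upper y∈)) (w-upper x∈) (w-upper y∈)) ⟩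
        e * ((ω + ω) * (ω + ω))                  ≈⟨ solve 2 (λ w e → e :* ((w :+ w) :* (w :+ w)) := ((con (+ 1) :+ con (+ 1)) :+ (con (+ 1) :+ con (+ 1))) :* (w :* w) :* e) refl ω e ⟩
        4# * (ω * ω) * e                         ≤⟨ *-monoʳ-≤ _ (0≤∣x∣ _) (≤-trans (proj₂ L₂) (ι-scale-≤ (ℕ.≤-trans (ℕ.m≤n+m (proj₁ L₂) (proj₁ L₁)) (ℕ.n≤1+n _)) (<⇒≤ 0<Δ))) ⟩
        ι L * ∣ Δ ∣ * e                          ≈⟨ solve 3 (λ L w e → L :* w :* e := w :* (L :* e)) refl (ι L) ∣ Δ ∣ _ ⟩
        ∣ Δ ∣ * (ι L * e)                        ∎)
        where
        e : Carrier
        e = ∣ apply x - apply y ∣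

-- Membership in ℚ(x) and matrices proportional to rational or integer ones.

module RationalTransformations (em : ExcludedMiddle 0ℓ) (ℝ : CompleteOrderedField) where
  open Möbius-transformations em ℝ public

  private variable
    x y z : Carrier

  rational-resp : x ≈ y → Rational x → Rational y
  rational-resp x≈y (n , 0<n , d) = n , 0<n , den-resp x≈y d

  rational-− : Rational x → Rational y → Rational (x - y)
  rational-− (m , 0<m , dx) (n , 0<n , dy) = m ℕ.* n , ℕ.*-mono-≤ 0<m 0<n , den-−-* dx dy

  rational-* : Rational x → Rational y → Rational (x * y)
  rational-* (m , 0<m , dx) (n , 0<n , dy) = m ℕ.* n , ℕ.*-mono-≤ 0<m 0<n , den-* dx dy

  rational-1 : Rational 1#
  rational-1 = 1 , ℕ.s≤s ℕ.z≤n , den (+ 1 , *-identityʳ _)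

  rational-⁻¹ : x ≉ 0# → Rational x → Rational (x ⁻¹)
  rational-⁻¹ {x} x≉0 (n , 0<n , den (p , nx≈p)) = ℤ.∣ p ∣ , 0<∣p∣
    , den (integer-resp (*-congʳ (∣ιℤ∣ p)) ([ positive , negative ]′ (abs-sign (ιℤ p))))
    where
    p≉0 : ιℤ p ≉ 0#
    p≉0 eq = *-≉0 (>⇒≉ (0<ι 0<n)) x≉0 (trans nx≈p eq)
    0<∣p∣ : 0 ℕ.< ℤ.∣ p ∣
    0<∣p∣ = ℕ.n≢0⇒n>0 λ ∣p∣≡0 → p≉0 (reflexive (≡.cong ιℤ (ℤ.∣i∣≡0⇒i≡0 {p} ∣p∣≡0)))
    p*x⁻¹ : ιℤ p * x ⁻¹ ≈ ι n
    p*x⁻¹ = trans (*-congʳ (sym nx≈p)) (trans (*-assoc _ _ _) (trans (*-congˡ (*-⁻¹ x≉0)) (*-identityʳ _)))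
    positive : ιℤ p ≈ ∣ ιℤ p ∣ → IsInteger (∣ ιℤ p ∣ * x ⁻¹)
    positive eq = integer-resp (trans (sym p*x⁻¹) (*-congʳ eq)) (integer-ι n)
    negative : ιℤ p ≈ - ∣ ιℤ p ∣ → IsInteger (∣ ιℤ p ∣ * x ⁻¹)
    negative eq = integer-resp (trans (-‿cong (trans (sym p*x⁻¹) (*-congʳ eq)))
      (solve 2 (λ a i → :- (:- a :* i) := a :* i) refl ∣ ιℤ p ∣ (x ⁻¹))) (integer-neg (integer-ι n))

  rational-fromℚ : ∀ r → Rational (fromℚ r)
  rational-fromℚ (mkℚ p q-1 _) = suc q-1 , ℕ.s≤s ℕ.z≤n , den-/ p (suc q-1)

  den-*-weaken : ∀ {m} n → Den m x → Den (m ℕ.* n) x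
  den-*-weaken {x} {m} n d = ≡.subst (λ k → Den k x) (ℕ.*-comm n m) (den-scale n d)

  wellApproximable-resp : x ≈ y → WellApproximable x → WellApproximable y
  wellApproximable-resp {x} {y} x≈y W N = from (W N)
    where
    from : ∃[ p ] ∃[ q ] 2 ℕ.≤ q × Close x N p q → ∃[ p ] ∃[ q ] 2 ℕ.≤ q × Close y N p q
    from (p , q , 2≤q , 0<gap , gap<) = p , q , 2≤q , <-respʳ-≈ gap≈ 0<gap , <-respˡ-≈ (*-congˡ gap≈) gap<
      where
      gap≈ : ∣ ι q * x - ιℤ p ∣ ≈ ∣ ι q * y - ιℤ p ∣
      gap≈ = abs-cong (+-congʳ (*-congˡ x≈y))

  liouville-resp : x ≈ y → Liouville x → Liouville y
  liouville-resp x≈y L = wellApproximable⇒liouville (wellApproximable-resp x≈y (liouville⇒wellApproximable L))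

  exponent-bound : ∀ x → ∃[ k ] x ≤ ι (2 ℕ.^ k)
  exponent-bound x = proj₁ (archimedean x) , ≤-trans (<⇒≤ (proj₂ (archimedean x))) (ι-mono-≤ (ℕ.<⇒≤ (n<2^n (proj₁ (archimedean x)))))

  module RationalMultiple (T : Transformation) where
    open Transformation T

    -- The matrix form of M ∈ ℚ(x); P is `Rational` or `IsInteger`.
    record Proportional (P : Carrier → Set) : Set where
      field
        scale a′ b′ c′ d′ : Carrier
        scale≉0           : scale ≉ 0#
        a-∈               : P a′
        b-∈               : P b′
        c-∈               : P c′
        d-∈               : P d′
        a≈                : a ≈ scale * a′
        b≈                : b ≈ scale * b′
        c≈                : c ≈ scale * c′
        d≈                : d ≈ scale * d′

    clear-denominators : Proportional Rational → Proportional IsInteger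
    clear-denominators record
      { scale = s ; a′ = a′ ; b′ = b′ ; c′ = c′ ; d′ = d′ ; scale≉0 = s≉0
      ; a-∈ = n₁ , 0<n₁ , den-a ; b-∈ = n₂ , 0<n₂ , den-b ; c-∈ = n₃ , 0<n₃ , den-c ; d-∈ = n₄ , 0<n₄ , den-d
      ; a≈ = a≈ ; b≈ = b≈ ; c≈ = c≈ ; d≈ = d≈ } = record
      { scale   = s * ι n ⁻¹
      ; scale≉0 = *-≉0 s≉0 (>⇒≉ (⁻¹-pos 0<n))
      ; a-∈     = integer (den-*-weaken n₄ (den-*-weaken n₃ (den-*-weaken n₂ den-a)))
      ; b-∈     = integer (den-*-weaken n₄ (den-*-weaken n₃ (den-scale n₁ den-b)))
      ; c-∈     = integer (den-*-weaken n₄ (den-scale (n₁ ℕ.* n₂) den-c))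
      ; d-∈     = integer (den-scale (n₁ ℕ.* n₂ ℕ.* n₃) den-d)
      ; a≈      = trans a≈ (rescale a′)
      ; b≈      = trans b≈ (rescale b′)
      ; c≈      = trans c≈ (rescale c′)
      ; d≈      = trans d≈ (rescale d′)
      }
      where
      n : ℕ
      n = n₁ ℕ.* n₂ ℕ.* n₃ ℕ.* n₄
      0<n : 0# < ι n
      0<n = 0<ι (ℕ.*-mono-≤ (ℕ.*-mono-≤ (ℕ.*-mono-≤ 0<n₁ 0<n₂) 0<n₃) 0<n₄)
      rescale : ∀ e → s * e ≈ s * ι n ⁻¹ * (ι n * e)
      rescale e = sym (trans (solve 4 (λ s n i e → s :* i :* (n :* e) := n :* i :* (s :* e)) refl s (ι n) (ι n ⁻¹) e)
        (trans (*-congʳ (*-⁻¹ (>⇒≉ 0<n))) (*-identityˡ _)))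

    module _ {x₁ x₂ x₃}
      (w₁≉0 : denominator x₁ ≉ 0#) (w₂≉0 : denominator x₂ ≉ 0#) (w₃≉0 : denominator x₃ ≉ 0#)
      (x₁∈ : Rational x₁) (x₂∈ : Rational x₂) (x₃∈ : Rational x₃)
      (f₁∈ : Rational (apply x₁)) (f₂∈ : Rational (apply x₂)) (f₃∈ : Rational (apply x₃))
      (x₁≉x₂ : x₁ ≉ x₂) (f₁≉f₃ : apply x₁ ≉ apply x₃) (x₂≉x₃ : x₂ ≉ x₃)
      where
      private
        w₁ w₂ w₃ f₁ f₂ f₃ g h ρ e : Carrier
        w₁ = denominator x₁
        w₂ = denominator x₂
        w₃ = denominator x₃
        f₁ = apply x₁
        f₂ = apply x₂
        f₃ = apply x₃
        g = (f₁ - f₃) * (x₁ - x₂)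
        h = (f₁ - f₂) * (x₁ - x₃)
        ρ = h * g ⁻¹
        e = (x₃ - x₂) ⁻¹

        g≉0 : g ≉ 0#
        g≉0 = *-≉0 (λ eq → f₁≉f₃ (x-y≈0⇒x≈y eq)) (λ eq → x₁≉x₂ (x-y≈0⇒x≈y eq))

        -- The `apply-diff` relations for x₁, x₃ and for x₁, x₂ are compared; this removes Δ and w₁,
        -- leaving the ratio of w₃ to w₂ in terms of rational data.
        w₃g≈w₂h : w₃ * g ≈ w₂ * h
        w₃g≈w₂h = *-cancelˡ w₁≉0 (begin
          w₁ * (w₃ * g)                            ≈⟨ solve 4 (λ w v p q → w :* (v :* (p :* q)) := p :* (w :* v) :* q) refl w₁ w₃ (f₁ - f₃) (x₁ - x₂) ⟩
          (f₁ - f₃) * (w₁ * w₃) * (x₁ - x₂)        ≈⟨ *-congʳ (apply-diff w₁≉0 w₃≉0) ⟩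
          Δ * (x₁ - x₃) * (x₁ - x₂)                ≈⟨ solve 3 (λ D p q → D :* p :* q := D :* q :* p) refl Δ (x₁ - x₃) (x₁ - x₂) ⟩
          Δ * (x₁ - x₂) * (x₁ - x₃)                ≈⟨ *-congʳ (sym (apply-diff w₁≉0 w₂≉0)) ⟩
          (f₁ - f₂) * (w₁ * w₂) * (x₁ - x₃)        ≈⟨ solve 4 (λ w v p q → p :* (w :* v) :* q := w :* (v :* (p :* q))) refl w₁ w₂ (f₁ - f₂) (x₁ - x₃) ⟩
          w₁ * (w₂ * h)                            ∎)
          where open import Relation.Binary.Reasoning.Setoid setoid

        w₃≈ : w₃ ≈ w₂ * ρ
        w₃≈ = *-cancelˡ g≉0 (trans (*-comm g w₃) (trans w₃g≈w₂h (sym (trans (solve 4 (λ g w h i → g :* (w :* (h :* i)) := g :* i :* (w :* h)) refl g w₂ h (g ⁻¹))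
          (trans (*-congʳ (*-⁻¹ g≉0)) (*-identityˡ _))))))

        ρ∈ : Rational ρ
        ρ∈ = rational-* (rational-* (rational-− f₁∈ f₂∈) (rational-− x₁∈ x₃∈))
          (rational-⁻¹ g≉0 (rational-* (rational-− f₁∈ f₃∈) (rational-− x₁∈ x₂∈)))

        x₃-x₂≉0 : x₃ - x₂ ≉ 0#
        x₃-x₂≉0 eq = x₂≉x₃ (sym (x-y≈0⇒x≈y eq))

        e∈ : Rational e
        e∈ = rational-⁻¹ x₃-x₂≉0 (rational-− x₃∈ x₂∈)

        -- The slope of an affine function from its values at x₂ and x₃, both measured in units of
        -- w₂.
        slope : ∀ {k u₂ u₃ m} → u₂ ≈ w₂ * m → u₃ - u₂ ≈ k * (x₃ - x₂) → ∀ {n} → u₃ ≈ w₂ * n → k ≈ w₂ * ((n - m) * e)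
        slope {k} {u₂} {u₃} {m} u₂≈ diff {n} u₃≈ = *-cancelˡ x₃-x₂≉0 (begin
          (x₃ - x₂) * k                        ≈⟨ trans (*-comm _ k) (sym diff) ⟩
          u₃ - u₂                              ≈⟨ +-cong u₃≈ (-‿cong u₂≈) ⟩
          w₂ * n - w₂ * m                      ≈⟨ sym (*-identityˡ _) ⟩
          1# * (w₂ * n - w₂ * m)               ≈⟨ *-congʳ (sym (*-⁻¹ x₃-x₂≉0)) ⟩
          (x₃ - x₂) * e * (w₂ * n - w₂ * m)    ≈⟨ solve 5 (λ X e w n m → X :* e :* (w :* n :- w :* m) := X :* (w :* ((n :- m) :* e))) refl (x₃ - x₂) e w₂ n m ⟩
          (x₃ - x₂) * (w₂ * ((n - m) * e))     ∎)
          where open import Relation.Binary.Reasoning.Setoid setoid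

        c₀ a₀ : Carrier
        c₀ = (ρ - 1#) * e
        a₀ = (f₃ * ρ - f₂) * e

        c≈₀ : c ≈ w₂ * c₀
        c≈₀ = slope {u₂ = w₂} {u₃ = w₃} (sym (*-identityʳ _))
          (solve 4 (λ c d x y → (c :* x :+ d) :- (c :* y :+ d) := c :* (x :- y)) refl c d x₃ x₂) w₃≈

        a≈₀ : a ≈ w₂ * a₀
        a≈₀ = slope {u₂ = a * x₂ + b} {u₃ = a * x₃ + b} (trans (sym (apply-denominator w₂≉0)) (*-comm f₂ w₂))
          (solve 4 (λ c d x y → (c :* x :+ d) :- (c :* y :+ d) := c :* (x :- y)) refl a b x₃ x₂)
          (trans (sym (apply-denominator w₃≉0)) (trans (*-congˡ w₃≈) (solve 3 (λ f w r → f :* (w :* r) := w :* (f :* r)) refl f₃ w₂ ρ)))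

        a₀∈ : Rational a₀
        a₀∈ = rational-* (rational-− (rational-* f₃∈ ρ∈) f₂∈) e∈

        c₀∈ : Rational c₀
        c₀∈ = rational-* (rational-− ρ∈ rational-1) e∈

        b≈₀ : b ≈ w₂ * (f₂ - a₀ * x₂)
        b≈₀ = begin
          b                             ≈⟨ solve 3 (λ a b x → b := (a :* x :+ b) :- a :* x) refl a b x₂ ⟩
          (a * x₂ + b) - a * x₂         ≈⟨ +-cong (sym (apply-denominator w₂≉0)) (-‿cong (*-congʳ a≈₀)) ⟩
          f₂ * w₂ - w₂ * a₀ * x₂        ≈⟨ solve 4 (λ f w a x → f :* w :- w :* a :* x := w :* (f :- a :* x)) refl f₂ w₂ a₀ x₂ ⟩
          w₂ * (f₂ - a₀ * x₂)           ∎
          where open import Relation.Binary.Reasoning.Setoid setoid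

        d≈₀ : d ≈ w₂ * (1# - c₀ * x₂)
        d≈₀ = begin
          d                             ≈⟨ solve 3 (λ a b x → b := (a :* x :+ b) :- a :* x) refl c d x₂ ⟩
          w₂ - c * x₂                   ≈⟨ +-congˡ (-‿cong (*-congʳ c≈₀)) ⟩
          w₂ - w₂ * c₀ * x₂             ≈⟨ solve 3 (λ w a x → w :- w :* a :* x := w :* (con (+ 1) :- a :* x)) refl w₂ c₀ x₂ ⟩
          w₂ * (1# - c₀ * x₂)           ∎
          where open import Relation.Binary.Reasoning.Setoid setoid

      -- In units of w₂, the affine functions c x + d and a x + b take at x₂ the values 1 and f₂,
      -- and at x₃ the values ρ and f₃ ρ. All four are rational, and they determine both functions.
      three-rational-points : Proportional Rational
      three-rational-points = record
        { scale≉0 = w₂≉0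
        ; a-∈ = a₀∈ ; b-∈ = rational-− f₂∈ (rational-* a₀∈ x₂∈) ; c-∈ = c₀∈ ; d-∈ = rational-− rational-1 (rational-* c₀∈ x₂∈)
        ; a≈ = a≈₀ ; b≈ = b≈₀ ; c≈ = c≈₀ ; d≈ = d≈₀
        }

    open Möbius a b c d using (M∈ℚ⟨x⟩) public

    proportional⇒M∈ℚ⟨x⟩ : Proportional IsInteger → M∈ℚ⟨x⟩
    proportional⇒M∈ℚ⟨x⟩ record
      { scale = s ; a-∈ = A , a′≈ ; b-∈ = B , b′≈ ; c-∈ = C , c′≈ ; d-∈ = D , d′≈
      ; a≈ = a≈ ; b≈ = b≈ ; c≈ = c≈ ; d≈ = d≈ } =
      whole B ∷ whole A ∷ [] , whole D ∷ whole C ∷ [] , nonzero , equal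
      where
      whole : ℤ → ℚ
      whole i = mkℚ i 0 (Coprimality.sym (Coprimality.1-coprimeTo ℤ.∣ i ∣))
      fromℚ-whole : ∀ i → fromℚ (whole i) ≈ ιℤ i
      fromℚ-whole i = trans (sym (*-identityˡ _)) (trans (*-congʳ (sym ι-1)) (q*[p/q]≈p i 1))
      aA : a ≈ s * fromℚ (whole A)
      aA = trans a≈ (*-congˡ (trans a′≈ (sym (fromℚ-whole A))))
      bB : b ≈ s * fromℚ (whole B)
      bB = trans b≈ (*-congˡ (trans b′≈ (sym (fromℚ-whole B))))
      cC : c ≈ s * fromℚ (whole C)
      cC = trans c≈ (*-congˡ (trans c′≈ (sym (fromℚ-whole C))))
      dD : d ≈ s * fromℚ (whole D)
      dD = trans d≈ (*-congˡ (trans d′≈ (sym (fromℚ-whole D))))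
      nonzero : ¬ (map fromℚ (whole D ∷ whole C ∷ []) ≈ₚ [])
      nonzero ≈0 = Δ≉0 (begin
        a * d - b * c      ≈⟨ +-cong (*-congˡ (trans dD (trans (*-congˡ (≈0 0)) (zeroʳ s)))) (-‿cong (*-congˡ (trans cC (trans (*-congˡ (≈0 1)) (zeroʳ s))))) ⟩
        a * 0# - b * 0#    ≈⟨ solve 2 (λ a b → a :* con (+ 0) :- b :* con (+ 0) := con (+ 0)) refl a b ⟩
        0#                 ∎)
        where open import Relation.Binary.Reasoning.Setoid setoid
      swap : ∀ {u v u′ v′} → u ≈ s * u′ → v ≈ s * v′ → u * v′ ≈ u′ * v
      swap {u} {v} {u′} {v′} u≈ v≈ = trans (*-congʳ u≈) (trans (solve 3 (λ s u v → s :* u :* v := u :* (s :* v)) refl s u′ v′) (*-congˡ (sym v≈)))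
      equal : (b ∷ a ∷ []) *ₚ map fromℚ (whole D ∷ whole C ∷ []) ≈ₚ map fromℚ (whole B ∷ whole A ∷ []) *ₚ (d ∷ c ∷ [])
      equal 0 = +-congʳ (swap bB dD)
      equal 1 = +-cong (swap bB cC) (+-congʳ (swap aA dD))
      equal 2 = swap aA cC
      equal (suc (suc (suc n))) = refl

    -- bQ₀ = dP₀ and bQₙ₊₁ + aQₙ = dPₙ₊₁ + cPₙ are the coefficients of
    -- (b + ax) Q = P (d + cx).
    record Satisfies (p q : ℕ → Carrier) : Set where
      field
        p-rational : ∀ n → Rational (p n)
        q-rational : ∀ n → Rational (q n)
        equation₀  : b * q 0 ≈ d * p 0
        equation   : ∀ n → b * q (suc n) + a * q n ≈ d * p (suc n) + c * p n

    module _ {p q} (sat : Satisfies p q) where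
      open Satisfies sat

      -- Substituting b and d in the coefficients of x and x² leaves c p₀ - a q₀ = l u₁ and c p₁ - a
      -- q₁ = l u₂, a linear system for a and c whose determinant is again u₁. As l² u₁ = - Δ,
      -- neither l nor u₁ vanishes, and Cramer's rule applies.
      solve-leading : ∀ l → b ≈ l * p 0 → d ≈ l * q 0 → Proportional Rational
      solve-leading l b≈ d≈ = record
        { scale   = l * u₁ ⁻¹
        ; scale≉0 = *-≉0 l≉0 u₁⁻¹≉0
        ; a-∈     = rational-− (rational-* u₁∈ (p-rational 1)) (rational-* u₂∈ (p-rational 0))
        ; b-∈     = rational-* u₁∈ (p-rational 0)
        ; c-∈     = rational-− (rational-* u₁∈ (q-rational 1)) (rational-* u₂∈ (q-rational 0))
        ; d-∈     = rational-* u₁∈ (q-rational 0)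
        ; a≈      = divide (begin
            u₁ * a
              ≈⟨ solve 6 (λ a c p₀ p₁ q₀ q₁ → (p₀ :* q₁ :- q₀ :* p₁) :* a := (c :* p₀ :- a :* q₀) :* p₁ :- (c :* p₁ :- a :* q₁) :* p₀) refl a c (p 0) (p 1) (q 0) (q 1) ⟩
            (c * p 0 - a * q 0) * p 1 - (c * p 1 - a * q 1) * p 0
              ≈⟨ +-cong (*-congʳ (sym lu₁)) (-‿cong (*-congʳ (sym lu₂))) ⟩
            l * u₁ * p 1 - l * u₂ * p 0
              ≈⟨ solve 5 (λ l u v p q → l :* u :* p :- l :* v :* q := l :* (u :* p :- v :* q)) refl l u₁ u₂ (p 1) (p 0) ⟩
            l * (u₁ * p 1 - u₂ * p 0)
              ∎)
        ; b≈      = divide (trans (*-congˡ b≈) (solve 3 (λ u l p → u :* (l :* p) := l :* (u :* p)) refl u₁ l (p 0)))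
        ; c≈      = divide (begin
            u₁ * c
              ≈⟨ solve 6 (λ a c p₀ p₁ q₀ q₁ → (p₀ :* q₁ :- q₀ :* p₁) :* c := (c :* p₀ :- a :* q₀) :* q₁ :- (c :* p₁ :- a :* q₁) :* q₀) refl a c (p 0) (p 1) (q 0) (q 1) ⟩
            (c * p 0 - a * q 0) * q 1 - (c * p 1 - a * q 1) * q 0
              ≈⟨ +-cong (*-congʳ (sym lu₁)) (-‿cong (*-congʳ (sym lu₂))) ⟩
            l * u₁ * q 1 - l * u₂ * q 0
              ≈⟨ solve 5 (λ l u v p q → l :* u :* p :- l :* v :* q := l :* (u :* p :- v :* q)) refl l u₁ u₂ (q 1) (q 0) ⟩
            l * (u₁ * q 1 - u₂ * q 0)
              ∎)
        ; d≈      = divide (trans (*-congˡ d≈) (solve 3 (λ u l p → u :* (l :* p) := l :* (u :* p)) refl u₁ l (q 0)))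
        }
        where
        open import Relation.Binary.Reasoning.Setoid setoid
        u₁ u₂ : Carrier
        u₁ = p 0 * q 1 - q 0 * p 1
        u₂ = p 0 * q 2 - q 0 * p 2
        u₁∈ : Rational u₁
        u₁∈ = rational-− (rational-* (p-rational 0) (q-rational 1)) (rational-* (q-rational 0) (p-rational 1))
        u₂∈ : Rational u₂
        u₂∈ = rational-− (rational-* (p-rational 0) (q-rational 2)) (rational-* (q-rational 0) (p-rational 2))
        lu : ∀ n → l * (p 0 * q (suc n) - q 0 * p (suc n)) ≈ c * p n - a * q n
        lu n = begin
          l * (p 0 * q (suc n) - q 0 * p (suc n))
            ≈⟨ solve 5 (λ l p₀ q₀ P Q → l :* (p₀ :* Q :- q₀ :* P) := l :* p₀ :* Q :- l :* q₀ :* P) refl l (p 0) (q 0) (p (suc n)) (q (suc n)) ⟩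
          l * p 0 * q (suc n) - l * q 0 * p (suc n)
            ≈⟨ +-cong (*-congʳ (sym b≈)) (-‿cong (*-congʳ (sym d≈))) ⟩
          b * q (suc n) - d * p (suc n)
            ≈⟨ solve 3 (λ x y z → x :- y := (x :+ z) :- z :- y) refl _ _ (a * q n) ⟩
          b * q (suc n) + a * q n - a * q n - d * p (suc n)
            ≈⟨ +-congʳ (+-congʳ (equation n)) ⟩
          d * p (suc n) + c * p n - a * q n - d * p (suc n)
            ≈⟨ solve 3 (λ x y z → x :+ y :- z :- x := y :- z) refl _ _ _ ⟩
          c * p n - a * q n
            ∎
        lu₁ = lu 0
        lu₂ = lu 1
        l²u₁≈-Δ : l * (l * u₁) ≈ - Δ
        l²u₁≈-Δ = begin
          l * (l * u₁)                        ≈⟨ *-congˡ lu₁ ⟩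
          l * (c * p 0 - a * q 0)             ≈⟨ solve 5 (λ l c p a q → l :* (c :* p :- a :* q) := :- (a :* (l :* q) :- (l :* p) :* c)) refl l c (p 0) a (q 0) ⟩
          - (a * (l * q 0) - (l * p 0) * c)   ≈⟨ -‿cong (+-cong (*-congˡ (sym d≈)) (-‿cong (*-congʳ (sym b≈)))) ⟩
          - Δ                                 ∎
        -Δ≉0 : - Δ ≉ 0#
        -Δ≉0 eq = Δ≉0 (trans (sym (-‿involutive Δ)) (trans (-‿cong eq) -0#≈0#))
        l≉0 : l ≉ 0#
        l≉0 eq = -Δ≉0 (trans (sym l²u₁≈-Δ) (trans (*-congʳ eq) (zeroˡ _)))
        u₁≉0 : u₁ ≉ 0#
        u₁≉0 eq = -Δ≉0 (trans (sym l²u₁≈-Δ) (trans (*-congˡ (trans (*-congˡ eq) (zeroʳ l))) (zeroʳ l)))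
        u₁⁻¹≉0 : u₁ ⁻¹ ≉ 0#
        u₁⁻¹≉0 eq = <-irrefl (sym (trans (sym (*-⁻¹ u₁≉0)) (trans (*-congˡ eq) (zeroʳ u₁)))) 0<1
        divide : ∀ {k v} → u₁ * k ≈ l * v → k ≈ l * u₁ ⁻¹ * v
        divide {k} {v} eq = *-cancelˡ u₁≉0 (trans eq (sym (trans (solve 4 (λ u l i v → u :* (l :* i :* v) := u :* i :* (l :* v)) refl u₁ l (u₁ ⁻¹) v)
          (trans (*-congʳ (*-⁻¹ u₁≉0)) (*-identityˡ _)))))

      -- By `equation₀`, (b, d) is a multiple of (p 0, q 0) as soon as the latter is nonzero.
      leading : (p 0 ≉ 0#) ⊎ (q 0 ≉ 0#) → Proportional Rational
      leading (inj₁ p₀≉0) = solve-leading (b * p 0 ⁻¹)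
        (sym (trans (solve 3 (λ b i p → b :* i :* p := b :* (p :* i)) refl b (p 0 ⁻¹) (p 0)) (trans (*-congˡ (*-⁻¹ p₀≉0)) (*-identityʳ b))))
        (sym (trans (solve 3 (λ b i q → b :* i :* q := b :* q :* i) refl b (p 0 ⁻¹) (q 0)) (trans (*-congʳ equation₀)
          (trans (*-assoc _ _ _) (trans (*-congˡ (*-⁻¹ p₀≉0)) (*-identityʳ d))))))
      leading (inj₂ q₀≉0) = solve-leading (d * q 0 ⁻¹)
        (sym (trans (solve 3 (λ b i q → b :* i :* q := b :* q :* i) refl d (q 0 ⁻¹) (p 0)) (trans (*-congʳ (sym equation₀))
          (trans (*-assoc _ _ _) (trans (*-congˡ (*-⁻¹ q₀≉0)) (*-identityʳ b))))))
        (sym (trans (solve 3 (λ b i p → b :* i :* p := b :* (p :* i)) refl d (q 0 ⁻¹) (q 0)) (trans (*-congˡ (*-⁻¹ q₀≉0)) (*-identityʳ d))))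

      -- If P₀ = Q₀ = 0, a common factor x is cancelled.
      shift-sequences : p 0 ≈ 0# → q 0 ≈ 0# → Satisfies (λ n → p (suc n)) (λ n → q (suc n))
      shift-sequences p₀≈0 q₀≈0 = record
        { p-rational = λ n → p-rational (suc n)
        ; q-rational = λ n → q-rational (suc n)
        ; equation₀  = trans (drop b a q₀≈0) (trans (equation 0) (sym (drop d c p₀≈0)))
        ; equation   = λ n → equation (suc n)
        }
        where
        drop : ∀ u v {x y} → y ≈ 0# → u * x ≈ u * x + v * y
        drop u v {x} y≈0 = sym (trans (+-congˡ (trans (*-congˡ y≈0) (zeroʳ v))) (+-identityʳ _))

    -- Induction on the index of a nonzero coefficient of Q, which drops by one when a factor x is
    -- cancelled. On coefficient sequences this cancellation is a mere shift.
    satisfies⇒proportional : ∀ k {p q} → Satisfies p q → q k ≉ 0# → Proportional Rational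
    satisfies⇒proportional zero    sat q₀≉0 = leading sat (inj₂ q₀≉0)
    satisfies⇒proportional (suc k) {p} {q} sat qₖ≉0 = split (p 0 ≟ 0#) (q 0 ≟ 0#)
      where
      split : Dec (p 0 ≈ 0#) → Dec (q 0 ≈ 0#) → Proportional Rational
      split (no p₀≉0)  _          = leading sat (inj₁ p₀≉0)
      split (yes _)    (no q₀≉0)  = leading sat (inj₂ q₀≉0)
      split (yes p₀≈0) (yes q₀≈0) = satisfies⇒proportional k (shift-sequences sat p₀≈0 q₀≈0) qₖ≉0

    coeff-+ₚ : ∀ f g n → coeff (f +ₚ g) n ≈ coeff f n + coeff g n
    coeff-+ₚ []      g       n       = sym (+-identityˡ _)
    coeff-+ₚ (_ ∷ _) []      n       = sym (+-identityʳ _)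
    coeff-+ₚ (_ ∷ _) (_ ∷ _) zero    = refl
    coeff-+ₚ (_ ∷ f) (_ ∷ g) (suc n) = coeff-+ₚ f g n

    coeff-scale : ∀ k f n → coeff (map (k *_) f) n ≈ k * coeff f n
    coeff-scale k []      n       = sym (zeroʳ k)
    coeff-scale k (_ ∷ f) zero    = refl
    coeff-scale k (_ ∷ f) (suc n) = coeff-scale k f n

    coeff-linearˡ-0 : ∀ F → coeff ((b ∷ a ∷ []) *ₚ F) 0 ≈ b * coeff F 0
    coeff-linearˡ-0 F = trans (coeff-+ₚ (map (b *_) F) _ 0) (trans (+-identityʳ _) (coeff-scale b F 0))

    coeff-linearˡ-suc : ∀ F n → coeff ((b ∷ a ∷ []) *ₚ F) (suc n) ≈ b * coeff F (suc n) + a * coeff F n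
    coeff-linearˡ-suc F n = trans (coeff-+ₚ (map (b *_) F) _ (suc n)) (+-cong (coeff-scale b F (suc n))
      (trans (coeff-+ₚ (map (a *_) F) (0# ∷ []) n) (trans (+-cong (coeff-scale a F n) (zeros n)) (+-identityʳ _))))
      where
      zeros : ∀ n → coeff (0# ∷ []) n ≈ 0#
      zeros zero    = refl
      zeros (suc n) = refl

    coeff-linearʳ-0 : ∀ F → coeff (F *ₚ (d ∷ c ∷ [])) 0 ≈ d * coeff F 0
    coeff-linearʳ-0 []      = sym (zeroʳ d)
    coeff-linearʳ-0 (k ∷ F) = trans (+-identityʳ _) (*-comm k d)

    coeff-linearʳ-suc : ∀ F n → coeff (F *ₚ (d ∷ c ∷ [])) (suc n) ≈ d * coeff F (suc n) + c * coeff F n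
    coeff-linearʳ-suc []      n    = sym (trans (+-cong (zeroʳ d) (zeroʳ c)) (+-identityˡ 0#))
    coeff-linearʳ-suc (k ∷ F) zero = trans (coeff-+ₚ (k * c ∷ []) (F *ₚ (d ∷ c ∷ [])) 0)
      (trans (+-cong (*-comm k c) (coeff-linearʳ-0 F)) (+-comm _ _))
    coeff-linearʳ-suc (k ∷ F) (suc n) = trans (coeff-+ₚ (k * c ∷ []) (F *ₚ (d ∷ c ∷ [])) (suc n))
      (trans (+-identityˡ _) (coeff-linearʳ-suc F n))

    rational-coeff : ∀ P n → Rational (coeff (map fromℚ P) n)
    rational-coeff []      n       = 1 , ℕ.s≤s ℕ.z≤n , den (+ 0 , zeroʳ _)
    rational-coeff (r ∷ P) zero    = rational-fromℚ r
    rational-coeff (r ∷ P) (suc n) = rational-coeff P n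

    M∈ℚ⟨x⟩⇒proportional : M∈ℚ⟨x⟩ → Proportional Rational
    M∈ℚ⟨x⟩⇒proportional (P , Q , Q≉0 , eq) = from em
      where
      p q : ℕ → Carrier
      p = coeff (map fromℚ P)
      q = coeff (map fromℚ Q)
      sat : Satisfies p q
      sat = record
        { p-rational = rational-coeff P
        ; q-rational = rational-coeff Q
        ; equation₀  = trans (sym (coeff-linearˡ-0 (map fromℚ Q))) (trans (eq 0) (coeff-linearʳ-0 (map fromℚ P)))
        ; equation   = λ n → trans (sym (coeff-linearˡ-suc (map fromℚ Q) n)) (trans (eq (suc n)) (coeff-linearʳ-suc (map fromℚ P) n))
        }
      from : Dec (∃[ k ] q k ≉ 0#) → Proportional Rational
      from (yes (k , qₖ≉0)) = satisfies⇒proportional k sat qₖ≉0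
      from (no none)        = contradiction (λ n → decide n (q n ≟ 0#)) Q≉0
        where
        decide : ∀ n → Dec (q n ≈ 0#) → q n ≈ 0#
        decide n (yes qₙ≈0) = qₙ≈0
        decide n (no qₙ≉0)  = contradiction (n , qₙ≉0) none

-- Integer matrices preserve approximability to every order.

module Preservation (em : ExcludedMiddle 0ℓ) (ℝ : CompleteOrderedField) where
  open RationalTransformations em ℝ public

  module _ (T : Transformation) where
    open Transformation T
    open RationalMultiple T

    -- With e = qξ − p one has (Cp + Dq) M(ξ) − (Ap + Bq) = e (A − C M(ξ)).
    integral-preserves : Proportional IsInteger → ∀ {ξ} → denominator ξ ≉ 0# → WellApproximable ξ → WellApproximable (apply ξ)
    integral-preserves record
      { scale = s ; a′ = A ; b′ = B ; c′ = C ; d′ = D ; scale≉0 = s≉0 ; a-∈ = iA ; b-∈ = iB ; c-∈ = iC ; d-∈ = iD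
      ; a≈ = a≈ ; b≈ = b≈ ; c≈ = c≈ ; d≈ = d≈ } {ξ} w≉0 W N = from (W N′)
      where
      open ≤-Reasoning
      y w g : Carrier
      y = apply ξ
      w = C * ξ + D
      g = A - C * y

      sw≈ : s * w ≈ denominator ξ
      sw≈ = trans (solve 4 (λ s C D x → s :* (C :* x :+ D) := s :* C :* x :+ s :* D) refl s C D ξ) (+-cong (*-congʳ (sym c≈)) (sym d≈))

      w≉0′ : w ≉ 0#
      w≉0′ eq = w≉0 (trans (sym sw≈) (trans (*-congˡ eq) (zeroʳ s)))

      yw≈ : y * w ≈ A * ξ + B
      yw≈ = *-cancelˡ s≉0 (begin-equality
        s * (y * w)              ≈⟨ solve 3 (λ s y w → s :* (y :* w) := y :* (s :* w)) refl s y w ⟩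
        y * (s * w)              ≈⟨ *-congˡ sw≈ ⟩
        y * denominator ξ        ≈⟨ apply-denominator w≉0 ⟩
        a * ξ + b                ≈⟨ +-cong (*-congʳ a≈) b≈ ⟩
        s * A * ξ + s * B        ≈⟨ solve 4 (λ s C D x → s :* C :* x :+ s :* D := s :* (C :* x :+ D)) refl s A B ξ ⟩
        s * (A * ξ + B)          ∎)

      -- Because s² w g = Δ.
      g≉0 : g ≉ 0#
      g≉0 eq = Δ≉0 (begin-equality
        a * d - b * c                          ≈⟨ +-cong (*-cong a≈ d≈) (-‿cong (*-cong b≈ c≈)) ⟩
        s * A * (s * D) - s * B * (s * C)      ≈⟨ solve 6 (λ s A B C D x → s :* A :* (s :* D) :- s :* B :* (s :* C) := s :* s :* (A :* (C :* x :+ D) :- C :* (A :* x :+ B))) refl s A B C D ξ ⟩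
        s * s * (A * w - C * (A * ξ + B))      ≈⟨ *-congˡ (+-congˡ (-‿cong (*-congˡ (sym yw≈)))) ⟩
        s * s * (A * w - C * (y * w))          ≈⟨ solve 5 (λ s A C w y → s :* s :* (A :* w :- C :* (y :* w)) := s :* s :* w :* (A :- C :* y)) refl s A C w y ⟩
        s * s * w * g                          ≈⟨ *-congˡ eq ⟩
        s * s * w * 0#                         ≈⟨ zeroʳ _ ⟩
        0#                                     ∎)

      -- Since 2 ≤ q, k₁ gives 2 ∣ V ∣ ≤ q ^ (1 + k₁), which costs (1 + k₁) N in the order; k₂
      -- absorbs the factor 2 ∣ g ∣; k₃ excludes V ≈ 0#.
      k₁ k₂ k₃ N′ : ℕ
      k₁ = proj₁ (exponent-bound ((∣ w ∣ + ∣ C ∣) + (∣ w ∣ + ∣ C ∣)))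
      k₂ = proj₁ (exponent-bound (∣ g ∣ + ∣ g ∣))
      k₃ = proj₁ (exponent-bound (∣ C ∣ * ∣ w ∣ ⁻¹))
      N′ = (1 ℕ.+ k₁) ℕ.* N ℕ.+ k₂ ℕ.+ k₃

      0<∣w∣ : 0# < ∣ w ∣
      0<∣w∣ = x≉0⇒0<∣x∣ w≉0′

      C≤ : ∣ C ∣ ≤ ι (2 ℕ.^ k₃) * ∣ w ∣
      C≤ = begin
        ∣ C ∣                          ≈⟨ trans (sym (*-identityʳ _)) (*-congˡ (sym (*-⁻¹ (>⇒≉ 0<∣w∣)))) ⟩
        ∣ C ∣ * (∣ w ∣ * ∣ w ∣ ⁻¹)     ≈⟨ solve 3 (λ c w i → c :* (w :* i) := c :* i :* w) refl ∣ C ∣ ∣ w ∣ (∣ w ∣ ⁻¹) ⟩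
        ∣ C ∣ * ∣ w ∣ ⁻¹ * ∣ w ∣       ≤⟨ *-monoʳ-≤ _ (0≤∣x∣ w) (proj₂ (exponent-bound (∣ C ∣ * ∣ w ∣ ⁻¹))) ⟩
        ι (2 ℕ.^ k₃) * ∣ w ∣           ∎

      from : ∃[ p ] ∃[ q ] 2 ℕ.≤ q × Close ξ N′ p q → ∃[ p ] ∃[ q ] 2 ℕ.≤ q × Close y N p q
      from (p , q , 2≤q , 0<δ , δ<) = close (integer-+ (integer-* iC (p , refl)) (integer-* iD (integer-ι q)))
                                            (integer-+ (integer-* iA (p , refl)) (integer-* iB (integer-ι q)))
        where
        instance
          q≢0 : NonZero q
          q≢0 = ℕ.>-nonZero (ℕ.≤-trans (ℕ.s≤s ℕ.z≤n) 2≤q)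
        e δ V Y : Carrier
        e = ι q * ξ - ιℤ p
        δ = ∣ e ∣
        V = C * ιℤ p + D * ι q
        Y = A * ιℤ p + B * ι q

        0≤δ : 0# ≤ δ
        0≤δ = 0≤∣x∣ e

        V≈ : V ≈ ι q * w - C * e
        V≈ = solve 5 (λ C D x q p → C :* p :+ D :* q := q :* (C :* x :+ D) :- C :* (q :* x :- p)) refl C D ξ (ι q) (ιℤ p)

        Vy-Y : V * y - Y ≈ e * g
        Vy-Y = begin-equality
          V * y - Y                                     ≈⟨ +-congʳ (*-congʳ V≈) ⟩
          (ι q * w - C * e) * y - Y                     ≈⟨ solve 6 (λ q w C e y Y → (q :* w :- C :* e) :* y :- Y := q :* (y :* w) :- C :* e :* y :- Y) refl (ι q) w C e y Y ⟩
          ι q * (y * w) - C * e * y - Y                 ≈⟨ +-congʳ (+-congʳ (*-congˡ yw≈)) ⟩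
          ι q * (A * ξ + B) - C * e * y - Y             ≈⟨ solve 7 (λ q A B C x y p → q :* (A :* x :+ B) :- C :* (q :* x :- p) :* y :- (A :* p :+ B :* q) := (q :* x :- p) :* (A :- C :* y)) refl (ι q) A B C ξ y (ιℤ p) ⟩
          e * g                                         ∎

        ∣V∣≤ : ∣ V ∣ + ∣ V ∣ ≤ ι (q ℕ.^ (1 ℕ.+ k₁))
        ∣V∣≤ = begin
          ∣ V ∣ + ∣ V ∣                                      ≤⟨ +-mono-≤ V≤ V≤ ⟩
          ι q * (∣ w ∣ + ∣ C ∣) + ι q * (∣ w ∣ + ∣ C ∣)      ≈⟨ sym (distribˡ _ _ _) ⟩
          ι q * ((∣ w ∣ + ∣ C ∣) + (∣ w ∣ + ∣ C ∣))          ≤⟨ *-monoˡ-≤ _ (0≤ι q) (≤-trans (proj₂ (exponent-bound ((∣ w ∣ + ∣ C ∣) + (∣ w ∣ + ∣ C ∣)))) (ι-mono-≤ (ℕ.^-monoˡ-≤ k₁ 2≤q))) ⟩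
          ι q * ι (q ℕ.^ k₁)                                 ≈⟨ sym (ι-* q (q ℕ.^ k₁)) ⟩
          ι (q ℕ.^ (1 ℕ.+ k₁))                               ∎
          where
          δ≤q : δ ≤ ι q
          δ≤q = ≤-trans (≤-trans (≤-reflexive (sym (*-identityˡ δ))) (*-monoʳ-≤ δ 0≤δ (1≤ι {q ℕ.^ N′} (ℕ.m^n>0 q N′))))
            (≤-trans (<⇒≤ δ<) (1≤ι {q} (ℕ.≤-trans (ℕ.s≤s ℕ.z≤n) 2≤q)))
          V≤ : ∣ V ∣ ≤ ι q * (∣ w ∣ + ∣ C ∣)
          V≤ = begin
            ∣ V ∣                               ≈⟨ abs-cong V≈ ⟩
            ∣ ι q * w - C * e ∣                 ≤⟨ triangle-− _ _ ⟩
            ∣ ι q * w ∣ + ∣ C * e ∣             ≈⟨ +-cong (ι-abs-* q w) (abs-* C e) ⟩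
            ι q * ∣ w ∣ + ∣ C ∣ * δ             ≤⟨ +-mono-≤ ≤-refl (*-monoˡ-≤ _ (0≤∣x∣ C) δ≤q) ⟩
            ι q * ∣ w ∣ + ∣ C ∣ * ι q           ≈⟨ solve 3 (λ q w c → q :* w :+ c :* q := q :* (w :+ c)) refl (ι q) ∣ w ∣ ∣ C ∣ ⟩
            ι q * (∣ w ∣ + ∣ C ∣)               ∎

        -- If V vanished, then q w = C e, and ∣ e ∣ < q ^ -N′ is too small for this.
        V≉0 : V ≉ 0#
        V≉0 V≈0 = <⇒≱ (*-monoʳ-< ∣ w ∣ 0<∣w∣ δ<) (begin
          1# * ∣ w ∣                            ≤⟨ *-monoʳ-≤ _ (0≤∣x∣ w) (1≤ι {q} (ℕ.≤-trans (ℕ.s≤s ℕ.z≤n) 2≤q)) ⟩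
          ι q * ∣ w ∣                           ≈⟨ sym (ι-abs-* q w) ⟩
          ∣ ι q * w ∣                           ≈⟨ abs-cong (x-y≈0⇒x≈y (trans (sym V≈) V≈0)) ⟩
          ∣ C * e ∣                             ≈⟨ abs-* C e ⟩
          ∣ C ∣ * δ                             ≤⟨ *-monoʳ-≤ δ 0≤δ C≤ ⟩
          ι (2 ℕ.^ k₃) * ∣ w ∣ * δ              ≤⟨ *-monoʳ-≤ δ 0≤δ (*-monoʳ-≤ _ (0≤∣x∣ w) (ι-mono-≤ 2^k₃≤)) ⟩
          ι (q ℕ.^ N′) * ∣ w ∣ * δ              ≈⟨ solve 3 (λ q w d → q :* w :* d := q :* d :* w) refl (ι (q ℕ.^ N′)) ∣ w ∣ δ ⟩
          ι (q ℕ.^ N′) * δ * ∣ w ∣              ∎)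
          where
          2^k₃≤ : 2 ℕ.^ k₃ ℕ.≤ q ℕ.^ N′
          2^k₃≤ = ℕ.≤-trans (ℕ.^-monoˡ-≤ k₃ 2≤q) (ℕ.^-monoʳ-≤ q (ℕ.m≤n+m k₃ ((1 ℕ.+ k₁) ℕ.* N ℕ.+ k₂)))

        close : IsInteger V → IsInteger Y → ∃[ p ] ∃[ q ] 2 ℕ.≤ q × Close y N p q
        close iV@(v , V≈v) (u , Y≈u) = [ positive , negative ]′ (abs-sign V)
          where
          -- Numerator and denominator are doubled so that 2 ≤ Q even if ∣ v ∣ = 1; the sign of V
          -- goes to the numerator.
          Q : ℕ
          Q = 2 ℕ.* ℤ.∣ v ∣
          ∣V∣≈ : ∣ V ∣ ≈ ι ℤ.∣ v ∣
          ∣V∣≈ = trans (abs-cong V≈v) (∣ιℤ∣ v)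
          ιQ≈ : ι Q ≈ ∣ V ∣ + ∣ V ∣
          ιQ≈ = trans (ι-2* ℤ.∣ v ∣) (+-cong (sym ∣V∣≈) (sym ∣V∣≈))
          2≤Q : 2 ℕ.≤ Q
          2≤Q = ℕ.*-monoʳ-≤ 2 (ℕ.n≢0⇒n>0 λ ∣v∣≡0 → V≉0 (trans V≈v (reflexive (≡.cong ιℤ (ℤ.∣i∣≡0⇒i≡0 {v} ∣v∣≡0)))))
          Q≤ : Q ℕ.≤ q ℕ.^ (1 ℕ.+ k₁)
          Q≤ = ℕ.≮⇒≥ λ lt → <⇒≱ (ι-mono-< lt) (≤-trans (≤-reflexive ιQ≈) ∣V∣≤)

          0<eg : 0# < ∣ (e + e) * g ∣
          0<eg = x≉0⇒0<∣x∣ (*-≉0 (λ eq → 0<∣x∣⇒x≉0 0<δ (half eq)) g≉0)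
            where
            half : e + e ≈ 0# → e ≈ 0#
            half eq = *-cancelˡ (>⇒≉ 0<2)
              (trans (solve 1 (λ e → (con (+ 1) :+ con (+ 1)) :* e := e :+ e) refl e) (trans eq (sym (zeroʳ (1# + 1#)))))

          small : ι (Q ℕ.^ N) * ∣ (e + e) * g ∣ < 1#
          small = begin-strict
            ι (Q ℕ.^ N) * ∣ (e + e) * g ∣                    ≈⟨ *-congˡ (trans (abs-cong (solve 2 (λ e g → (e :+ e) :* g := e :* (g :+ g)) refl e g)) (abs-* e (g + g))) ⟩
            ι (Q ℕ.^ N) * (δ * ∣ g + g ∣)                    ≤⟨ *-mono-≤ (0≤ι (Q ℕ.^ N)) (*-nonNeg 0≤δ (0≤ι (q ℕ.^ k₂)))
                (ι-mono-≤ (ℕ.≤-trans (ℕ.^-monoˡ-≤ N Q≤) (ℕ.≤-reflexive (ℕ.^-*-assoc q (1 ℕ.+ k₁) N))))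
                (*-monoˡ-≤ δ 0≤δ (≤-trans (triangle g g) (≤-trans (proj₂ (exponent-bound (∣ g ∣ + ∣ g ∣))) (ι-mono-≤ (ℕ.^-monoˡ-≤ k₂ 2≤q))))) ⟩
            ι (q ℕ.^ ((1 ℕ.+ k₁) ℕ.* N)) * (δ * ι (q ℕ.^ k₂))  ≈⟨ solve 3 (λ x d y → x :* (d :* y) := x :* y :* d) refl (ι (q ℕ.^ ((1 ℕ.+ k₁) ℕ.* N))) δ (ι (q ℕ.^ k₂)) ⟩
            ι (q ℕ.^ ((1 ℕ.+ k₁) ℕ.* N)) * ι (q ℕ.^ k₂) * δ  ≈⟨ *-congʳ (trans (sym (ι-* (q ℕ.^ ((1 ℕ.+ k₁) ℕ.* N)) (q ℕ.^ k₂))) (ι-cong (≡.sym (ℕ.^-distribˡ-+-* q ((1 ℕ.+ k₁) ℕ.* N) k₂)))) ⟩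
            ι (q ℕ.^ ((1 ℕ.+ k₁) ℕ.* N ℕ.+ k₂)) * δ          ≤⟨ ι-scale-≤ (ℕ.^-monoʳ-≤ q (ℕ.m≤m+n ((1 ℕ.+ k₁) ℕ.* N ℕ.+ k₂) k₃)) 0≤δ ⟩
            ι (q ℕ.^ N′) * δ                                 <⟨ δ< ⟩
            1#                                               ∎

          conclude : ∀ i → ∣ ι Q * y - ιℤ i ∣ ≈ ∣ (e + e) * g ∣ → ∃[ p ] ∃[ q ] 2 ℕ.≤ q × Close y N p q
          conclude i eq = i , Q , 2≤Q , <-respʳ-≈ (sym eq) 0<eg , <-respˡ-≈ (*-congˡ (sym eq)) small

          doubled : (V + V) * y - (Y + Y) ≈ (e + e) * g
          doubled = trans (solve 3 (λ V y Y → (V :+ V) :* y :- (Y :+ Y) := (V :* y :- Y) :+ (V :* y :- Y)) refl V y Y)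
            (trans (+-cong Vy-Y Vy-Y) (solve 2 (λ e g → e :* g :+ e :* g := (e :+ e) :* g) refl e g))

          positive : V ≈ ∣ V ∣ → ∃[ p ] ∃[ q ] 2 ℕ.≤ q × Close y N p q
          positive eq = conclude (u ℤ.+ u) (abs-cong (trans (+-cong (*-congʳ (trans ιQ≈ (+-cong (sym eq) (sym eq))))
            (-‿cong (trans (ιℤ-+ u u) (+-cong (sym Y≈u) (sym Y≈u))))) doubled))

          negative : V ≈ - ∣ V ∣ → ∃[ p ] ∃[ q ] 2 ℕ.≤ q × Close y N p q
          negative eq = conclude (ℤ.- (u ℤ.+ u)) (trans (abs-cong (begin-equality
            ι Q * y - ιℤ (ℤ.- (u ℤ.+ u))       ≈⟨ +-cong (*-congʳ ιQ≈) (-‿cong (trans (ιℤ-neg (u ℤ.+ u)) (-‿cong (trans (ιℤ-+ u u) (+-cong (sym Y≈u) (sym Y≈u)))))) ⟩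
            (∣ V ∣ + ∣ V ∣) * y - - (Y + Y)     ≈⟨ solve 3 (λ v y Y → (v :+ v) :* y :- :- (Y :+ Y) := :- ((:- v :+ :- v) :* y :- (Y :+ Y))) refl ∣ V ∣ y Y ⟩
            - ((- ∣ V ∣ + - ∣ V ∣) * y - (Y + Y))  ≈⟨ -‿cong (+-congʳ (*-congʳ (+-cong (sym eq) (sym eq)))) ⟩
            - ((V + V) * y - (Y + Y))           ≈⟨ -‿cong doubled ⟩
            - ((e + e) * g)                     ∎)) (abs-neg _))

-- Open intervals, inverse transformations, and both directions of the theorem.

module MailletProperty (em : ExcludedMiddle 0ℓ) (ℝ : CompleteOrderedField) where
  open Preservation em ℝ
  open Extrema _<_ using (_<±_)

  smaller : ∀ {x} → 0# < x → ∃[ r ] 0# < r × r < x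
  smaller {x} 0<x = from (radius (1# + 1#) 0<x)
    where
    from : ∃[ r ] 0# < r × (1# + 1#) * r ≤ x → ∃[ r ] 0# < r × r < x
    from (r , 0<r , 2r≤x) = r , 0<r , <-≤-trans
      (linear-< 0<r (solve 1 (λ r → (con (+ 1) :+ con (+ 1)) :* r :- r := r :- con (+ 0)) refl r)) 2r≤x

  OpenAt : (Carrier → Set) → Carrier → Set
  OpenAt P x = ∃[ r ] 0# < r × (∀ {y} → Ball x r y → P y)

  left-open : ∀ {x u} → u <± ⟨ x ⟩ → OpenAt (λ y → u <± ⟨ y ⟩) x
  left-open Supremum.[ Infimum.⊥₋<[ _ ] ] = 1# , 0<1 , λ _ → Supremum.[ Infimum.⊥₋<[ _ ] ]
  left-open {x} {⟨ k ⟩} Supremum.[ Infimum.[ k<x ] ] = from (smaller (0<y-x k<x))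
    where
    from : ∃[ r ] 0# < r × r < x - k → OpenAt (λ y → ⟨ k ⟩ <± ⟨ y ⟩) x
    from (r , 0<r , r<) = r , 0<r , λ {y} y∈ → Supremum.[ Infimum.[
      linear-< (+-mono-≤-< (proj₁ (abs-bound y∈)) r<)
        (solve 4 (λ k x y r → y :- k := ((y :- x) :+ (x :- k)) :- (:- r :+ r)) refl k x y r) ] ]

  right-open : ∀ {x v} → ⟨ x ⟩ <± v → OpenAt (λ y → ⟨ y ⟩ <± v) x
  right-open Supremum.[ _ ]<⊤⁺ = 1# , 0<1 , λ _ → Supremum.[ _ ]<⊤⁺
  right-open {x} {⟨ k ⟩} Supremum.[ Infimum.[ x<k ] ] = from (smaller (0<y-x x<k))
    where
    from : ∃[ r ] 0# < r × r < k - x → OpenAt (λ y → ⟨ y ⟩ <± ⟨ k ⟩) x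
    from (r , 0<r , r<) = r , 0<r , λ {y} y∈ → Supremum.[ Infimum.[
      linear-< (+-mono-≤-< (proj₂ (abs-bound y∈)) r<)
        (solve 4 (λ k x y r → k :- y := (r :+ (k :- x)) :- ((y :- x) :+ r)) refl k x y r) ] ]

  interval-open : ∀ {x u v} → OpenInterval u v x → OpenAt (OpenInterval u v) x
  interval-open {x} {u} {v} (u<x , x<v) = from (left-open u<x) (right-open x<v)
    where
    from : OpenAt (λ y → u <± ⟨ y ⟩) x → OpenAt (λ y → ⟨ y ⟩ <± v) x → OpenAt (OpenInterval u v) x
    from (r , 0<r , left) (r′ , 0<r′ , right) = meet (lower-bound₂ 0<r 0<r′)
      where
      meet : ∃[ s ] 0# < s × s ≤ r × s ≤ r′ → OpenAt (OpenInterval u v) x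
      meet (s , 0<s , s≤r , s≤r′) = s , 0<s , λ y∈ → left (ball-weaken s≤r y∈) , right (ball-weaken s≤r′ y∈)

  module _ (a b c d : Carrier) (Δ≉0 : a * d - b * c ≉ 0#) where
    open Möbius a b c d using (Domain; M)

    T T⁻¹ : Transformation
    T   = record { a = a ; b = b ; c = c ; d = d ; Δ≉0 = Δ≉0 }
    T⁻¹ = record { a = d ; b = - b ; c = - c ; d = a ; Δ≉0 = λ eq → Δ≉0
      (trans (solve 4 (λ a b c d → a :* d :- b :* c := d :* a :- :- b :* :- c) refl a b c d) eq) }

    open Transformation T hiding (a; b; c; d; Δ≉0)
    open RationalMultiple T
    module Inverse = Transformation T⁻¹

    -- `M` uses the inverse supplied with the proof of x ∈ D, `apply` the total `_⁻¹`; inverses are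
    -- unique.
    M≈apply : ∀ x (x∈D : Domain x) → M x x∈D ≈ apply x
    M≈apply x x∈D = *-congˡ (*-cancelˡ x∈D (trans (*-recip x∈D) (sym (*-⁻¹ x∈D))))

    module _ {x} (w≉0 : denominator x ≉ 0#) where
      inverse-denominator : Inverse.denominator (apply x) * denominator x ≈ Δ
      inverse-denominator = trans (solve 4 (λ a c f w → (:- c :* f :+ a) :* w := a :* w :- c :* (f :* w)) refl a c (apply x) (denominator x))
        (trans (+-congˡ (-‿cong (*-congˡ (apply-denominator w≉0))))
          (solve 5 (λ a b c d x → a :* (c :* x :+ d) :- c :* (a :* x :+ b) := a :* d :- b :* c) refl a b c d x))

      inverse-regular : Inverse.denominator (apply x) ≉ 0#
      inverse-regular eq = Δ≉0 (trans (sym inverse-denominator) (trans (*-congʳ eq) (zeroˡ _)))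

      inverse-apply : Inverse.apply (apply x) ≈ x
      inverse-apply = *-cancelˡ inverse-regular (begin
        v * Inverse.apply y              ≈⟨ *-comm v _ ⟩
        Inverse.apply y * v              ≈⟨ Inverse.apply-denominator inverse-regular ⟩
        d * y + - b                      ≈⟨ solve 6 (λ a b c d x y → d :* y :+ :- b := y :* (c :* x :+ d) :- c :* x :* y :- b) refl a b c d x y ⟩
        y * denominator x - c * x * y - b  ≈⟨ +-congʳ (+-congʳ (apply-denominator w≉0)) ⟩
        (a * x + b) - c * x * y - b      ≈⟨ solve 5 (λ a b c x y → (a :* x :+ b) :- c :* x :* y :- b := (:- c :* y :+ a) :* x) refl a b c x y ⟩
        v * x                            ∎)
        where
        open import Relation.Binary.Reasoning.Setoid setoid
        y v : Carrier
        y = apply x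
        v = Inverse.denominator y

    module _ {y} (v≉0 : Inverse.denominator y ≉ 0#) where
      private
        x v : Carrier
        x = Inverse.apply y
        v = Inverse.denominator y

      denominator-inverse : denominator x * v ≈ Δ
      denominator-inverse = trans (solve 4 (λ c d x v → (c :* x :+ d) :* v := c :* (x :* v) :+ d :* v) refl c d x v)
        (trans (+-congʳ (*-congˡ (Inverse.apply-denominator v≉0)))
          (solve 5 (λ a b c d y → c :* (d :* y :+ :- b) :+ d :* (:- c :* y :+ a) := a :* d :- b :* c) refl a b c d y))

      regular-inverse : denominator x ≉ 0#
      regular-inverse eq = Δ≉0 (trans (sym denominator-inverse) (trans (*-congʳ eq) (zeroˡ _)))

      apply-inverse : apply x ≈ y
      apply-inverse = *-cancelˡ (*-≉0 regular-inverse v≉0) (begin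
        denominator x * v * apply x          ≈⟨ solve 3 (λ w v f → w :* v :* f := f :* w :* v) refl (denominator x) v (apply x) ⟩
        apply x * denominator x * v          ≈⟨ *-congʳ (apply-denominator regular-inverse) ⟩
        (a * x + b) * v                      ≈⟨ solve 4 (λ a b x v → (a :* x :+ b) :* v := a :* (x :* v) :+ b :* v) refl a b x v ⟩
        a * (x * v) + b * v                  ≈⟨ +-congʳ (*-congˡ (Inverse.apply-denominator v≉0)) ⟩
        a * (d * y + - b) + b * v            ≈⟨ solve 5 (λ a b c d y → a :* (d :* y :+ :- b) :+ b :* (:- c :* y :+ a) := (a :* d :- b :* c) :* y) refl a b c d y ⟩
        Δ * y                                ≈⟨ *-congʳ (sym denominator-inverse) ⟩
        denominator x * v * y                ∎)
        where open import Relation.Binary.Reasoning.Setoid setoid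

    fractions-in-ball : ∀ c {r} → 0# < r → ∃[ p ] Σ[ q ∈ ℕ ] (∀ i → i ℕ.≤ 2 → Ball c r ((p ℤ.+ + i) / suc q))
    fractions-in-ball c {r} 0<r = p , q , λ i i≤2 → *-cancelˡ-≤ (ι (suc q)) (0<fromℕ-suc q)
        (≤-trans (proj₂ fractions i i≤2) (≤-trans (proj₂ n) (ι-scale-≤ (ℕ.n≤1+n q) (<⇒≤ 0<r))))
      where
      n = quotient-bound (ι 2) 0<r
      q : ℕ
      q = proj₁ n
      fractions = fractions-near c (suc q) 2 (ℕ.s≤s ℕ.z≤n)
      p : ℤ
      p = proj₁ fractions

    -- The candidates are pulled back from three fractions near M(x*) by the inverse transformation.
    -- Its Lipschitz constant tells how near these must be, and its `colipschitz` bound keeps the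
    -- preimages distinct.
    irrational-preimage : ¬ M∈ℚ⟨x⟩ → ∀ {x*} → denominator x* ≉ 0# → ∀ {r} → 0# < r →
      ∃[ x ] Ball x* r x × denominator x ≉ 0# × Rational (apply x) × ¬ Rational x
    irrational-preimage M∉ {x*} w≉0 {r} 0<r = from (Inverse.locally-biLipschitz (inverse-regular w≉0) 0<1)
      where
      y* : Carrier
      y* = apply x*
      Goal : Set
      Goal = ∃[ x ] Ball x* r x × denominator x ≉ 0# × Rational (apply x) × ¬ Rational x
      from : ∃[ R ] R ≤ 1# × Inverse.BiLipschitz y* R → Goal
      from (R , _ , biLip) = search em
        where
        open Inverse.BiLipschitz biLip using (0<R; regular; L; lipschitz; colipschitz)
        r₁ = radius (ι L) 0<r
        r₂ = lower-bound₂ 0<R (proj₁ (proj₂ r₁))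
        ρ : Carrier
        ρ = proj₁ r₂
        ρ≤R : ρ ≤ R
        ρ≤R = proj₁ (proj₂ (proj₂ r₂))
        Lρ≤r : ι L * ρ ≤ r
        Lρ≤r = ≤-trans (*-monoˡ-≤ _ (0≤ι L) (proj₂ (proj₂ (proj₂ r₂)))) (proj₂ (proj₂ r₁))
        fractions = fractions-in-ball y* (proj₁ (proj₂ r₂))
        p = proj₁ fractions
        q = proj₁ (proj₂ fractions)
        s x : ℕ → Carrier
        s i = (p ℤ.+ + i) / suc q
        x i = Inverse.apply (s i)
        s∈ρ : ∀ i → i ℕ.≤ 2 → Ball y* ρ (s i)
        s∈ρ = proj₂ (proj₂ fractions)
        s∈ : ∀ i → i ℕ.≤ 2 → Ball y* R (s i)
        s∈ i i≤2 = ball-weaken ρ≤R (s∈ρ i i≤2)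
        s-rational : ∀ i → Rational (s i)
        s-rational i = suc q , ℕ.s≤s ℕ.z≤n , den-/ (p ℤ.+ + i) (suc q)
        x∈ : ∀ i → i ℕ.≤ 2 → Ball x* r (x i)
        x∈ i i≤2 = begin
          ∣ x i - x* ∣                    ≈⟨ abs-cong (+-congˡ (-‿cong (sym (inverse-apply w≉0)))) ⟩
          ∣ x i - Inverse.apply y* ∣      ≤⟨ lipschitz (s∈ i i≤2) (ball-centre y* (<⇒≤ 0<R)) ⟩
          ι L * ∣ s i - y* ∣              ≤⟨ *-monoˡ-≤ _ (0≤ι L) (s∈ρ i i≤2) ⟩
          ι L * ρ                         ≤⟨ Lρ≤r ⟩
          r                               ∎
          where open ≤-Reasoning
        w≉ : ∀ i → i ℕ.≤ 2 → denominator (x i) ≉ 0#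
        w≉ i i≤2 = regular-inverse (regular (s∈ i i≤2))
        apply-x : ∀ i → i ℕ.≤ 2 → apply (x i) ≈ s i
        apply-x i i≤2 = apply-inverse (regular (s∈ i i≤2))
        apply-rational : ∀ i → i ℕ.≤ 2 → Rational (apply (x i))
        apply-rational i i≤2 = rational-resp (sym (apply-x i i≤2)) (s-rational i)
        x-distinct : ∀ i j → i ≢ j → i ℕ.≤ 2 → j ℕ.≤ 2 → x i ≉ x j
        x-distinct i j i≢j i≤2 j≤2 eq = <⇒≱ (x≉0⇒0<∣x∣ λ s≈ → fractions-distinct p (suc q) i≢j (x-y≈0⇒x≈y s≈))
          (≤-trans (colipschitz (s∈ i i≤2) (s∈ j j≤2)) (≤-reflexive (trans (*-congˡ (x≈0⇒∣x∣≈0 (x≈y⇒x-y≈0 eq))) (zeroʳ _))))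
        Irrational : ℕ → Set
        Irrational i = i ℕ.≤ 2 × ¬ Rational (x i)
        search : Dec (∃ Irrational) → Goal
        search (yes (i , i≤2 , irr)) = x i , x∈ i i≤2 , w≉ i i≤2 , apply-rational i i≤2 , irr
        search (no none) = contradiction (proportional⇒M∈ℚ⟨x⟩ (clear-denominators (three-rational-points
            (w≉ 0 0≤2) (w≉ 1 1≤2) (w≉ 2 2≤2) (rational 0 0≤2) (rational 1 1≤2) (rational 2 2≤2)
            (apply-rational 0 0≤2) (apply-rational 1 1≤2) (apply-rational 2 2≤2)
            (x-distinct 0 1 (λ ()) 0≤2 1≤2)
            (λ eq → fractions-distinct p (suc q) {0} {2} (λ ()) (trans (sym (apply-x 0 0≤2)) (trans eq (apply-x 2 2≤2))))
            (x-distinct 1 2 (λ ()) 1≤2 2≤2)))) M∉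
          where
          0≤2 : 0 ℕ.≤ 2
          0≤2 = ℕ.z≤n
          1≤2 : 1 ℕ.≤ 2
          1≤2 = ℕ.s≤s ℕ.z≤n
          2≤2 : 2 ℕ.≤ 2
          2≤2 = ℕ.≤-refl
          rational : ∀ i → i ℕ.≤ 2 → Rational (x i)
          rational i i≤2 = decide em
            where
            decide : Dec (Rational (x i)) → Rational (x i)
            decide (yes rat) = rat
            decide (no irr)  = contradiction (i , i≤2 , irr) none

    counterexample : ¬ M∈ℚ⟨x⟩ → ∀ u v → Satisfiable (OpenInterval u v) → (I⊆D : OpenInterval u v ⊆ Domain) →
      ∃[ ξ ] Σ[ ξ∈I ∈ OpenInterval u v ξ ] Liouville ξ × ¬ Liouville (M ξ (I⊆D ξ∈I))
    counterexample M∉ u v (x* , x*∈I) I⊆D = from₁ (interval-open x*∈I)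
      where
      Goal : Set
      Goal = ∃[ ξ ] Σ[ ξ∈I ∈ OpenInterval u v ξ ] Liouville ξ × ¬ Liouville (M ξ (I⊆D ξ∈I))
      finish : ∀ {ξ} → OpenInterval u v ξ → Liouville ξ → ¬ Liouville (apply ξ) → Goal
      finish {ξ} ξ∈I L ¬L = ξ , ξ∈I , L , λ L′ → ¬L (liouville-resp (M≈apply ξ (I⊆D ξ∈I)) L′)
      from₁ : OpenAt (OpenInterval u v) x* → Goal
      from₁ (r , 0<r , inside) = from₂ (irrational-preimage M∉ (I⊆D x*∈I) 0<r)
        where
        from₂ : ∃[ x ] Ball x* r x × denominator x ≉ 0# × Rational (apply x) × ¬ Rational x → Goal
        from₂ (x₀ , x₀∈ , w₀≉0 , (Q₀ , 0<Q₀ , den-f) , irrational) = split em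
          where
          split : Dec (Liouville x₀) → Goal
          split (yes L) = finish (inside x₀∈) L (rational⇒¬liouville (Q₀ , 0<Q₀ , den-f))
          split (no ¬L) = from₃ (interval-open (inside x₀∈))
            where
            from₃ : OpenAt (OpenInterval u v) x₀ → Goal
            from₃ (r₀ , 0<r₀ , inside₀) = from₄ (locally-biLipschitz w₀≉0 0<r₀) (¬liouville⇒repelled irrational ¬L)
              where
              from₄ : ∃[ R ] R ≤ r₀ × BiLipschitz x₀ R → ∃[ κ ] Repelled κ x₀ → Goal
              from₄ (R , R≤r₀ , biLip) (κ , repelled) = from₅ (Conclusion.conclusion germ)
                where
                open BiLipschitz biLip
                germ : Germ apply x₀ R
                germ = record
                  { 0<R = 0<R ; 2R≤1 = 2R≤1 ; L = L ; 1≤L = 1≤L ; lipschitz = lipschitz ; colipschitz = colipschitz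
                  ; cross-ratio = λ x₁∈ x₂∈ x₃∈ → cross-ratio w₀≉0 (regular x₁∈) (regular x₂∈) (regular x₃∈)
                  ; Q₀ = Q₀ ; 0<Q₀ = 0<Q₀ ; den-f-x₀ = den-f ; κ = κ ; repelled-x₀ = repelled
                  }
                from₅ : ∃[ ξ ] Ball x₀ R ξ × Liouville ξ × ¬ Liouville (apply ξ) → Goal
                from₅ (ξ , ξ∈ , L , ¬L) = finish (inside₀ (ball-weaken R≤r₀ ξ∈)) L ¬L

    -- The point 0 serves unless d ≈ 0#; then Δ ≉ 0# forces c ≉ 0#, and 1 serves.
    domain-nonempty : ∃ Domain
    domain-nonempty = split (d ≟ 0#)
      where
      open import Relation.Binary.Reasoning.Setoid setoid
      split : Dec (d ≈ 0#) → ∃ Domain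
      split (no d≉0)  = 0# , λ eq → d≉0 (trans (sym (trans (+-congʳ (zeroʳ c)) (+-identityˡ d))) eq)
      split (yes d≈0) = 1# , λ eq → Δ≉0 (begin
        a * d - b * c                ≈⟨ solve 4 (λ a b c d → a :* d :- b :* c := (a :+ b) :* d :- b :* (c :* con (+ 1) :+ d)) refl a b c d ⟩
        (a + b) * d - b * (c * 1# + d)  ≈⟨ +-cong (*-congˡ d≈0) (-‿cong (*-congˡ eq)) ⟩
        (a + b) * 0# - b * 0#        ≈⟨ solve 2 (λ x b → x :* con (+ 0) :- b :* con (+ 0) := con (+ 0)) refl (a + b) b ⟩
        0#                           ∎)

    -- Follows from `counterexample` on one interval inside the domain; `locally-biLipschitz`
    -- provides a ball on which the denominator does not vanish.
    maillet⇒M∈ℚ⟨x⟩ : HasMailletProperty Domain M → M∈ℚ⟨x⟩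
    maillet⇒M∈ℚ⟨x⟩ maillet = decide em
      where
      decide : Dec M∈ℚ⟨x⟩ → M∈ℚ⟨x⟩
      decide (yes M∈) = M∈
      decide (no M∉)  = ⊥-elim (from₁ domain-nonempty)
        where
        from₁ : ∃ Domain → ⊥
        from₁ (x* , w≉0) = from₂ (locally-biLipschitz w≉0 0<1)
          where
          from₂ : ∃[ R ] R ≤ 1# × BiLipschitz x* R → ⊥
          from₂ (R , _ , biLip) = from₃ (counterexample M∉ ⟨ x* - R ⟩ ⟨ x* + R ⟩ (x* , x*∈) I⊆D)
            where
            open BiLipschitz biLip
            x*∈ : OpenInterval ⟨ x* - R ⟩ ⟨ x* + R ⟩ x*
            x*∈ = Supremum.[ Infimum.[ linear-< 0<R (solve 2 (λ x R → x :- (x :- R) := R :- con (+ 0)) refl x* R) ] ]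
                , Supremum.[ Infimum.[ linear-< 0<R (solve 2 (λ x R → (x :+ R) :- x := R :- con (+ 0)) refl x* R) ] ]
            I⊆D : OpenInterval ⟨ x* - R ⟩ ⟨ x* + R ⟩ ⊆ Domain
            I⊆D {x} (Supremum.[ Infimum.[ lo ] ] , Supremum.[ Infimum.[ hi ] ]) = regular (abs-≤
              (<⇒≤ (linear-< hi (solve 3 (λ x y R → R :- (y :- x) := (x :+ R) :- y) refl x* x R)))
              (<⇒≤ (linear-< lo (solve 3 (λ x y R → R :- (:- (y :- x)) := y :- (x :- R)) refl x* x R))))
            from₃ : ∃[ ξ ] Σ[ ξ∈I ∈ OpenInterval ⟨ x* - R ⟩ ⟨ x* + R ⟩ ξ ] Liouville ξ × ¬ Liouville (M ξ (I⊆D ξ∈I)) → ⊥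
            from₃ (ξ , ξ∈I , L , ¬L) = ¬L (maillet ξ (I⊆D ξ∈I) L)

    M∈ℚ⟨x⟩⇒maillet : M∈ℚ⟨x⟩ → HasMailletProperty Domain M
    M∈ℚ⟨x⟩⇒maillet M∈ ξ ξ∈D L = liouville-resp (sym (M≈apply ξ ξ∈D)) (wellApproximable⇒liouville
      (integral-preserves T (clear-denominators (M∈ℚ⟨x⟩⇒proportional M∈)) ξ∈D (liouville⇒wellApproximable L)))

theorem1p4 : ExcludedMiddle 0ℓ →
    (ℝ : CompleteOrderedField) →
    let open CompleteOrderedField ℝ
        open RealNumbers ℝ
    in
    (a b c d : Carrier) → a * d - b * c ≉ 0# →
    let open Möbius a b c d
    in
    (HasMailletProperty Domain M ⇔ M∈ℚ⟨x⟩)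
    ×
    (¬ M∈ℚ⟨x⟩ →
     ∀ u v → Satisfiable (OpenInterval u v) →
     (I⊆D : OpenInterval u v ⊆ Domain) →
     ∃[ ξ ] Σ[ ξ∈I ∈ OpenInterval u v ξ ]
       Liouville ξ × ¬ Liouville (M ξ (I⊆D ξ∈I)))
theorem1p4 em ℝ a b c d Δ≉0 = mk⇔ (maillet⇒M∈ℚ⟨x⟩ a b c d Δ≉0) (M∈ℚ⟨x⟩⇒maillet a b c d Δ≉0) , counterexample a b c d Δ≉0
  where open MailletProperty em ℝ
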